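{- (1) Let $L$ be a finite $(3,3)$-homogeneous orthomodular poset with exactly $15$ atoms. Then $L$ is isomorphic (as an orthomodular poset) to $\mathcal{L}^{3}_{2}=\{X\subset\{1,\dots,6\}\mid \operatorname{card}X\equiv 0 \pmod 2\}$. (2) There exist finite $(3,3)$-homogeneous orthomodular posets $L_{17}$ and $L_{27}$, having exactly $17$ and exactly $27$ atoms respectively, such that: (a) the set $S_2(L_{17})$ of two-valued states on $L_{17}$ is empty, and the convex set $S(L_{17})$ of all states on $L_{17}$ is (affinely) isomorphic to the segment $[0,\tfrac23]\subset\mathbb{R}$; (b) the set $S_2(L_{27})$ of two-valued states on $L_{27}$ is full, and the total representation of $L_{27}$ is a regular concrete logic.
   Context: An orthomodular poset (OMP) is a poset $L$ with least element $0$ and greatest element $1$ and an order-reversing involution $x\mapsto x^{\perp}$ such that $x\wedge x^{\perp}=0$ and $x\vee x^{\perp}=1$, such that $x\vee y$ exists whenever $x\perp y$ (i.e. $x\le y^{\perp}$), and such that $x\le y$ implies $y=x\vee(y\wedge x^{\perp})$. Isomorphisms of OMPs are order isomorphisms preserving the orthocomplementation. For a finite OMP $L$, a block is a maximal (with respect to inclusion) set of pairwise orthogonal atoms. $L$ is $(n,m)$-homogeneous if every atom of $L$ is contained in exactly $n$ blocks and every block has exactly $m$ elements. The set $\mathcal{L}^{3}_{2}$ is ordered by inclusion, with set complement in $\{1,\dots,6\}$ as orthocomplementation. A state on $L$ is a map $s:L\to[0,1]$ with $s(1)=1$ and $s(x\vee y)=s(x)+s(y)$ whenever $x\perp y$.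 $S(L)$ is the convex set of all states on $L$, and $S_2(L)$ is the set of states taking values only in $\{0,1\}$ (two-valued states). A set $T\subset S_2(L)$ is full if for all $x,y\in L$: $x\le y$ if and only if $f(x)\le f(y)$ for all $f\in T$. A concrete logic on a set $\Omega$ is a subset $\mathcal{E}$ of the power set $\mathcal{P}(\Omega)$ such that $\Omega\in\mathcal{E}$; $x\in\mathcal{E}$ implies $\Omega\setminus x\in\mathcal{E}$; and $x,y\in\mathcal{E}$, $x\cap y=\emptyset$ imply $x\cup y\in\mathcal{E}$. A signed measure on a concrete logic $\mathcal{E}$ is a function $\mu:\mathcal{E}\to\mathbb{R}$ with $\mu(x\cup y)=\mu(x)+\mu(y)$ for all disjoint $x,y\in\mathcal{E}$. $\mathcal{E}$ is regular if every signed measure on $\mathcal{E}$ extends to a signed measure on $\mathcal{P}(\Omega)$. If $S_2(L)$ is full, then the sets $x'=\{\mu\in S_2(L)\mid \mu(x)=1\}$, $x\in L$, form a concrete logic $\mathcal{E}(L)$ on $\Omega=S_2(L)$, called the total representation of $L$. -}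

module Defs where

open import Level using (Level; _⊔_; 0ℓ) renaming (suc to lsuc)
open import Algebra.Definitions using (Involutive)
open import Data.Bool.Base using (Bool; true; false; not; _∨_)
open import Data.Fin.Base using (Fin)
import Data.Fin.Subset as FS
import Data.Fin.Subset.Properties as FSₚ
open import Data.Integer.Base using (+<+)
open import Data.Nat.Base as ℕ using (ℕ)
import Data.Nat.Properties as ℕₚ
import Data.Nat.Divisibility as ℕ∣
open import Data.Product.Base using (Σ-syntax; ∃; ∃-syntax; _×_; _,_; proj₁; proj₂)
open import Data.Rational.Base as ℚ using (ℚ; 0ℚ; 1ℚ; ½)
import Data.Rational.Properties as ℚₚ
import Data.Rational.Solver as ℚSolver
open import Data.Sum.Base using (_⊎_; [_,_]′)
open import Data.Vec.Base using ([]; _∷_; here; there)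
open import Function.Base using (_∘_)
open import Function.Bundles using (Func; _⟨$⟩_; Inverse; _⇔_)
open import Function.Relation.Binary.Setoid.Equality using (_⇨_)
open import Relation.Binary.Bundles using (Poset; Setoid)
import Relation.Binary.Construct.On as On
open import Relation.Binary.Core using (Rel)
open import Relation.Binary.Definitions using (Antitonic₁; Decidable; Maximum; Minimum)
open import Relation.Binary.Morphism.Structures using (IsOrderIsomorphism)
import Relation.Binary.PropositionalEquality as ≡
open ≡ using (_≡_)
open import Relation.Nullary using (¬_; contradiction; yes; no)
open import Relation.Unary using (Pred; U)

private
  variable
    c ℓ ℓ₁ ℓ₂ c′ ℓ₁′ ℓ₂′ p e : Level

-- Real numbers are Cauchy sequences of rationals, with _≈ℝ_ identifying
-- sequences whose difference is null; _≤ℝ_ is the induced order.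

record ℝ : Set where
  constructor mkℝ
  field
    seq    : ℕ → ℚ
    cauchy : ∀ {ε} → 0ℚ ℚ.< ε →
             ∃[ N ] (∀ {m n} → N ℕ.≤ m → N ℕ.≤ n → ℚ.∣ seq m ℚ.- seq n ∣ ℚ.≤ ε)

open ℝ public

infix 4 _≈ℝ_ _≤ℝ_

_≈ℝ_ : Rel ℝ 0ℓ
x ≈ℝ y = ∀ {ε} → 0ℚ ℚ.< ε →
         ∃[ N ] (∀ {n} → N ℕ.≤ n → ℚ.∣ seq x n ℚ.- seq y n ∣ ℚ.≤ ε)

_≤ℝ_ : Rel ℝ 0ℓ
x ≤ℝ y = ∀ {ε} → 0ℚ ℚ.< ε →
         ∃[ N ] (∀ {n} → N ℕ.≤ n → seq x n ℚ.≤ seq y n ℚ.+ ε)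

private
  ½-pos : ∀ {ε} → 0ℚ ℚ.< ε → 0ℚ ℚ.< ε ℚ.* ½
  ½-pos 0<ε = ℚₚ.*-monoˡ-<-pos ½ 0<ε

  halves : ∀ ε → ε ℚ.* ½ ℚ.+ ε ℚ.* ½ ≡ ε
  halves ε = ≡.trans (≡.sym (ℚₚ.*-distribˡ-+ ε ½ ½)) (ℚₚ.*-identityʳ ε)

  open ℚSolver.+-*-Solver using (solve; _:=_; _:+_; _:-_; _:*_; :-_)

  ∣-∣-sym : ∀ a b → ℚ.∣ a ℚ.- b ∣ ≡ ℚ.∣ b ℚ.- a ∣
  ∣-∣-sym a b = ≡.trans (≡.sym (ℚₚ.∣-p∣≡∣p∣ (a ℚ.- b)))
    (≡.cong ℚ.∣_∣ (solve 2 (λ a b → :- (a :- b) := b :- a) ≡.refl a b))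

  ∣0∣≤ : ∀ a {ε} → 0ℚ ℚ.< ε → ℚ.∣ a ℚ.- a ∣ ℚ.≤ ε
  ∣0∣≤ a {ε} 0<ε = ≡.subst (λ d → ℚ.∣ d ∣ ℚ.≤ ε) (≡.sym (ℚₚ.+-inverseʳ a)) (ℚₚ.<⇒≤ 0<ε)

  split : ∀ {a b d α β γ} → d ≡ a ℚ.+ b → α ℚ.+ β ≡ γ →
          ℚ.∣ a ∣ ℚ.≤ α → ℚ.∣ b ∣ ℚ.≤ β → ℚ.∣ d ∣ ℚ.≤ γ
  split {a} {b} ≡.refl ≡.refl a≤ b≤ =
    ℚₚ.≤-trans (ℚₚ.∣p+q∣≤∣p∣+∣q∣ a b) (ℚₚ.+-mono-≤ a≤ b≤)

  bound : (x : ℝ) → ∃[ K ] (0ℚ ℚ.< K × ∃[ N ] (∀ {n} → N ℕ.≤ n → ℚ.∣ seq x n ∣ ℚ.≤ K))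
  bound x with cauchy x {1ℚ} (ℚ.*<* (+<+ (ℕ.s≤s ℕ.z≤n)))
  ... | N , close = ℚ.∣ seq x N ∣ ℚ.+ 1ℚ
                  , ℚₚ.+-mono-≤-< (ℚₚ.0≤∣p∣ (seq x N)) (ℚₚ.positive⁻¹ 1ℚ)
                  , N
                  , λ {n} N≤n → split {a = seq x N} {b = seq x n ℚ.- seq x N}
                      (solve 2 (λ a b → b := a :+ (b :- a)) ≡.refl (seq x N) (seq x n))
                      ≡.refl ℚₚ.≤-refl (close N≤n ℕₚ.≤-refl)

  ∣*∣≤ : ∀ {a b α β} → ℚ.∣ a ∣ ℚ.≤ α → ℚ.∣ b ∣ ℚ.≤ β → ℚ.∣ a ℚ.* b ∣ ℚ.≤ α ℚ.* β
  ∣*∣≤ {a} {b} {α} {β} a≤ b≤ = begin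
    ℚ.∣ a ℚ.* b ∣        ≡⟨ ℚₚ.∣p*q∣≡∣p∣*∣q∣ a b ⟩
    ℚ.∣ a ∣ ℚ.* ℚ.∣ b ∣  ≤⟨ ℚₚ.*-monoʳ-≤-nonNeg ℚ.∣ b ∣ {{ℚₚ.∣-∣-nonNeg b}} a≤ ⟩
    α ℚ.* ℚ.∣ b ∣        ≤⟨ ℚₚ.*-monoˡ-≤-nonNeg α {{ℚ.nonNegative (ℚₚ.≤-trans (ℚₚ.0≤∣p∣ a) a≤)}} b≤ ⟩
    α ℚ.* β              ∎
    where open ℚₚ.≤-Reasoning

  N₁≤ : ∀ {i j n} → i ℕ.⊔ j ℕ.≤ n → i ℕ.≤ n
  N₁≤ {i} {j} = ℕₚ.≤-trans (ℕₚ.m≤m⊔n i j)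

  N₂≤ : ∀ {i j n} → i ℕ.⊔ j ℕ.≤ n → j ℕ.≤ n
  N₂≤ {i} {j} = ℕₚ.≤-trans (ℕₚ.m≤n⊔m i j)

ℝ-setoid : Setoid 0ℓ 0ℓ
ℝ-setoid = record
  { Carrier = ℝ
  ; _≈_ = _≈ℝ_
  ; isEquivalence = record
    { refl  = λ {x} 0<ε → 0 , λ {n} _ → ∣0∣≤ (seq x n) 0<ε
    ; sym   = λ {x} {y} x≈y 0<ε → let N , h = x≈y 0<ε in
        N , λ {n} N≤n → ≡.subst (ℚ._≤ _) (∣-∣-sym (seq x n) (seq y n)) (h N≤n)
    ; trans = λ {x} {y} {z} x≈y y≈z {ε} 0<ε →
        let N₁ , h₁ = x≈y (½-pos 0<ε)
            N₂ , h₂ = y≈z (½-pos 0<ε)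
        in N₁ ℕ.⊔ N₂ , λ {n} N≤n →
          split {a = seq x n ℚ.- seq y n} {b = seq y n ℚ.- seq z n}
            (solve 3 (λ a b c → a :- c := (a :- b) :+ (b :- c)) ≡.refl
              (seq x n) (seq y n) (seq z n))
            (halves ε) (h₁ (N₁≤ {N₁} N≤n)) (h₂ (N₂≤ {N₁} N≤n))
    }
  }

fromℚ : ℚ → ℝ
fromℚ q = mkℝ (λ _ → q) (λ 0<ε → 0 , λ _ _ → ∣0∣≤ q 0<ε)

0ℝ 1ℝ : ℝ
0ℝ = fromℚ 0ℚ
1ℝ = fromℚ 1ℚ

infixl 6 _+ℝ_
infixl 7 _*ℝ_

_+ℝ_ : ℝ → ℝ → ℝ
x +ℝ y = mkℝ (λ n → seq x n ℚ.+ seq y n) λ {ε} 0<ε →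
  let N₁ , h₁ = cauchy x (½-pos 0<ε)
      N₂ , h₂ = cauchy y (½-pos 0<ε)
  in N₁ ℕ.⊔ N₂ , λ {m} {n} N≤m N≤n →
    split {a = seq x m ℚ.- seq x n} {b = seq y m ℚ.- seq y n}
      (solve 4 (λ a b c d → (a :+ b) :- (c :+ d) := (a :- c) :+ (b :- d)) ≡.refl
        (seq x m) (seq y m) (seq x n) (seq y n))
      (halves ε)
      (h₁ (N₁≤ {N₁} N≤m) (N₁≤ {N₁} N≤n)) (h₂ (N₂≤ {N₁} N≤m) (N₂≤ {N₁} N≤n))

_*ℝ_ : ℝ → ℝ → ℝ
x *ℝ y = mkℝ (λ n → seq x n ℚ.* seq y n) λ {ε} 0<ε →
  let Kx , 0<Kx , Nx , bx = bound x
      Ky , 0<Ky , Ny , by = bound y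
      K = Kx ℚ.+ Ky
      instance
        K-pos : ℚ.Positive K
        K-pos = ℚ.positive (ℚₚ.+-mono-< 0<Kx 0<Ky)
        K-nonZero : ℚ.NonZero K
        K-nonZero = ℚₚ.pos⇒nonZero K
      δ = ε ℚ.* (ℚ.1/ K)
      0<δ = ≡.subst (ℚ._< δ) (ℚₚ.*-zeroˡ (ℚ.1/ K))
              (ℚₚ.*-monoˡ-<-pos (ℚ.1/ K) {{ℚₚ.1/pos⇒pos K}} 0<ε)
      Kδ≡ε = ≡.trans (≡.sym (ℚₚ.*-distribʳ-+ δ Kx Ky))
        (≡.trans (solve 3 (λ k e i → k :* (e :* i) := e :* (k :* i)) ≡.refl K ε (ℚ.1/ K))
        (≡.trans (≡.cong (ε ℚ.*_) (ℚₚ.*-inverseʳ K)) (ℚₚ.*-identityʳ ε)))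
      N₁ , h₁ = cauchy x 0<δ
      N₂ , h₂ = cauchy y 0<δ
      B = Nx ℕ.⊔ Ny
      C = N₁ ℕ.⊔ N₂
  in B ℕ.⊔ C , λ {m} {n} N≤m N≤n →
    let B≤m = N₁≤ {B} {C} N≤m ; B≤n = N₁≤ {B} {C} N≤n
        C≤m = N₂≤ {B} {C} N≤m ; C≤n = N₂≤ {B} {C} N≤n
    in split {a = seq x m ℚ.* (seq y m ℚ.- seq y n)} {b = seq y n ℚ.* (seq x m ℚ.- seq x n)}
      (solve 4 (λ a b c d → (a :* b) :- (c :* d) := a :* (b :- d) :+ d :* (a :- c)) ≡.refl
        (seq x m) (seq y m) (seq x n) (seq y n))
      Kδ≡ε
      (∣*∣≤ {a = seq x m} (bx (N₁≤ {Nx} B≤m)) (h₂ (N₂≤ {N₁} C≤m) (N₂≤ {N₁} C≤n)))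
      (∣*∣≤ {a = seq y n} (by (N₂≤ {Nx} B≤n)) (h₁ (N₁≤ {N₁} C≤m) (N₁≤ {N₁} C≤n)))

infix 5 _∣ₛ_

_∣ₛ_ : (S : Setoid c ℓ) → Pred (Setoid.Carrier S) p → Setoid (c ⊔ p) ℓ
S ∣ₛ P = On.setoid S (proj₁ {B = P})

HasCard : Setoid c ℓ → ℕ → Set (c ⊔ ℓ)
HasCard S n = Inverse S (≡.setoid (Fin n))

-- Subsets are characteristic functions into Bool, as in classical
-- mathematics.  With Set-valued predicates, point masses on a finite set
-- would not extend to a measure on all subsets constructively.

𝒫 : Setoid c ℓ → Setoid (c ⊔ ℓ) c
𝒫 S = S ⇨ ≡.setoid Bool

module _ {S : Setoid c ℓ} where
  open Setoid S using (Carrier)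

  infix 4 _∈_ _⊆_

  _∈_ : Carrier → Func S (≡.setoid Bool) → Set
  x ∈ X = X ⟨$⟩ x ≡ true

  _⊆_ Disjoint : Rel (Func S (≡.setoid Bool)) c
  X ⊆ Y = ∀ {x} → x ∈ X → x ∈ Y
  Disjoint X Y = ∀ {x} → x ∈ X → ¬ x ∈ Y

  full : Func S (≡.setoid Bool)
  full = record { to = λ _ → true ; cong = λ _ → ≡.refl }

  ∁ : Func S (≡.setoid Bool) → Func S (≡.setoid Bool)
  ∁ X = record { to = λ x → not (X ⟨$⟩ x) ; cong = λ x≈y → ≡.cong not (Func.cong X x≈y) }

  infixr 6 _∪_

  _∪_ : (X Y : Func S (≡.setoid Bool)) → Func S (≡.setoid Bool)
  X ∪ Y = record
    { to   = λ x → (X ⟨$⟩ x) ∨ (Y ⟨$⟩ x)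
    ; cong = λ x≈y → ≡.cong₂ _∨_ (Func.cong X x≈y) (Func.cong Y x≈y)
    }

module _ (P : Poset c ℓ₁ ℓ₂) where
  open Poset P

  IsJoin IsMeet : Carrier → Carrier → Carrier → Set (c ⊔ ℓ₂)
  IsJoin x y z = x ≤ z × y ≤ z × (∀ {w} → x ≤ w → y ≤ w → z ≤ w)
  IsMeet x y z = z ≤ x × z ≤ y × (∀ {w} → w ≤ x → w ≤ y → w ≤ z)

record OrthomodularPoset c ℓ₁ ℓ₂ : Set (lsuc (c ⊔ ℓ₁ ⊔ ℓ₂)) where
  infix 8 _ᗮ
  infix 4 _⊥_

  field
    poset : Poset c ℓ₁ ℓ₂

  open Poset poset public

  field
    0# 1#        : Carrier
    _ᗮ           : Carrier → Carrier

  _⊥_ : Rel Carrier ℓ₂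
  x ⊥ y = x ≤ y ᗮ

  field
    minimum      : Minimum _≤_ 0#
    maximum      : Maximum _≤_ 1#
    ᗮ-antitone   : Antitonic₁ _≤_ _≤_ _ᗮ
    ᗮ-involutive : Involutive _≈_ _ᗮ
    ᗮ-meet       : ∀ x → IsMeet poset x (x ᗮ) 0#
    ᗮ-join       : ∀ x → IsJoin poset x (x ᗮ) 1#
    ⊥-join       : ∀ {x y} → x ⊥ y → ∃ (IsJoin poset x y)
    -- y = x ∨ (y ∧ x ᗮ); this meet exists by ⊥-join and De Morgan
    orthomodular : ∀ {x y} → x ≤ y →
                   ∃[ z ] (IsMeet poset y (x ᗮ) z × IsJoin poset x z y)

  setoid : Setoid c ℓ₁
  setoid = Eq.setoid

record _≅_ (L : OrthomodularPoset c ℓ₁ ℓ₂) (M : OrthomodularPoset c′ ℓ₁′ ℓ₂′)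
           : Set (c ⊔ ℓ₁ ⊔ ℓ₂ ⊔ c′ ⊔ ℓ₁′ ⊔ ℓ₂′) where
  private
    module L = OrthomodularPoset L
    module M = OrthomodularPoset M
  field
    to                 : L.Carrier → M.Carrier
    isOrderIsomorphism : IsOrderIsomorphism L._≈_ M._≈_ L._≤_ M._≤_ to
    ᗮ-homo             : ∀ x → to (x L.ᗮ) M.≈ (to x) M.ᗮ

module _ (L : OrthomodularPoset c ℓ₁ ℓ₂) where
  open OrthomodularPoset L

  -- A finite poset is given by a finite table, so its order is decidable.
  IsFinite : Set (c ⊔ ℓ₁ ⊔ ℓ₂)
  IsFinite = Decidable _≤_ × ∃[ n ] HasCard setoid n

  IsAtom : Pred Carrier (c ⊔ ℓ₁ ⊔ ℓ₂)
  IsAtom a = ¬ a ≈ 0# × (∀ {x} → x ≤ a → x ≈ 0# ⊎ x ≈ a)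

  Atoms : Setoid (c ⊔ ℓ₁ ⊔ ℓ₂) ℓ₁
  Atoms = setoid ∣ₛ IsAtom

  private
    PL : Set (c ⊔ ℓ₁)
    PL = Setoid.Carrier (𝒫 setoid)

  IsOrthogonalAtomSet : Pred PL (c ⊔ ℓ₁ ⊔ ℓ₂)
  IsOrthogonalAtomSet B =
    (∀ {x} → x ∈ B → IsAtom x) ×
    (∀ {x y} → x ∈ B → y ∈ B → ¬ x ≈ y → x ⊥ y)

  IsBlock : Pred PL (c ⊔ ℓ₁ ⊔ ℓ₂)
  IsBlock B = IsOrthogonalAtomSet B ×
              (∀ {C} → IsOrthogonalAtomSet C → B ⊆ C → C ⊆ B)

  IsHomogeneous : ℕ → ℕ → Set (c ⊔ ℓ₁ ⊔ ℓ₂)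
  IsHomogeneous n m =
    (∀ {a} → IsAtom a → HasCard (𝒫 setoid ∣ₛ λ B → IsBlock B × a ∈ B) n) ×
    (∀ {B} → IsBlock B → HasCard (setoid ∣ₛ λ x → x ∈ B) m)

Even : Pred (FS.Subset 6) 0ℓ
Even X = 2 ℕ∣.∣ FS.∣ X ∣

private
  disjoint-card : ∀ {n} (X Y : FS.Subset n) → X FS.⊆ FS.∁ Y →
                  FS.∣ X FS.∪ Y ∣ ≡ FS.∣ X ∣ ℕ.+ FS.∣ Y ∣
  disjoint-card []          []          _ = ≡.refl
  disjoint-card (true ∷ X)  (true ∷ Y)  h with h here
  ... | ()
  disjoint-card (true ∷ X)  (false ∷ Y) h = ≡.cong ℕ.suc (disjoint-card X Y (FSₚ.drop-∷-⊆ h))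
  disjoint-card (false ∷ X) (true ∷ Y)  h =
    ≡.trans (≡.cong ℕ.suc (disjoint-card X Y (FSₚ.drop-∷-⊆ h)))
            (≡.sym (ℕₚ.+-suc FS.∣ X ∣ FS.∣ Y ∣))
  disjoint-card (false ∷ X) (false ∷ Y) h = disjoint-card X Y (FSₚ.drop-∷-⊆ h)

  ∁∁ : ∀ {n} (X : FS.Subset n) → FS.∁ (FS.∁ X) ≡ X
  ∁∁ []          = ≡.refl
  ∁∁ (true ∷ X)  = ≡.cong (true ∷_) (∁∁ X)
  ∁∁ (false ∷ X) = ≡.cong (false ∷_) (∁∁ X)

  even-∪ : ∀ X Y → X FS.⊆ FS.∁ Y → Even X → Even Y → Even (X FS.∪ Y)
  even-∪ X Y X⊆∁Y eX eY =
    ≡.subst (2 ℕ∣.∣_) (≡.sym (disjoint-card X Y X⊆∁Y)) (ℕ∣.∣m∣n⇒∣m+n eX eY)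

  even-∁ : ∀ X → Even X → Even (FS.∁ X)
  even-∁ X eX = ℕ∣.∣m+n∣m⇒∣n
    (≡.subst (2 ℕ∣.∣_)
      (≡.trans (≡.cong FS.∣_∣ (≡.sym (FSₚ.p∪∁p≡⊤ X)))
        (disjoint-card X (FS.∁ X) λ {i} → ≡.subst (λ Z → i FS.∈ Z) (≡.sym (∁∁ X))))
      (ℕ∣.divides 3 ≡.refl))
    eX

  ∪-least : ∀ {n} (X Y : FS.Subset n) {Z} → X FS.⊆ Z → Y FS.⊆ Z → X FS.∪ Y FS.⊆ Z
  ∪-least X Y X⊆Z Y⊆Z = [ X⊆Z , Y⊆Z ]′ ∘ FSₚ.x∈p∪q⁻ X Y

  ∁-join : ∀ {n} (X : FS.Subset n) {Z} → X FS.⊆ Z → FS.∁ X FS.⊆ Z → FS.⊤ FS.⊆ Z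
  ∁-join X {Z} X⊆Z ∁X⊆Z = ≡.subst (FS._⊆ Z) (FSₚ.p∪∁p≡⊤ X) (∪-least X (FS.∁ X) X⊆Z ∁X⊆Z)

  ∁-meet : ∀ {n} (X : FS.Subset n) {Z} → Z FS.⊆ X → Z FS.⊆ FS.∁ X → Z FS.⊆ FS.⊥
  ∁-meet X Z⊆X Z⊆∁X i∈Z = contradiction (Z⊆X i∈Z) (FSₚ.x∈∁p⇒x∉p (Z⊆∁X i∈Z))

  -- Y \ X as the complement of a disjoint union, from which its parity follows
  infixl 6 _∖_
  _∖_ : ∀ {n} → FS.Subset n → FS.Subset n → FS.Subset n
  Y ∖ X = FS.∁ (X FS.∪ FS.∁ Y)

  ∖⊆ : ∀ {n} (Y X : FS.Subset n) → Y ∖ X FS.⊆ Y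
  ∖⊆ Y X i∈ = FSₚ.x∉∁p⇒x∈p (FSₚ.x∈∁p⇒x∉p i∈ ∘ FSₚ.q⊆p∪q X (FS.∁ Y))

  ∖⊆∁ : ∀ {n} (Y X : FS.Subset n) → Y ∖ X FS.⊆ FS.∁ X
  ∖⊆∁ Y X = FSₚ.p⊆q⇒∁p⊇∁q (FSₚ.p⊆p∪q (FS.∁ Y))

  ∖-intro : ∀ {n} (Y X : FS.Subset n) {i} → i FS.∈ Y → i FS.∉ X → i FS.∈ Y ∖ X
  ∖-intro Y X i∈Y i∉X = FSₚ.x∉p⇒x∈∁p
    ([ i∉X , (λ i∈∁Y → FSₚ.x∈∁p⇒x∉p i∈∁Y i∈Y) ]′ ∘ FSₚ.x∈p∪q⁻ X (FS.∁ Y))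

  ∖-join : ∀ {n} (Y X : FS.Subset n) {Z} → X FS.⊆ Z → Y ∖ X FS.⊆ Z → Y FS.⊆ Z
  ∖-join Y X X⊆Z Y∖X⊆Z {i} i∈Y with i FSₚ.∈? X
  ... | yes i∈X = X⊆Z i∈X
  ... | no  i∉X = Y∖X⊆Z (∖-intro Y X i∈Y i∉X)

  even-∖ : ∀ Y X → X FS.⊆ Y → Even X → Even Y → Even (Y ∖ X)
  even-∖ Y X X⊆Y eX eY = even-∁ (X FS.∪ FS.∁ Y)
    (even-∪ X (FS.∁ Y) (λ {i} i∈X → ≡.subst (i FS.∈_) (≡.sym (∁∁ Y)) (X⊆Y i∈X))
      eX (even-∁ Y eY))

𝓛³₂ : OrthomodularPoset 0ℓ 0ℓ 0ℓ
𝓛³₂ = record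
  { poset        = On.poset (FSₚ.⊆-poset 6) (proj₁ {B = Even})
  ; 0#           = FS.⊥ , ℕ∣.divides 0 ≡.refl
  ; 1#           = FS.⊤ , ℕ∣.divides 3 ≡.refl
  ; _ᗮ           = λ (X , eX) → FS.∁ X , even-∁ X eX
  ; minimum      = λ _ → FSₚ.⊥⊆
  ; maximum      = λ _ → FSₚ.⊆⊤
  ; ᗮ-antitone   = λ X⊆Y → FSₚ.p⊆q⇒∁p⊇∁q X⊆Y
  ; ᗮ-involutive = λ (X , _) → ∁∁ X
  ; ᗮ-meet       = λ (X , _) → FSₚ.⊥⊆ , FSₚ.⊥⊆ , λ Z⊆X Z⊆∁X → ∁-meet X Z⊆X Z⊆∁X
  ; ᗮ-join       = λ (X , _) → FSₚ.⊆⊤ , FSₚ.⊆⊤ , λ X⊆Z ∁X⊆Z → ∁-join X X⊆Z ∁X⊆Z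
  ; ⊥-join       = λ { {X , eX} {Y , eY} X⊆∁Y →
      (X FS.∪ Y , even-∪ X Y X⊆∁Y eX eY) ,
      FSₚ.p⊆p∪q Y , FSₚ.q⊆p∪q X Y , λ X⊆Z Y⊆Z → ∪-least X Y X⊆Z Y⊆Z }
  ; orthomodular = λ { {X , eX} {Y , eY} X⊆Y →
      (Y ∖ X , even-∖ Y X X⊆Y eX eY) ,
      (∖⊆ Y X , ∖⊆∁ Y X , λ Z⊆Y Z⊆∁X i∈Z → ∖-intro Y X (Z⊆Y i∈Z) (FSₚ.x∈∁p⇒x∉p (Z⊆∁X i∈Z))) ,
      X⊆Y , ∖⊆ Y X , λ X⊆Z Y∖X⊆Z → ∖-join Y X X⊆Z Y∖X⊆Z }
  }

module _ (L : OrthomodularPoset c ℓ₁ ℓ₂) where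
  open OrthomodularPoset L

  IsState : Pred (Func setoid ℝ-setoid) (c ⊔ ℓ₂)
  IsState s =
    (∀ x → 0ℝ ≤ℝ s ⟨$⟩ x × s ⟨$⟩ x ≤ℝ 1ℝ) ×
    s ⟨$⟩ 1# ≈ℝ 1ℝ ×
    (∀ {x y z} → x ⊥ y → IsJoin poset x y z → s ⟨$⟩ z ≈ℝ (s ⟨$⟩ x) +ℝ (s ⟨$⟩ y))

  𝐒 : Setoid (c ⊔ ℓ₁ ⊔ ℓ₂) c
  𝐒 = (setoid ⇨ ℝ-setoid) ∣ₛ IsState

  IsTwoValued : Pred (Setoid.Carrier 𝐒) c
  IsTwoValued (s , _) = ∀ x → s ⟨$⟩ x ≈ℝ 0ℝ ⊎ s ⟨$⟩ x ≈ℝ 1ℝ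

  𝐒₂ : Setoid (c ⊔ ℓ₁ ⊔ ℓ₂) c
  𝐒₂ = 𝐒 ∣ₛ IsTwoValued

  infixl 9 _at_

  _at_ : Setoid.Carrier 𝐒₂ → Carrier → ℝ
  ((s , _) , _) at x = s ⟨$⟩ x

  IsFull : Pred (Setoid.Carrier 𝐒₂) p → Set (c ⊔ ℓ₁ ⊔ ℓ₂ ⊔ p)
  IsFull T = ∀ {x y} → x ≤ y ⇔ (∀ f → T f → f at x ≤ℝ f at y)

Segment : ℝ → ℝ → Setoid 0ℓ 0ℓ
Segment a b = ℝ-setoid ∣ₛ λ t → a ≤ℝ t × t ≤ℝ b

-- Affine maps preserve convex combinations.  The combination on the left is
-- described by its pointwise values, so that it need not first be shown to
-- be a state.

record StateSpace≅Segment (L : OrthomodularPoset c ℓ₁ ℓ₂) (a b : ℝ)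
                          : Set (c ⊔ ℓ₁ ⊔ ℓ₂) where
  private
    module L = OrthomodularPoset L
  field
    bijection : Inverse (𝐒 L) (Segment a b)

  ⟦_⟧ : Setoid.Carrier (𝐒 L) → ℝ
  ⟦ s ⟧ = proj₁ (Inverse.to bijection s)

  field
    affine : ∀ {t u} {s s₁ s₂ : Setoid.Carrier (𝐒 L)} →
             0ℝ ≤ℝ t → 0ℝ ≤ℝ u → t +ℝ u ≈ℝ 1ℝ →
             (∀ x → proj₁ s ⟨$⟩ x ≈ℝ t *ℝ (proj₁ s₁ ⟨$⟩ x) +ℝ u *ℝ (proj₁ s₂ ⟨$⟩ x)) →
             ⟦ s ⟧ ≈ℝ t *ℝ ⟦ s₁ ⟧ +ℝ u *ℝ ⟦ s₂ ⟧

module _ (Ω : Setoid c ℓ) where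
  private
    PΩ : Set (c ⊔ ℓ)
    PΩ = Setoid.Carrier (𝒫 Ω)

  record IsConcreteLogic (E : Pred PΩ e) : Set (c ⊔ ℓ ⊔ e) where
    field
      -- a predicate on 𝒫 Ω is a set of subsets only if it respects equality
      resp     : ∀ {X Y} → Setoid._≈_ (𝒫 Ω) X Y → E X → E Y
      full∈    : E full
      ∁-closed : ∀ {X} → E X → E (∁ X)
      ∪-closed : ∀ {X Y} → E X → E Y → Disjoint X Y → E (X ∪ Y)

  record SignedMeasure (E : Pred PΩ e) : Set (c ⊔ ℓ ⊔ e) where
    field
      fun : Func (𝒫 Ω ∣ₛ E) ℝ-setoid

    measure : ∀ X → E X → ℝ
    measure X X∈E = fun ⟨$⟩ (X , X∈E)

    field
      additive : ∀ {X Y} (X∈E : E X) (Y∈E : E Y) (X∪Y∈E : E (X ∪ Y)) → Disjoint X Y →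
                 measure (X ∪ Y) X∪Y∈E ≈ℝ measure X X∈E +ℝ measure Y Y∈E

  open SignedMeasure using (measure)

  IsRegular : Pred PΩ e → Set (c ⊔ ℓ ⊔ e)
  IsRegular E = (μ : SignedMeasure E) →
    Σ[ ν ∈ SignedMeasure U ] (∀ {X} (X∈E : E X) → measure ν X _ ≈ℝ measure μ X X∈E)

TotalRepresentation : (L : OrthomodularPoset c ℓ₁ ℓ₂) →
                      Pred (Setoid.Carrier (𝒫 (𝐒₂ L))) (c ⊔ ℓ₁ ⊔ ℓ₂)
TotalRepresentation L X = ∃[ x ] (∀ μ → μ ∈ X ⇔ _at_ L μ x ≈ℝ 1ℝ)

{-# OPTIONS --safe #-}
module Submission where

-- (1) Around a line of L lie its three atoms and, since there are no triangles, twelve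
-- different neighbours of these.  So 15 atoms form a generalized quadrangle: an atom
-- off a line is orthogonal to some atom of it.  Naming the neighbours of two atoms of
-- a line suitably forces all other orthogonalities, and the named atoms match the 15
-- pairs of letters from {1,…,6}, orthogonality being disjointness.
--
-- (2) Three lines of three points through each point without triangles always give a
-- (3,3)-homogeneous orthomodular poset, whose states are the nonnegative functions
-- with sum 1 on every line.  For 17 points the linear system leaves one parameter t:
-- the atoms get 1/3, t or 2/3 − t, and the value 1/3 rules out two-valued states.  For
-- the 27 points of the 3 × 3 × 3 grid the planes i ± j ± k = d over the field of three
-- elements are two-valued states that separate elements.  A signed measure f with
-- total c is the sum of the point masses f(P)/9 − c/4 at these twelve planes P, where
-- f(P) is the sum of f over P, hence it extends to all sets of two-valued states.

open import Defs
open import Level using (0ℓ)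
open import Data.Integer.Base using (+_)
open import Data.Product.Base using (Σ-syntax; _×_)
open import Data.Rational.Base using (_/_)
open import Relation.Binary.Bundles using (Setoid)
open import Relation.Nullary using (¬_)
open import Relation.Unary using (U)

open import Level using (_⊔_)
open import Algebra.Bundles using (AbelianGroup)
import Algebra.Properties.AbelianGroup as AbelianGroupₚ
open import Data.Bool.Base using (Bool; true; false; not; _∨_; _xor_; if_then_else_)
import Data.Bool.Properties as Boolₚ
open import Data.Empty using (⊥-elim)
open import Data.Fin using (#_)
open import Data.Fin.Base using (Fin; zero; suc; punchOut; combine; remQuot; splitAt; _↑ˡ_; _↑ʳ_)
import Data.Fin.Induction as FinI
open import Data.Fin.Patterns
import Data.Fin.Properties as Finₚ
import Data.Fin.Subset as FS
import Data.Fin.Subset.Properties as FSₚ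
open import Data.List.Base using (List; []; _∷_; _++_; map; concatMap; allFin)
open import Data.List.Membership.Propositional using () renaming (_∈_ to _∈ˡ_)
open import Data.List.Membership.Propositional.Properties using (∈-allFin)
open import Data.List.Relation.Unary.Any using (here; there)
open import Data.Maybe using (Maybe; just; nothing; Is-just; to-witness)
open import Data.Maybe.Relation.Unary.Any using () renaming (dec to is-just?)
open import Data.Nat.Base as ℕ using (ℕ; zero; suc; _+_; _*_)
import Data.Nat.Divisibility as ℕ∣
import Data.Nat.Properties as ℕₚ
open import Data.Product.Base using (∃; ∃-syntax; _,_; proj₁; proj₂; map₂)
open import Data.Rational.Base as ℚ using (ℚ; 0ℚ; 1ℚ; ½)
import Data.Rational.Properties as ℚₚ
import Data.Rational.Solver as ℚSolver
open import Data.Sum.Base using (_⊎_; inj₁; inj₂; [_,_]′)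
open import Data.Sum.Function.Propositional using (_⊎-↔_)
open import Data.Vec.Base using (Vec; []; _∷_; lookup; here; updateAt; replicate)
import Data.Vec.Properties as Vecₚ
open import Function.Base using (_∘_)
open import Function.Bundles using (Func; _⟨$⟩_; Inverse; Equivalence; _⇔_; mk⇔; _↔_; mk↔ₛ′)
open import Function.Construct.Composition using (_↔-∘_)
open import Function.Construct.Identity using (↔-id)
open import Function.Construct.Symmetry using (↔-sym)
open import Function.Definitions using (Injective)
open import Induction.WellFounded using (Acc; acc)
open import Relation.Binary.Bundles using (Poset)
open import Relation.Binary.Core using (Rel)
open import Relation.Binary.Definitions using (Decidable; DecidableEquality; Symmetric)
import Relation.Binary.PropositionalEquality as ≡
open ≡ using (_≡_; _≢_; refl; sym; trans; cong; subst; subst₂)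
import Relation.Binary.Reasoning.Setoid as SetoidReasoning
open import Relation.Binary.Structures using (IsPartialOrder)
open import Relation.Nullary using (Dec; yes; no; does; contradiction)
open import Relation.Nullary.Decidable using (map′; _×-dec_; _⊎-dec_; _→-dec_; ¬?; dec-true; does-⇔; True; toWitness; from-yes)
open import Relation.Unary using (Pred) renaming (Decidable to Decidable₁)

-- Geometries with three points on a line and three lines through a point

-- Both halves use one dictionary: with three-atom blocks every element is 0, 1, an atom or the
-- complement of an atom, so the poset amounts to its graph of orthogonal atoms. This graph has no
-- triangles outside blocks because the third atom of a block is the complement of the join of the
-- other two. In (1), joining is a bijection between the two further points on a line at a and those
-- on a line at b, so four bits describe the joining of the neighbours of a to those of b. Renaming
-- clears three of them; the real work is that the fourth is then cleared too (`completes`). In (2),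
-- the planes come from harmonic analysis over the field of three elements. Functions on the grid
-- with all line sums 0 are spanned by the characters without zero coordinate; up to sign these are
-- the four forms i ± j ± k, whose level sets are the twelve planes. So a function f with line sums
-- c is its mean c/3 plus, for each form, the deviation f(P)/9 - c/3 of its average over the plane P
-- through the given point. Spreading the constant c/3 - 4c/3 = -c evenly over the four planes
-- through the point gives the weights f(P)/9 - c/4.

injective⇒surjective : ∀ {n} (f : Fin n → Fin n) → Injective _≡_ _≡_ f → ∀ y → ∃[ x ] f x ≡ y
injective⇒surjective {suc n} f inj y with Finₚ.any? (λ x → f x Finₚ.≟ y)
... | yes hit = hit
... | no miss = contradiction (λ {x y} → inj ∘ Finₚ.punchOut-injective (≢f x) (≢f y))
                            (Finₚ.<⇒notInjective {f = λ x → punchOut (≢f x)} (ℕₚ.n<1+n n))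
  where
  ≢f : ∀ x → y ≢ f x
  ≢f x e = miss (x , sym e)

-- Names for the points: `base m` runs through a chosen line, and `arm m i s` is the point number
-- `s` on the further line number `i` through `base m`.
data Pt : Set where
  base : Fin 3 → Pt
  arm  : Fin 3 → Bool → Bool → Pt

toPt : Fin 15 → Pt
toPt = lookup
  ( base 0F ∷ base 1F ∷ base 2F
  ∷ arm 0F false false ∷ arm 0F false true ∷ arm 0F true false ∷ arm 0F true true
  ∷ arm 1F false false ∷ arm 1F false true ∷ arm 1F true false ∷ arm 1F true true
  ∷ arm 2F false false ∷ arm 2F false true ∷ arm 2F true false ∷ arm 2F true true ∷ [])

fromPt : Pt → Fin 15
fromPt (base 0F)            = 0F
fromPt (base 1F)            = 1F
fromPt (base 2F)            = 2F
fromPt (arm 0F false false) = 3F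
fromPt (arm 0F false true)  = 4F
fromPt (arm 0F true false)  = 5F
fromPt (arm 0F true true)   = 6F
fromPt (arm 1F false false) = 7F
fromPt (arm 1F false true)  = 8F
fromPt (arm 1F true false)  = 9F
fromPt (arm 1F true true)   = suc 9F
fromPt (arm 2F false false) = suc (suc 9F)
fromPt (arm 2F false true)  = suc (suc (suc 9F))
fromPt (arm 2F true false)  = suc (suc (suc (suc 9F)))
fromPt (arm 2F true true)   = suc (suc (suc (suc (suc 9F))))

toPt-fromPt : ∀ t → toPt (fromPt t) ≡ t
toPt-fromPt (base 0F)            = refl
toPt-fromPt (base 1F)            = refl
toPt-fromPt (base 2F)            = refl
toPt-fromPt (arm 0F false false) = refl
toPt-fromPt (arm 0F false true)  = refl
toPt-fromPt (arm 0F true false)  = refl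
toPt-fromPt (arm 0F true true)   = refl
toPt-fromPt (arm 1F false false) = refl
toPt-fromPt (arm 1F false true)  = refl
toPt-fromPt (arm 1F true false)  = refl
toPt-fromPt (arm 1F true true)   = refl
toPt-fromPt (arm 2F false false) = refl
toPt-fromPt (arm 2F false true)  = refl
toPt-fromPt (arm 2F true false)  = refl
toPt-fromPt (arm 2F true true)   = refl

fromPt-toPt : ∀ i → fromPt (toPt i) ≡ i
fromPt-toPt = from-yes (Finₚ.all? λ i → fromPt (toPt i) Finₚ.≟ i)

toPt-injective : Injective _≡_ _≡_ toPt
toPt-injective {i} {j} eq = trans (sym (fromPt-toPt i)) (trans (cong fromPt eq) (fromPt-toPt j))

∀Pt? : ∀ {p} {P : Pred Pt p} → Decidable₁ P → Dec (∀ t → P t)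
∀Pt? {P = P} P? = map′ (λ h t → subst P (toPt-fromPt t) (h (fromPt t))) (λ h i → h (toPt i))
  (Finₚ.all? (P? ∘ toPt))

∃Pt? : ∀ {p} {P : Pred Pt p} → Decidable₁ P → Dec (∃ P)
∃Pt? {P = P} P? = map′ (λ (i , h) → toPt i , h)
  (λ (t , h) → fromPt t , subst P (sym (toPt-fromPt t)) h) (Finₚ.any? (P? ∘ toPt))

-- The lines are the triples of pairwise joined points; common excludes all other triangles.
module TriangleFree
  {ℓ} (_~_ : Rel (Fin 15) ℓ) (~-sym : Symmetric _~_) (~-irrefl : ∀ {p} → ¬ p ~ p)
  (common : ∀ {p q r s} → p ~ q → p ~ r → q ~ r → p ~ s → q ~ s → r ≡ s)
  where

  private P = Fin 15

  ~⇒≢ : ∀ {p q} → p ~ q → p ≢ q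
  ~⇒≢ p~p refl = ~-irrefl p~p

  Line : P → P → P → Set ℓ
  Line a b c = a ~ b × a ~ c × b ~ c

  -- The two lines through `a` other than the line `a b c`: line number `i` consists of `a` and the
  -- two points `pt i s`.
  record Fan (a b c : P) : Set ℓ where
    field
      pt    : Bool → Bool → P
      spoke : ∀ i s → a ~ pt i s
      rim   : ∀ i s → pt i s ~ pt i (not s)
      ≢b    : ∀ i s → pt i s ≢ b
      ≢c    : ∀ i s → pt i s ≢ c
      apart : ∀ i s s' → pt i s ≢ pt (not i) s'

    ≁b : Line a b c → ∀ i s → ¬ pt i s ~ b
    ≁b (ab , ac , bc) i s h = ≢c i s (sym (common ab ac bc (spoke i s) (~-sym h)))

    ≁c : Line a b c → ∀ i s → ¬ pt i s ~ c
    ≁c (ab , ac , bc) i s h = ≢b i s (sym (common ac ab (~-sym bc) (spoke i s) (~-sym h)))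

    ≁apart : ∀ i s s' → ¬ pt i s ~ pt (not i) s'
    ≁apart i s s' h = apart i (not s) s' (common (spoke i s) (spoke i (not s)) (rim i s) (spoke (not i) s') h)

    centre : ∀ i s {p} → p ~ pt i s → p ~ pt i (not s) → p ≡ a
    centre i s h h' = common (rim i s) (~-sym h) (~-sym h') (~-sym (spoke i s)) (~-sym (spoke i (not s)))

  -- The freedom left in naming a fan: on each of its lines the two outer points may be exchanged.
  swap : ∀ {a b c} → (Bool → Bool) → Fan a b c → Fan a b c
  swap f F = record
    { pt    = λ i s → pt i (s xor f i)
    ; spoke = λ i s → spoke i (s xor f i)
    ; rim   = λ { i false → rim i (f i) ; i true → ~-sym (rim i (f i)) }
    ; ≢b    = λ i s → ≢b i _
    ; ≢c    = λ i s → ≢c i _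
    ; apart = λ i s s' → apart i _ _
    }
    where open Fan F

  -- A line with the fans at its three points names 3 + 3 · 2 · 2 = 15 points.
  record Frame : Set ℓ where
    field
      {a b c}  : P
      abc      : Line a b c
      fanA     : Fan a b c
      fanB     : Fan b c a
      fanC     : Fan c a b

    private
      module A = Fan fanA
      module B = Fan fanB
      module C = Fan fanC
      a~b = proj₁ abc
      a~c = proj₁ (proj₂ abc)
      b~c = proj₂ (proj₂ abc)

    bca : Line b c a
    bca = b~c , ~-sym a~b , ~-sym a~c

    cab : Line c a b
    cab = ~-sym a~c , ~-sym b~c , a~b

    ψ : Pt → P
    ψ (base 0F)    = a
    ψ (base 1F)    = b
    ψ (base 2F)    = c
    ψ (arm 0F i s) = A.pt i s
    ψ (arm 1F i s) = B.pt i s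
    ψ (arm 2F i s) = C.pt i s

    private
      within : ∀ {a b c} (F : Fan a b c) m i s i' s' → Fan.pt F i s ≡ Fan.pt F i' s' → arm m i s ≡ arm m i' s'
      within F m false false false false e = refl
      within F m false true  false true  e = refl
      within F m true  false true  false e = refl
      within F m true  true  true  true  e = refl
      within F m false false false true  e = contradiction e (~⇒≢ (Fan.rim F false false))
      within F m false true  false false e = contradiction e (~⇒≢ (Fan.rim F false true))
      within F m true  false true  true  e = contradiction e (~⇒≢ (Fan.rim F true false))
      within F m true  true  true  false e = contradiction e (~⇒≢ (Fan.rim F true true))
      within F m false s true  s' e = contradiction e (Fan.apart F false s s')
      within F m true  s false s' e = contradiction e (Fan.apart F true s s')

      -- The centre `a'` of the second fan tells the points apart: it is joined to every point of
      -- its own fan and to none of the other.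
      across : ∀ {a b c a' b' c'} (F : Fan a b c) (F' : Fan a' b' c') →
               (∀ i s → ¬ Fan.pt F i s ~ a') → ∀ {i s i' s'} → Fan.pt F i s ≢ Fan.pt F' i' s'
      across F F' off {i} {s} {i'} {s'} e = off i s (subst (_~ _) (sym e) (~-sym (Fan.spoke F' i' s')))

    private
      base≢arm : ∀ m m' i s → ψ (base m) ≢ ψ (arm m' i s)
      base≢arm 0F 0F i s = ~⇒≢ (A.spoke i s)
      base≢arm 0F 1F i s = (B.≢c i s) ∘ sym
      base≢arm 0F 2F i s = (C.≢b i s) ∘ sym
      base≢arm 1F 0F i s = (A.≢b i s) ∘ sym
      base≢arm 1F 1F i s = ~⇒≢ (B.spoke i s)
      base≢arm 1F 2F i s = (C.≢c i s) ∘ sym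
      base≢arm 2F 0F i s = (A.≢c i s) ∘ sym
      base≢arm 2F 1F i s = (B.≢b i s) ∘ sym
      base≢arm 2F 2F i s = ~⇒≢ (C.spoke i s)

    ψ-injective : Injective _≡_ _≡_ ψ
    ψ-injective {base 0F} {base 0F} e = refl
    ψ-injective {base 0F} {base 1F} e = contradiction e (~⇒≢ a~b)
    ψ-injective {base 0F} {base 2F} e = contradiction e (~⇒≢ a~c)
    ψ-injective {base 1F} {base 0F} e = contradiction (sym e) (~⇒≢ a~b)
    ψ-injective {base 1F} {base 1F} e = refl
    ψ-injective {base 1F} {base 2F} e = contradiction e (~⇒≢ b~c)
    ψ-injective {base 2F} {base 0F} e = contradiction (sym e) (~⇒≢ a~c)
    ψ-injective {base 2F} {base 1F} e = contradiction (sym e) (~⇒≢ b~c)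
    ψ-injective {base 2F} {base 2F} e = refl
    ψ-injective {base m} {arm m' i s} e = contradiction e (base≢arm m m' i s)
    ψ-injective {arm m i s} {base m'} e = contradiction (sym e) (base≢arm m' m i s)
    ψ-injective {arm 0F i s} {arm 0F i' s'} e = within fanA 0F i s i' s' e
    ψ-injective {arm 0F i s} {arm 1F i' s'} e = contradiction e (across fanA fanB (A.≁b abc))
    ψ-injective {arm 0F i s} {arm 2F i' s'} e = contradiction e (across fanA fanC (A.≁c abc))
    ψ-injective {arm 1F i s} {arm 0F i' s'} e = contradiction e (across fanB fanA (B.≁c bca))
    ψ-injective {arm 1F i s} {arm 1F i' s'} e = within fanB 1F i s i' s' e
    ψ-injective {arm 1F i s} {arm 2F i' s'} e = contradiction e (across fanB fanC (B.≁b bca))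
    ψ-injective {arm 2F i s} {arm 0F i' s'} e = contradiction e (across fanC fanA (C.≁b cab))
    ψ-injective {arm 2F i s} {arm 1F i' s'} e = contradiction e (across fanC fanB (C.≁c cab))
    ψ-injective {arm 2F i s} {arm 2F i' s'} e = within fanC 2F i s i' s' e

    abstract
      -- The number of atoms enters here: the fifteen named points are distinct, so none is left
      -- over.
      ψ-surjective : ∀ p → ∃[ t ] ψ t ≡ p
      ψ-surjective p with i , e ← injective⇒surjective (ψ ∘ toPt) (toPt-injective ∘ ψ-injective) p = toPt i , e

  -- The generalized quadrangle with 15 points

  module Uniqueness
    (third : ∀ {p q} → p ~ q → ∃[ r ] (p ~ r × q ~ r))
    (fan : ∀ {a b c} → Line a b c → Fan a b c)
    where

    frame : ∀ {a b c} → Line a b c → Frame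
    frame abc@(a~b , a~c , b~c) = record
      { abc = abc
      ; fanA = fan abc
      ; fanB = fan (b~c , ~-sym a~b , ~-sym a~c)
      ; fanC = fan (~-sym a~c , ~-sym b~c , a~b)
      }

    -- By counting: the fifteen points of a frame are all the points.
    meets : ∀ {a b c} → Line a b c → ∀ {p} → p ≢ a → p ≢ b → p ≢ c → p ~ a ⊎ p ~ b ⊎ p ~ c
    meets abc {p} p≢a p≢b p≢c with Frame.ψ-surjective (frame abc) p
    ... | base 0F    , e = contradiction (sym e) p≢a
    ... | base 1F    , e = contradiction (sym e) p≢b
    ... | base 2F    , e = contradiction (sym e) p≢c
    ... | arm 0F i s , refl = inj₁ (~-sym (Fan.spoke (Frame.fanA (frame abc)) i s))
    ... | arm 1F i s , refl = inj₂ (inj₁ (~-sym (Fan.spoke (Frame.fanB (frame abc)) i s)))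
    ... | arm 2F i s , refl = inj₂ (inj₂ (~-sym (Fan.spoke (Frame.fanC (frame abc)) i s)))

    -- The inequalities required by `meets` are automatic: the points of a line are joined to each
    -- other, so `p` on the line would be joined to `a` or to `b`.
    meets₃ : ∀ {a b c} → Line a b c → ∀ {p} → ¬ p ~ a → ¬ p ~ b → p ~ c
    meets₃ abc@(a~b , a~c , b~c) p≁a p≁b
      with meets abc (λ { refl → p≁b a~b }) (λ { refl → p≁a (~-sym a~b) }) (λ { refl → p≁a (~-sym a~c) })
    ... | inj₁ h        = contradiction h p≁a
    ... | inj₂ (inj₁ h) = contradiction h p≁b
    ... | inj₂ (inj₂ h) = h

    around : ∀ {a b c} (abc : Line a b c) (A : Fan a b c) {p} → a ~ p →
             p ≡ b ⊎ p ≡ c ⊎ ∃[ i ] ∃[ s ] p ≡ Fan.pt A i s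
    -- The fan in the frame is replaced by `A`, so that the answer uses the names of `A`.
    around abc A {p} a~p with Frame.ψ-surjective (record (frame abc) { fanA = A }) p
    ... | base 0F    , refl = contradiction a~p ~-irrefl
    ... | base 1F    , e = inj₁ (sym e)
    ... | base 2F    , e = inj₂ (inj₁ (sym e))
    ... | arm 0F i s , e = inj₂ (inj₂ (i , s , sym e))
    ... | arm 1F i s , refl = contradiction (~-sym a~p) (Fan.≁c (Frame.fanB F) (Frame.bca F) i s)
      where F = frame abc
    ... | arm 2F i s , refl = contradiction (~-sym a~p) (Fan.≁b (Frame.fanC F) (Frame.cab F) i s)
      where F = frame abc

    -- For each `i` and `j`, joining turns out to be a bijection between the two points `α i _` and
    -- the two points `β j _` (`joined`, `excludeA`, `excludeB`, `opposite`), hence a single bit.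
    module Matching {a b c} (abc : Line a b c) (A : Fan a b c) (B : Fan b c a) where
      private
        module A = Fan A
        module B = Fan B
        a~b = proj₁ abc
        a~c = proj₁ (proj₂ abc)
        b~c = proj₂ (proj₂ abc)

      bca : Line b c a
      bca = b~c , ~-sym a~b , ~-sym a~c

      α β : Bool → Bool → P
      α = A.pt
      β = B.pt

      α≁b : ∀ i s → ¬ α i s ~ b
      α≁b = A.≁b abc

      β≁a : ∀ j t → ¬ β j t ~ a
      β≁a = B.≁c bca

      -- The line through `b`, `β j false` and `β j true` must contain a point joined to `α i s`,
      -- and `b` is not that point.
      joined : ∀ i s j → ∃[ t ] α i s ~ β j t
      joined i s j with meets (B.spoke j false , B.spoke j true , B.rim j false) {α i s} (A.≢b i s) (α≢β false) (α≢β true)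
        where
        α≢β : ∀ t → α i s ≢ β j t
        α≢β t e = α≁b i s (subst (_~ b) (sym e) (~-sym (B.spoke j t)))
      ... | inj₁ h        = contradiction h (α≁b i s)
      ... | inj₂ (inj₁ h) = false , h
      ... | inj₂ (inj₂ h) = true , h

      excludeB : ∀ {i s j t} → α i s ~ β j t → ¬ α i s ~ β j (not t)
      excludeB h h' = A.≢b _ _ (B.centre _ _ h h')

      excludeA : ∀ {i s j t} → α i s ~ β j t → ¬ α i (not s) ~ β j t
      excludeA h h' = B.≢c _ _ (A.centre _ _ (~-sym h) (~-sym h'))

      opposite : ∀ {i s j t} → α i s ~ β j t → α i (not s) ~ β j (not t)
      opposite {i} {s} {j} {t} h =
        meets₃ (B.spoke j t , B.spoke j (not t) , B.rim j t) (α≁b i (not s)) (excludeA h)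

      -- Here `γ` is the third point of the line through `α i false` and `β j false`. Were it joined
      -- to `a`, `common` would make it `α i true`, which `excludeA` keeps off `β j false`; likewise
      -- for `b`. Only `c` remains.
      module _ {i j γ} (i~j : α i false ~ β j false) (α~γ : α i false ~ γ) (β~γ : β j false ~ γ) where

        γ≢a : γ ≢ a
        γ≢a refl = β≁a _ _ β~γ

        γ≢b : γ ≢ b
        γ≢b refl = α≁b _ _ α~γ

        γ≁a : ¬ γ ~ a
        γ≁a h = excludeA i~j (subst (_~ β j false)
          (sym (common (A.spoke i false) (A.spoke i true) (A.rim i false) (~-sym h) α~γ)) (~-sym β~γ))

        γ≁b : ¬ γ ~ b
        γ≁b h = excludeB i~j (subst (α i false ~_)
          (sym (common (B.spoke j false) (B.spoke j true) (B.rim j false) (~-sym h) β~γ)) α~γ)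

        γ~c : γ ~ c
        γ~c = meets₃ abc γ≁a γ≁b

        γ~α : ¬ α (not i) true ~ β j false → γ ~ α (not i) true
        γ~α h = ~-sym (meets₃ (i~j , α~γ , β~γ) (λ k → A.≁apart i false true (~-sym k)) h)

        γ~β : ¬ α i false ~ β (not j) true → γ ~ β (not j) true
        γ~β h = ~-sym (meets₃ (i~j , α~γ , β~γ) (λ k → h (~-sym k)) (λ k → B.≁apart j false true (~-sym k)))

      -- The third point γ of the line through α₀₀ and β₀₀ is joined to α₁₁ and to β₁₁,
      -- and these lie on the same line through γ.
      completes : α false false ~ β false false → α false false ~ β true false →
                  α true false ~ β false false → α true false ~ β true false
      completes h₀₀ h₀₁ h₁₀ with third h₀₀
      ... | γ , α~γ , β~γ with third {γ} {β true true} (γ~β h₀₀ α~γ β~γ (excludeB h₀₁))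
      -- By `opposite` it is enough to join the second points `α true true` and `β true true`. The
      -- third point `δ` of the line through `γ` and `β true true` turns out to be `α true true`.
      ... | δ , γ~δ , β~δ = opposite {true} {true} {true} {true} α~β
        where
        γ~β₁ : γ ~ β true true
        γ~β₁ = γ~β h₀₀ α~γ β~γ (excludeB h₀₁)
        on-a : δ ~ a → α true true ~ β true true
        on-a δ~a with around abc A (~-sym δ~a)
        ... | inj₁ refl        = contradiction γ~δ (γ≁b h₀₀ α~γ β~γ)
        ... | inj₂ (inj₁ refl) = contradiction β~δ (B.≁b bca true true)
        ... | inj₂ (inj₂ (false , false , refl)) = contradiction (~-sym β~δ) (excludeB h₀₁)
        ... | inj₂ (inj₂ (false , true  , refl)) =
          contradiction (A.centre false false (~-sym α~γ) γ~δ) (γ≢a h₀₀ α~γ β~γ)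
        ... | inj₂ (inj₂ (true  , false , refl)) =
          contradiction (common β~γ (~-sym h₁₀) γ~δ (~-sym h₀₀) (~-sym α~γ)) (A.apart true false false)
        ... | inj₂ (inj₂ (true  , true  , refl)) = ~-sym β~δ
        α~β : α true true ~ β true true
        -- On the line of `γ`, `β true true` and `δ`, the point `b` is already joined to
        -- `β true true` and `c` to `γ`. Joining `δ` to `b` or to `c` would therefore close a
        -- forbidden triangle, and `a` remains.
        α~β with meets abc {δ} (λ { refl → β≁a _ _ β~δ }) (λ { refl → γ≁b h₀₀ α~γ β~γ γ~δ })
                               (λ { refl → B.≁b bca _ _ β~δ })
        ... | inj₁ δ~a        = on-a δ~a
        ... | inj₂ (inj₁ δ~b) = contradiction
          (common β~δ (~-sym γ~β₁) (~-sym γ~δ) (~-sym (B.spoke true true)) δ~b) (γ≢b h₀₀ α~γ β~γ)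
        ... | inj₂ (inj₂ δ~c) = contradiction
          (common γ~δ γ~β₁ (~-sym β~δ) (γ~c h₀₀ α~γ β~γ) δ~c) (B.≢b true true)

      module Matched (match₀ : ∀ i j → α i false ~ β j false) where

        match : ∀ i j s → α i s ~ β j s
        match i j false = match₀ i j
        match i j true  = opposite (match₀ i j)

        γ : Bool → Bool → P
        γ i j = proj₁ (third (match₀ i j))

        α~γ : ∀ i j → α i false ~ γ i j
        α~γ i j = proj₁ (proj₂ (third (match₀ i j)))

        β~γ : ∀ i j → β j false ~ γ i j
        β~γ i j = proj₂ (proj₂ (third (match₀ i j)))

        α'~γ : ∀ i j → α (not i) true ~ γ i j
        α'~γ i j = ~-sym (γ~α (match₀ i j) (α~γ i j) (β~γ i j) (excludeB (match (not i) j true)))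

        β'~γ : ∀ i j → β (not j) true ~ γ i j
        β'~γ i j = ~-sym (γ~β (match₀ i j) (α~γ i j) (β~γ i j) (excludeA (match i (not j) true)))

        -- The point `γ i j` is already joined to the second points `α (not i) true` and
        -- `β (not j) true`. By `centre`, joining it to a first point as well would make it `a` or
        -- `b`, so on the line of `γ (not i) (not j)` only this point is left.
        γ-rim : ∀ i j → γ i j ~ γ (not i) (not j)
        γ-rim i j = meets₃ (match₀ (not i) (not j) , α~γ (not i) (not j) , β~γ (not i) (not j))
          (λ h → γ≢a (match₀ i j) (α~γ i j) (β~γ i j) (A.centre (not i) false h (~-sym (α'~γ i j))))
          (λ h → γ≢b (match₀ i j) (α~γ i j) (β~γ i j) (B.centre (not j) false h (~-sym (β'~γ i j))))

        γ-row : ∀ i j → γ i j ≢ γ i (not j)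
        γ-row i j e = B.apart j false false (common (α~γ i j) (match₀ i j) (~-sym (β~γ i j))
          (match₀ i (not j)) (subst (_~ β (not j) false) (sym e) (~-sym (β~γ i (not j)))))

        γ-column : ∀ i j → γ i j ≢ γ (not i) j
        γ-column i j e = A.apart i false false (common (β~γ i j) (~-sym (match₀ i j)) (~-sym (α~γ i j))
          (~-sym (match₀ (not i) j)) (subst (_~ α (not i) false) (sym e) (~-sym (α~γ (not i) j))))

        fanC : Fan c a b
        fanC = record
          -- A line through `c` contains `γ i j` and `γ (not i) (not j)`. Hence the line is numbered
          -- by `k`, the exclusive or of `i` and `j`, and the point on it by `s`, which is `i`.
          { pt    = λ k s → γ s (s xor k)
          ; spoke = λ k s → ~-sym (γ~c (match₀ s (s xor k)) (α~γ s (s xor k)) (β~γ s (s xor k)))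
          ; rim   = λ { k false → γ-rim false k ; k true → ~-sym (γ-rim false k) }
          ; ≢b    = λ k s → γ≢a (match₀ s (s xor k)) (α~γ s (s xor k)) (β~γ s (s xor k))
          ; ≢c    = λ k s → γ≢b (match₀ s (s xor k)) (α~γ s (s xor k)) (β~γ s (s xor k))
          ; apart = λ { false false false → γ-row false false
                      ; false false true  → γ-column false false
                      ; false true  false → γ-column true true
                      ; false true  true  → γ-row true true
                      ; true  false false → γ-row false true
                      ; true  false true  → γ-column false true
                      ; true  true  false → γ-column true false
                      ; true  true  true  → γ-row true false }
          }

        coordinates : Frame
        coordinates = record { abc = abc ; fanA = A ; fanB = B ; fanC = fanC }

        open Frame coordinates using (ψ)

        cross₀₁ : ∀ i j s → ψ (arm 0F i s) ~ ψ (arm 1F j s)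
        cross₀₁ = match

        -- In the numbering of `fanC`, `arm 2F (i xor j) (i xor s)` is the point
        -- `γ (i xor s) (j xor s)`. It completes the line through `arm 0F i s` and `arm 1F j s`.
        cross₀₂ : ∀ i j s → ψ (arm 0F i s) ~ ψ (arm 2F (i xor j) (i xor s))
        cross₀₂ false j     false = α~γ false j
        cross₀₂ false j     true  = α'~γ true (not j)
        cross₀₂ true  false false = α~γ true false
        cross₀₂ true  true  false = α~γ true true
        cross₀₂ true  false true  = α'~γ false true
        cross₀₂ true  true  true  = α'~γ false false

        cross₁₂ : ∀ i j s → ψ (arm 1F j s) ~ ψ (arm 2F (i xor j) (i xor s))
        cross₁₂ false j     false = β~γ false j
        cross₁₂ false false true  = β'~γ true true
        cross₁₂ false true  true  = β'~γ true false
        cross₁₂ true  false false = β~γ true false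
        cross₁₂ true  true  false = β~γ true true
        cross₁₂ true  false true  = β'~γ false true
        cross₁₂ true  true  true  = β'~γ false false

    -- These eight lines, the base line and the six lines of the fans are the fifteen lines of the
    -- quadrangle.
    Crossed : Frame → Set _
    Crossed F = ∀ i j s →
      ψ (arm 0F i s) ~ ψ (arm 1F j s) ×
      ψ (arm 0F i s) ~ ψ (arm 2F (i xor j) (i xor s)) ×
      ψ (arm 1F j s) ~ ψ (arm 2F (i xor j) (i xor s))
      where open Frame F

    coordinatised : ∀ {a b c} → Line a b c → ∃ Crossed
    coordinatised {a} {b} {c} abc@(a~b , a~c , b~c) = coordinates , λ i j s → cross₀₁ i j s , cross₀₂ i j s , cross₁₂ i j s
      where
      A₀ : Fan a b c
      A₀ = fan abc
      B₀ B₁ : Fan b c a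
      B₀ = fan (b~c , ~-sym a~b , ~-sym a~c)
      module M₀ = Matching abc A₀ B₀
      toB : ∀ j → ∃[ t ] M₀.α false false ~ M₀.β j t
      toB = M₀.joined false false
      -- Each line at `b` is renamed so that its first point is the one joined to `α false false`.
      B₁ = swap (proj₁ ∘ toB) B₀
      module M₁ = Matching abc A₀ B₁
      -- If the first point is joined to the wrong end of the line at `b`, then by `opposite` the
      -- second point is joined to the right one.
      toA : ∃[ s ] M₁.α true s ~ M₁.β false false
      toA with M₁.joined true false false
      ... | false , h = false , h
      ... | true  , h = true , M₁.opposite {true} {false} {false} {true} h
      A₁ : Fan a b c
      A₁ = swap (λ { false → false ; true → proj₁ toA }) A₀
      module M₂ = Matching abc A₁ B₁
      match₀ : ∀ i j → M₂.α i false ~ M₂.β j false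
      match₀ false j     = proj₂ (toB j)
      match₀ true  false = proj₂ toA
      match₀ true  true  = M₂.completes (match₀ false false) (match₀ false true) (match₀ true false)
      open M₂.Matched match₀

-- Duads of six letters

infix 4 _≟ᴾ_
_≟ᴾ_ : DecidableEquality Pt
p ≟ᴾ q = map′ (λ e → trans (sym (toPt-fromPt p)) (trans (cong toPt e) (toPt-fromPt q))) (cong fromPt)
  (fromPt p Finₚ.≟ fromPt q)

pattern ⦅_,_,_,_,_,_⦆ a b c d e f = a ∷ b ∷ c ∷ d ∷ e ∷ f ∷ []

private
  pattern I = true
  pattern O = false

-- Lines become partitions of the six letters into three pairs. The base line is 12|34|56, and the
-- two fan lines at a base point are the other two ways to split the four remaining letters. The
-- `arm` labels are ordered so that the crossing lines are partitions too, for example 35|26|14.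
label : Pt → FS.Subset 6
label (base 0F)    = ⦅ I , I , O , O , O , O ⦆
label (base 1F)    = ⦅ O , O , I , I , O , O ⦆
label (base 2F)    = ⦅ O , O , O , O , I , I ⦆
label (arm 0F O O) = ⦅ O , O , I , O , I , O ⦆
label (arm 0F O I) = ⦅ O , O , O , I , O , I ⦆
label (arm 0F I O) = ⦅ O , O , O , I , I , O ⦆
label (arm 0F I I) = ⦅ O , O , I , O , O , I ⦆
label (arm 1F O O) = ⦅ O , I , O , O , O , I ⦆
label (arm 1F O I) = ⦅ I , O , O , O , I , O ⦆
label (arm 1F I O) = ⦅ I , O , O , O , O , I ⦆
label (arm 1F I I) = ⦅ O , I , O , O , I , O ⦆
label (arm 2F O O) = ⦅ I , O , O , I , O , O ⦆
label (arm 2F O I) = ⦅ O , I , I , O , O , O ⦆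
label (arm 2F I O) = ⦅ O , I , O , I , O , O ⦆
label (arm 2F I I) = ⦅ I , O , I , O , O , O ⦆

infix 4 _#_
_#_ : Rel Pt 0ℓ
p # q = label p FS.⊆ FS.∁ (label q)

_#?_ : Decidable _#_
p #? q = label p FSₚ.⊆? FS.∁ (label q)

-- The constructors other than `flip` are precisely what a crossed frame provides, so each can be
-- carried over to the points of an arbitrary frame.
data Joined : Rel Pt 0ℓ where
  bases   : ∀ {m m'} → m ≢ m' → Joined (base m) (base m')
  spokes  : ∀ m i s → Joined (base m) (arm m i s)
  rims    : ∀ m i s → Joined (arm m i s) (arm m i (not s))
  cross₀₁ : ∀ i j s → Joined (arm 0F i s) (arm 1F j s)
  cross₀₂ : ∀ i j s → Joined (arm 0F i s) (arm 2F (i xor j) (i xor s))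
  cross₁₂ : ∀ i j s → Joined (arm 1F j s) (arm 2F (i xor j) (i xor s))
  flip    : ∀ {p q} → Joined p q → Joined q p

private
  joined-arms : ∀ m i s m' i' s' → Maybe (Joined (arm m i s) (arm m' i' s'))
  joined-arms 0F i s 1F j s' with s Boolₚ.≟ s'
  ... | yes refl = just (cross₀₁ i j s)
  ... | no _     = nothing
  joined-arms 0F i s 2F k s' with i xor (i xor k) Boolₚ.≟ k | i xor s Boolₚ.≟ s'
  ... | yes e | yes refl = just (subst (λ k → Joined (arm 0F i s) (arm 2F k _)) e (cross₀₂ i (i xor k) s))
  ... | _     | _        = nothing
  joined-arms 1F j s 2F k s' with (k xor j) xor j Boolₚ.≟ k | (k xor j) xor s Boolₚ.≟ s'
  ... | yes e | yes refl = just (subst (λ k' → Joined (arm 1F j s) (arm 2F k' ((k xor j) xor s))) e (cross₁₂ (k xor j) j s))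
  ... | _     | _        = nothing
  joined-arms m i s m' i' s' with m Finₚ.≟ m' | i Boolₚ.≟ i' | not s Boolₚ.≟ s'
  ... | yes refl | yes refl | yes refl = just (rims m i s)
  ... | _        | _        | _        = nothing

  joined : ∀ p q → Maybe (Joined p q)
  joined (base m) (base m') with m Finₚ.≟ m'
  ... | yes _   = nothing
  ... | no m≢m' = just (bases m≢m')
  joined (base m) (arm m' i s) with m Finₚ.≟ m'
  ... | yes refl = just (spokes m i s)
  ... | no _     = nothing
  joined (arm m i s) (base m') = nothing
  joined (arm m i s) (arm m' i' s') = joined-arms m i s m' i' s'

  abstract
    is-joined : ∀ p q → p # q → Is-just (joined p q) ⊎ Is-just (joined q p)
    is-joined = from-yes (∀Pt? λ p → ∀Pt? λ q →
      p #? q →-dec (is-just? (λ _ → yes _) (joined p q) ⊎-dec is-just? (λ _ → yes _) (joined q p)))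

#⇒Joined : ∀ {p q} → p # q → Joined p q
#⇒Joined {p} {q} h with is-joined p q h
... | inj₁ j = to-witness j
... | inj₂ j = flip (to-witness j)

-- r and r' complete q to a line, and r is joined to p.  A map preserving lines that
-- joins the images of p and q then identifies p with r'.
Bridge : Rel Pt 0ℓ
Bridge p q = ∃[ r ] ∃[ r' ] (q # r × q # r' × r # r' × p # r × p ≢ r')

abstract
  -- The quadrangle axiom for duads: on a line through `q`, a point `p` that is neither `q` nor
  -- disjoint from `q` is disjoint from one of the two other points. Thanks to it, the absence of
  -- further orthogonalities in a frame needs no counting.
  bridge : ∀ p q → p ≡ q ⊎ p # q ⊎ Bridge p q
  bridge = from-yes (∀Pt? λ p → ∀Pt? λ q → (p ≟ᴾ q) ⊎-dec (p #? q) ⊎-dec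
    (∃Pt? λ r → ∃Pt? λ r' → (q #? r) ×-dec (q #? r') ×-dec (r #? r') ×-dec (p #? r) ×-dec ¬? (p ≟ᴾ r')))

-- Elements named by zero, one, atoms and complements of atoms

data El {a} (A : Set a) : Set a where
  𝟎 𝟏   : El A
  pos neg : A → El A

-- The one nontrivial comparison is an atom below the complement of another, which is orthogonality.
data Order {a ℓ} {A : Set a} (_⟂_ : Rel A ℓ) : Rel (El A) (a ⊔ ℓ) where
  𝟎≤    : ∀ {x} → Order _⟂_ 𝟎 x
  ≤𝟏    : ∀ {x} → Order _⟂_ x 𝟏
  pos≤pos : ∀ {p} → Order _⟂_ (pos p) (pos p)
  neg≤neg : ∀ {p} → Order _⟂_ (neg p) (neg p)
  pos≤neg : ∀ {p q} → p ⟂ q → Order _⟂_ (pos p) (neg q)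

compl : ∀ {a} {A : Set a} → El A → El A
compl 𝟎      = 𝟏
compl 𝟏      = 𝟎
compl (pos p) = neg p
compl (neg p) = pos p

⟪_⟫ : El Pt → FS.Subset 6
⟪ 𝟎 ⟫    = FS.⊥
⟪ 𝟏 ⟫    = FS.⊤
⟪ pos p ⟫ = label p
⟪ neg p ⟫ = FS.∁ (label p)

private
  ∀Subset? : ∀ {n p} {P : Pred (FS.Subset n) p} → Decidable₁ P → Dec (∀ X → P X)
  ∀Subset? {zero}  P? = map′ (λ h → λ { [] → h }) (λ h → h []) (P? [])
  ∀Subset? {suc n} P? = map′ (λ { (h , k) (true ∷ X) → h X ; (h , k) (false ∷ X) → k X })
    (λ h → h ∘ (true ∷_) , h ∘ (false ∷_)) (∀Subset? (P? ∘ (true ∷_)) ×-dec ∀Subset? (P? ∘ (false ∷_)))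

  ∃El? : ∀ {p} {P : Pred (El Pt) p} → Decidable₁ P → Dec (∃ P)
  ∃El? {P = P} P? = map′ from to (P? 𝟎 ⊎-dec P? 𝟏 ⊎-dec ∃Pt? (P? ∘ pos) ⊎-dec ∃Pt? (P? ∘ neg))
    where
    from : P 𝟎 ⊎ P 𝟏 ⊎ ∃ (P ∘ pos) ⊎ ∃ (P ∘ neg) → ∃ P
    from (inj₁ h)                      = 𝟎 , h
    from (inj₂ (inj₁ h))               = 𝟏 , h
    from (inj₂ (inj₂ (inj₁ (p , h)))) = pos p , h
    from (inj₂ (inj₂ (inj₂ (p , h)))) = neg p , h
    to : ∃ P → P 𝟎 ⊎ P 𝟏 ⊎ ∃ (P ∘ pos) ⊎ ∃ (P ∘ neg)
    to (𝟎 , h)    = inj₁ h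
    to (𝟏 , h)    = inj₂ (inj₁ h)
    to (pos p , h) = inj₂ (inj₂ (inj₁ (p , h)))
    to (neg p , h) = inj₂ (inj₂ (inj₂ (p , h)))

  _≟ˢ_ : DecidableEquality (FS.Subset 6)
  _≟ˢ_ = Vecₚ.≡-dec Boolₚ._≟_

abstract
  ⟪⟫-surjective : ∀ X → Even X → ∃[ x ] ⟪ x ⟫ ≡ X
  ⟪⟫-surjective = from-yes (∀Subset? λ X → (2 ℕ∣.∣? FS.∣ X ∣) →-dec ∃El? λ x → ⟪ x ⟫ ≟ˢ X)

  ⟪⟫-even : ∀ x → Even ⟪ x ⟫
  ⟪⟫-even 𝟎 = ℕ∣.divides 0 refl
  ⟪⟫-even 𝟏 = ℕ∣.divides 3 refl
  ⟪⟫-even (pos p) = from-yes (∀Pt? λ p → 2 ℕ∣.∣? FS.∣ label p ∣) p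
  ⟪⟫-even (neg p) = from-yes (∀Pt? λ p → 2 ℕ∣.∣? FS.∣ FS.∁ (label p) ∣) p

  ⟪⟫-compl : ∀ x → ⟪ compl x ⟫ ≡ FS.∁ ⟪ x ⟫
  ⟪⟫-compl 𝟎      = refl
  ⟪⟫-compl 𝟏      = refl
  ⟪⟫-compl (pos p) = refl
  ⟪⟫-compl (neg p) = from-yes (∀Pt? λ p → label p ≟ˢ FS.∁ (FS.∁ (label p))) p

  ⟪⟫-mono : ∀ {x y} → Order _#_ x y → ⟪ x ⟫ FS.⊆ ⟪ y ⟫
  ⟪⟫-mono 𝟎≤        = FSₚ.⊥⊆
  ⟪⟫-mono ≤𝟏        = FSₚ.⊆⊤
  ⟪⟫-mono pos≤pos     = λ h → h
  ⟪⟫-mono neg≤neg     = λ h → h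
  ⟪⟫-mono (pos≤neg h) = h

  ⊤⊈label : ∀ q → ¬ FS.⊤ FS.⊆ label q
  ⊤⊈label = from-yes (∀Pt? λ q → ¬? (FS.⊤ FSₚ.⊆? label q))

  ⊤⊈∁label : ∀ q → ¬ FS.⊤ FS.⊆ FS.∁ (label q)
  ⊤⊈∁label = from-yes (∀Pt? λ q → ¬? (FS.⊤ FSₚ.⊆? FS.∁ (label q)))

  label⊈⊥ : ∀ p → ¬ label p FS.⊆ FS.⊥
  label⊈⊥ = from-yes (∀Pt? λ p → ¬? (label p FSₚ.⊆? FS.⊥))

  ∁label⊈⊥ : ∀ p → ¬ FS.∁ (label p) FS.⊆ FS.⊥
  ∁label⊈⊥ = from-yes (∀Pt? λ p → ¬? (FS.∁ (label p) FSₚ.⊆? FS.⊥))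

  ∁label⊈label : ∀ p q → ¬ FS.∁ (label p) FS.⊆ label q
  ∁label⊈label = from-yes (∀Pt? λ p → ∀Pt? λ q → ¬? (FS.∁ (label p) FSₚ.⊆? label q))

  label⊆label : ∀ p q → label p FS.⊆ label q → p ≡ q
  label⊆label = from-yes (∀Pt? λ p → ∀Pt? λ q → (label p FSₚ.⊆? label q) →-dec (p ≟ᴾ q))

  ∁label⊆∁label : ∀ p q → FS.∁ (label p) FS.⊆ FS.∁ (label q) → p ≡ q
  ∁label⊆∁label = from-yes (∀Pt? λ p → ∀Pt? λ q → (FS.∁ (label p) FSₚ.⊆? FS.∁ (label q)) →-dec (p ≟ᴾ q))

⟪⟫-cancel : ∀ {x y} → ⟪ x ⟫ FS.⊆ ⟪ y ⟫ → Order _#_ x y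
⟪⟫-cancel {𝟎}    {y}    h = 𝟎≤
⟪⟫-cancel {x}    {𝟏}    h = ≤𝟏
⟪⟫-cancel {𝟏}    {𝟎}    h = contradiction (h {0F} here) λ ()
⟪⟫-cancel {𝟏}    {pos q} h = ⊥-elim (⊤⊈label q h)
⟪⟫-cancel {𝟏}    {neg q} h = ⊥-elim (⊤⊈∁label q h)
⟪⟫-cancel {pos p} {𝟎}    h = ⊥-elim (label⊈⊥ p h)
⟪⟫-cancel {neg p} {𝟎}    h = ⊥-elim (∁label⊈⊥ p h)
⟪⟫-cancel {pos p} {pos q} h with refl ← label⊆label p q h = pos≤pos
⟪⟫-cancel {pos p} {neg q} h = pos≤neg h
⟪⟫-cancel {neg p} {pos q} h = ⊥-elim (∁label⊈label p q h)
⟪⟫-cancel {neg p} {neg q} h with refl ← ∁label⊆∁label p q h = neg≤neg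

module LabelledFrame
  {ℓ} (_~_ : Rel (Fin 15) ℓ) (~-sym : Symmetric _~_) (~-irrefl : ∀ {p} → ¬ p ~ p)
  (common : ∀ {p q r s} → p ~ q → p ~ r → q ~ r → p ~ s → q ~ s → r ≡ s)
  where
  open TriangleFree _~_ ~-sym ~-irrefl common
  module _
    (third : ∀ {p q} → p ~ q → ∃[ r ] (p ~ r × q ~ r))
    (fan : ∀ {a b c} → Line a b c → Fan a b c)
    (F : Frame) (X : Uniqueness.Crossed third fan F) where

    open Frame F

    Joined⇒~ : ∀ {p q} → Joined p q → ψ p ~ ψ q
    Joined⇒~ (bases {0F} {0F} ne) = contradiction refl ne
    Joined⇒~ (bases {0F} {1F} ne) = proj₁ abc
    Joined⇒~ (bases {0F} {2F} ne) = proj₁ (proj₂ abc)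
    Joined⇒~ (bases {1F} {0F} ne) = ~-sym (proj₁ abc)
    Joined⇒~ (bases {1F} {1F} ne) = contradiction refl ne
    Joined⇒~ (bases {1F} {2F} ne) = proj₂ (proj₂ abc)
    Joined⇒~ (bases {2F} {0F} ne) = ~-sym (proj₁ (proj₂ abc))
    Joined⇒~ (bases {2F} {1F} ne) = ~-sym (proj₂ (proj₂ abc))
    Joined⇒~ (bases {2F} {2F} ne) = contradiction refl ne
    Joined⇒~ (spokes 0F i s)  = Fan.spoke fanA i s
    Joined⇒~ (spokes 1F i s)  = Fan.spoke fanB i s
    Joined⇒~ (spokes 2F i s)  = Fan.spoke fanC i s
    Joined⇒~ (rims 0F i s)    = Fan.rim fanA i s
    Joined⇒~ (rims 1F i s)    = Fan.rim fanB i s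
    Joined⇒~ (rims 2F i s)    = Fan.rim fanC i s
    Joined⇒~ (cross₀₁ i j s) = proj₁ (X i j s)
    Joined⇒~ (cross₀₂ i j s) = proj₁ (proj₂ (X i j s))
    Joined⇒~ (cross₁₂ i j s) = proj₂ (proj₂ (X i j s))
    Joined⇒~ (flip h)        = ~-sym (Joined⇒~ h)

    ψ-# : ∀ {p q} → p # q → ψ p ~ ψ q
    ψ-# {p} {q} h = Joined⇒~ (#⇒Joined {p} {q} h)

    ψ-#⁻ : ∀ {p q} → ψ p ~ ψ q → p # q
    ψ-#⁻ {p} {q} h with bridge p q
    ... | inj₁ refl     = contradiction h ~-irrefl
    ... | inj₂ (inj₁ k) = k
    ... | inj₂ (inj₂ (r , r' , q#r , q#r' , r#r' , p#r , p≢r')) = contradiction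
      (ψ-injective (common (ψ-# {q} {r} q#r) (~-sym h) (~-sym (ψ-# {p} {r} p#r)) (ψ-# {q} {r'} q#r') (ψ-# {r} {r'} r#r')))
      p≢r'

-- Finite orthomodular posets

does-true⁻ : ∀ {a} {A : Set a} (A? : Dec A) → does A? ≡ true → A
does-true⁻ (yes a) _ = a

≡true-ext : ∀ {b b'} → (b ≡ true → b' ≡ true) → (b' ≡ true → b ≡ true) → b ≡ b'
≡true-ext {true}  {b'}    f g = sym (f refl)
≡true-ext {false} {true}  f g = g refl
≡true-ext {false} {false} f g = refl

module FiniteOMP {c ℓ₁ ℓ₂} (L : OrthomodularPoset c ℓ₁ ℓ₂)
  (_≤?_ : Decidable (OrthomodularPoset._≤_ L))
  {n} (card : HasCard (OrthomodularPoset.setoid L) n)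
  {N} (atoms : HasCard (Atoms L) N)
  where

  open OrthomodularPoset L renaming (trans to ≤-trans; refl to ≤-refl; reflexive to ≤-reflexive)
  private
    module C = Inverse card
    module A = Inverse atoms

  ≈⇒≥ : ∀ {x y} → x ≈ y → y ≤ x
  ≈⇒≥ e = ≤-reflexive (Eq.sym e)

  infix 4 _≈?_
  _≈?_ : Decidable _≈_
  x ≈? y = map′ (λ e → Eq.trans (Eq.sym (C.strictlyInverseʳ x)) (Eq.trans (C.from-cong e) (C.strictlyInverseʳ y)))
                C.to-cong (C.to x Finₚ.≟ C.to y)

  ≤𝟎⇒≈ : ∀ {x} → x ≤ 0# → x ≈ 0#
  ≤𝟎⇒≈ x≤0 = antisym x≤0 (minimum _)

  ⊥-sym : ∀ {x y} → x ⊥ y → y ⊥ x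
  ⊥-sym {x} {y} x⊥y = ≤-trans (≈⇒≥ (ᗮ-involutive y)) (ᗮ-antitone x⊥y)

  ⊥-irrefl : ∀ {x} → x ⊥ x → x ≈ 0#
  ⊥-irrefl {x} x⊥x = ≤𝟎⇒≈ (proj₂ (proj₂ (ᗮ-meet x)) ≤-refl x⊥x)

  ⊥-mono : ∀ {x y x' y'} → x' ≤ x → y' ≤ y → x ⊥ y → x' ⊥ y'
  ⊥-mono x'≤x y'≤y x⊥y = ≤-trans x'≤x (≤-trans x⊥y (ᗮ-antitone y'≤y))

  atom : Fin N → Carrier
  atom i = proj₁ (A.from i)

  atom-isAtom : ∀ i → IsAtom L (atom i)
  atom-isAtom i = proj₂ (A.from i)

  atom-surjective : ∀ {x} → IsAtom L x → ∃[ i ] atom i ≈ x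
  atom-surjective {x} x-atom = A.to (x , x-atom) , A.strictlyInverseʳ (x , x-atom)

  atom-injective : ∀ {i j} → atom i ≈ atom j → i ≡ j
  atom-injective {i} {j} e = trans (sym (A.strictlyInverseˡ i)) (trans (A.to-cong e) (A.strictlyInverseˡ j))

  atom-≤ : ∀ {i j} → atom i ≤ atom j → i ≡ j
  atom-≤ {i} {j} i≤j with proj₂ (atom-isAtom j) i≤j
  ... | inj₁ i≈0 = contradiction i≈0 (proj₁ (atom-isAtom i))
  ... | inj₂ i≈j = atom-injective i≈j

  -- Descent: pass to a strictly smaller nonzero element while there is one. The order is
  -- transported to `Fin n`, where a finite search decides whether such an element exists and every
  -- partial order is well founded.
  atom-below : ∀ {x} → ¬ x ≈ 0# → ∃[ i ] atom i ≤ x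
  atom-below {x} x≉0 =
    let i , i≤ = go (C.to x) (FinI.po-wellFounded isPO _) (x≉0 ∘ Eq.trans (Eq.sym (C.strictlyInverseʳ x)))
    in i , ≤-trans i≤ (≤-reflexive (C.strictlyInverseʳ x))
    where
    _⊑_ : Rel (Fin n) ℓ₂
    i ⊑ j = C.from i ≤ C.from j
    isPO : IsPartialOrder _≡_ _⊑_
    isPO = record
      { isPreorder = record
        { isEquivalence = ≡.isEquivalence ; reflexive = λ { refl → ≤-refl } ; trans = ≤-trans }
      ; antisym = λ {i} {j} i≤j j≤i → trans (sym (C.strictlyInverseˡ i))
          (trans (C.to-cong (antisym i≤j j≤i)) (C.strictlyInverseˡ j))
      }
    go : ∀ k → Acc (λ i j → i ⊑ j × ¬ i ≡ j) k → ¬ C.from k ≈ 0# → ∃[ i ] atom i ≤ C.from k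
    go k (acc rec) k≉0
      with Finₚ.any? (λ j → (C.from j ≤? C.from k) ×-dec ¬? (j Finₚ.≟ k) ×-dec ¬? (C.from j ≈? 0#))
    ... | yes (j , j≤k , j≢k , j≉0) with i , i≤j ← go j (rec (j≤k , j≢k)) j≉0 = i , ≤-trans i≤j j≤k
    ... | no none = let i , i≈k = atom-surjective (k≉0 , below) in i , ≤-reflexive i≈k
      where
      below : ∀ {y} → y ≤ C.from k → y ≈ 0# ⊎ y ≈ C.from k
      below {y} y≤k with y ≈? 0# | y ≈? C.from k
      ... | yes y≈0 | _       = inj₁ y≈0
      ... | no _    | yes y≈k = inj₂ y≈k
      ... | no y≉0  | no y≉k  = contradiction
        (C.to y , ≤-trans (≤-reflexive (C.strictlyInverseʳ y)) y≤k
                , (λ { refl → y≉k (Eq.sym (C.strictlyInverseʳ y)) })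
                , (λ e → y≉0 (Eq.trans (Eq.sym (C.strictlyInverseʳ y)) e))) none

  -- The orthomodular law writes `y` as the join of `x` and some `z` orthogonal to `x`. As `x`
  -- differs from `y`, this `z` is nonzero and has an atom below it.
  atom-between : ∀ {x y} → x ≤ y → ¬ x ≈ y → ∃[ i ] (atom i ≤ y × atom i ⊥ x)
  atom-between {x} {y} x≤y x≉y with orthomodular x≤y
  ... | z , (z≤y , z⊥x , _) , (_ , _ , lub) with z ≈? 0#
  ... | yes z≈0 = contradiction
        (antisym x≤y (lub ≤-refl (≤-trans (≤-reflexive z≈0) (minimum x)))) x≉y
  ... | no z≉0 with i , i≤z ← atom-below z≉0 = i , ≤-trans i≤z z≤y , ≤-trans i≤z z⊥x

  infix 4 _~_
  _~_ : Rel (Fin N) ℓ₂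
  i ~ j = atom i ⊥ atom j

  _~?_ : Decidable _~_
  i ~? j = atom i ≤? (atom j ᗮ)

  ~-irrefl : ∀ {i} → ¬ i ~ i
  ~-irrefl {i} h = proj₁ (atom-isAtom i) (⊥-irrefl h)

  module _ {i j} (i~j : i ~ j) where

    -- The greatest element orthogonal to both atoms. In three-atom blocks it is the third atom
    -- (`third`).
    cojoin : Carrier
    cojoin = proj₁ (⊥-join i~j) ᗮ

    ≤-cojoin : ∀ {x} → x ⊥ atom i → x ⊥ atom j → x ≤ cojoin
    ≤-cojoin x⊥i x⊥j = ⊥-sym (proj₂ (proj₂ (proj₂ (⊥-join i~j))) (⊥-sym x⊥i) (⊥-sym x⊥j))

    cojoin-⊥ˡ : cojoin ⊥ atom i
    cojoin-⊥ˡ = ᗮ-antitone (proj₁ (proj₂ (⊥-join i~j)))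

    cojoin-⊥ʳ : cojoin ⊥ atom j
    cojoin-⊥ʳ = ᗮ-antitone (proj₁ (proj₂ (proj₂ (⊥-join i~j))))

  -- Extending orthogonal sets of atoms to blocks

  private
    Idx = Fin N → Bool

  _∈ⁱ_ : Fin N → Idx → Set
  i ∈ⁱ S = S i ≡ true

  _near_ : Fin N → Idx → Set ℓ₂
  i near S = ∀ j → j ∈ⁱ S → j ≡ i ⊎ j ~ i

  near? : ∀ i S → Dec (i near S)
  near? i S = Finₚ.all? λ j → (S j Boolₚ.≟ true) →-dec ((j Finₚ.≟ i) ⊎-dec (j ~? i))

  Clique : Idx → Set ℓ₂
  Clique S = ∀ {i} → i ∈ⁱ S → i near S

  insert : Fin N → Idx → Idx
  insert i S j = does (j Finₚ.≟ i) ∨ S j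

  insert-here : ∀ i S → i ∈ⁱ insert i S
  insert-here i S with i Finₚ.≟ i
  ... | yes _  = refl
  ... | no i≢i = contradiction refl i≢i

  insert-there : ∀ i S {j} → j ∈ⁱ S → j ∈ⁱ insert i S
  insert-there i S {j} j∈S with j Finₚ.≟ i
  ... | yes _ = refl
  ... | no _  = j∈S

  insert⁻ : ∀ i S {j} → j ∈ⁱ insert i S → j ≡ i ⊎ j ∈ⁱ S
  insert⁻ i S {j} h with j Finₚ.≟ i
  ... | yes e = inj₁ e
  ... | no _  = inj₂ h

  insert-clique : ∀ i S → Clique S → i near S → Clique (insert i S)
  insert-clique i S S-clique i-near p j q∈ with insert⁻ i S p | insert⁻ i S q∈
  ... | inj₁ refl | inj₁ refl = inj₁ refl
  ... | inj₁ refl | inj₂ j∈S  = i-near j j∈S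
  ... | inj₂ p∈S  | inj₂ j∈S  = S-clique p∈S j j∈S
  ... | inj₂ p∈S  | inj₁ refl with i-near _ p∈S
  ... | inj₁ refl = inj₁ refl
  ... | inj₂ p~i  = inj₂ (⊥-sym p~i)

  saturate : List (Fin N) → Idx → Idx
  saturate []       S = S
  saturate (i ∷ is) S with near? i S
  ... | yes _ = saturate is (insert i S)
  ... | no _  = saturate is S

  saturate-⊇ : ∀ is S {j} → j ∈ⁱ S → j ∈ⁱ saturate is S
  saturate-⊇ []       S h = h
  saturate-⊇ (i ∷ is) S h with near? i S
  ... | yes _ = saturate-⊇ is (insert i S) (insert-there i S h)
  ... | no _  = saturate-⊇ is S h

  saturate-clique : ∀ is S → Clique S → Clique (saturate is S)
  saturate-clique []       S h = h
  saturate-clique (i ∷ is) S h with near? i S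
  ... | yes i-near = saturate-clique is (insert i S) (λ {j} → insert-clique i S h i-near {j})
  ... | no _       = saturate-clique is S h

  -- Nearness to a set is lost, never gained, when the set grows. An index rejected on its only
  -- trial therefore cannot be near the final set.
  saturate-maximal : ∀ is S {i} → i ∈ˡ is → i near saturate is S → i ∈ⁱ saturate is S
  saturate-maximal (i ∷ is) S (here refl) h with near? i S
  ... | yes _ = saturate-⊇ is (insert i S) (insert-here i S)
  ... | no ¬near = contradiction (λ j j∈S → h j (saturate-⊇ is S j∈S)) ¬near
  saturate-maximal (i ∷ is) S (there k∈is) h with near? i S
  ... | yes _ = saturate-maximal is (insert i S) k∈is h
  ... | no _  = saturate-maximal is S k∈is h

  atoms-of : Idx → Func setoid (≡.setoid Bool)
  atoms-of S = record
    { to   = λ x → does (member? x)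
    ; cong = λ {x} {y} x≈y → does-⇔ (mk⇔ (λ (i , i∈S , e) → i , i∈S , Eq.trans e x≈y)
                                        (λ (i , i∈S , e) → i , i∈S , Eq.trans e (Eq.sym x≈y)))
                                   (member? x) (member? y)
    }
    where
    member? : ∀ x → Dec (∃[ i ] (i ∈ⁱ S × atom i ≈ x))
    member? x = Finₚ.any? λ i → (S i Boolₚ.≟ true) ×-dec (atom i ≈? x)

  atoms-of⁺ : ∀ S {i x} → i ∈ⁱ S → atom i ≈ x → x ∈ atoms-of S
  atoms-of⁺ S {i} i∈S e = dec-true (Finₚ.any? _) (i , i∈S , e)

  atoms-of⁻ : ∀ S {x} → x ∈ atoms-of S → ∃[ i ] (i ∈ⁱ S × atom i ≈ x)
  atoms-of⁻ S h = does-true⁻ (Finₚ.any? _) h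

  ∈-resp : ∀ (B : Func setoid (≡.setoid Bool)) {x y} → x ≈ y → x ∈ B → y ∈ B
  ∈-resp B x≈y x∈B = trans (sym (Func.cong B x≈y)) x∈B

  IsAtom-resp : ∀ {x y} → x ≈ y → IsAtom L x → IsAtom L y
  IsAtom-resp x≈y (x≉0 , below) = (λ y≈0 → x≉0 (Eq.trans x≈y y≈0)) ,
    λ z≤y → [ inj₁ , (λ z≈x → inj₂ (Eq.trans z≈x x≈y)) ]′ (below (≤-trans z≤y (≈⇒≥ x≈y)))

  maximal-clique-block : ∀ S → Clique S → (∀ {i} → i near S → i ∈ⁱ S) → IsBlock L (atoms-of S)
  maximal-clique-block S S-clique S-max = (isAtom , orth) , λ {C} → maximal {C}
    where
    isAtom : ∀ {x} → x ∈ atoms-of S → IsAtom L x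
    isAtom h with i , _ , e ← atoms-of⁻ S h = IsAtom-resp e (atom-isAtom i)
    orth : ∀ {x y} → x ∈ atoms-of S → y ∈ atoms-of S → ¬ x ≈ y → x ⊥ y
    orth x∈ y∈ x≉y with i , i∈S , i≈x ← atoms-of⁻ S x∈ | j , j∈S , j≈y ← atoms-of⁻ S y∈ with S-clique j∈S i i∈S
    ... | inj₁ refl = contradiction (Eq.trans (Eq.sym i≈x) j≈y) x≉y
    ... | inj₂ i~j  = ⊥-mono (≈⇒≥ i≈x) (≈⇒≥ j≈y) i~j
    maximal : ∀ {C} → IsOrthogonalAtomSet L C → atoms-of S ⊆ C → C ⊆ atoms-of S
    maximal {C} (C-atoms , C-orth) S⊆C {x} x∈C with i , i≈x ← atom-surjective (C-atoms x∈C) =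
      atoms-of⁺ S (S-max near) i≈x
      where
      near : i near S
      near j j∈S with atom j ≈? x
      ... | yes j≈x = inj₁ (atom-injective (Eq.trans j≈x (Eq.sym i≈x)))
      ... | no j≉x  = inj₂ (⊥-mono ≤-refl (≤-reflexive i≈x) (C-orth (S⊆C (atoms-of⁺ S j∈S Eq.refl)) x∈C j≉x))

  abstract
    extend-to-block : ∀ S → Clique S → ∃[ B ] (IsBlock L B × (∀ k → k ∈ⁱ S → atom k ∈ B) ×
                      (∀ l → (∀ m → atom m ∈ B → m ≡ l ⊎ m ~ l) → atom l ∈ B))
    extend-to-block S S-clique = atoms-of T ,
      maximal-clique-block T (saturate-clique (allFin N) S S-clique) (λ {i} → saturate-maximal (allFin N) S (∈-allFin i)) ,
      (λ k k∈S → atoms-of⁺ T (saturate-⊇ (allFin N) S k∈S) Eq.refl) ,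
      (λ l near → atoms-of⁺ T (saturate-maximal (allFin N) S (∈-allFin l)
                    λ m m∈T → near m (atoms-of⁺ T m∈T Eq.refl)) Eq.refl)
      where
      T : Idx
      T = saturate (allFin N) S

  -- Posets whose blocks have three atoms

  module ThreeAtomBlocks
    (blocks : ∀ {a} → IsAtom L a → HasCard (𝒫 setoid ∣ₛ λ B → IsBlock L B × a ∈ B) 3)
    (sizes : ∀ {B} → IsBlock L B → HasCard (setoid ∣ₛ λ x → x ∈ B) 3)
    where

    Triple : Fin N → Fin N → Fin N → Set ℓ₂
    Triple i j k = i ~ j × i ~ k × j ~ k

    block-triple : ∀ {B} → IsBlock L B → ∃[ i ] ∃[ j ] ∃[ k ]
      (Triple i j k × (atom i ∈ B × atom j ∈ B × atom k ∈ B) × (∀ {l} → atom l ∈ B → l ≡ i ⊎ l ≡ j ⊎ l ≡ k))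
    block-triple {B} B-block@((B-atoms , B-orth) , _) =
      pt 0F , pt 1F , pt 2F , (orth (λ ()) , orth (λ ()) , orth (λ ())) , (pt∈ 0F , pt∈ 1F , pt∈ 2F) , λ {l} → cover {l}
      where
      module S = Inverse (sizes {B} B-block)
      index : ∀ s → ∃[ i ] atom i ≈ proj₁ (S.from s)
      index s = atom-surjective (B-atoms (proj₂ (S.from s)))
      pt : Fin 3 → Fin N
      pt = proj₁ ∘ index
      pt∈ : ∀ s → atom (pt s) ∈ B
      pt∈ s = ∈-resp B (Eq.sym (proj₂ (index s))) (proj₂ (S.from s))
      pt-injective : ∀ {s t} → atom (pt s) ≈ atom (pt t) → s ≡ t
      pt-injective {s} {t} e = trans (sym (S.strictlyInverseˡ s)) (trans
        (S.to-cong (Eq.trans (Eq.sym (proj₂ (index s))) (Eq.trans e (proj₂ (index t))))) (S.strictlyInverseˡ t))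
      orth : ∀ {s t} → s ≢ t → pt s ~ pt t
      orth s≢t = B-orth (pt∈ _) (pt∈ _) (s≢t ∘ pt-injective)
      cover : ∀ {l} → atom l ∈ B → l ≡ pt 0F ⊎ l ≡ pt 1F ⊎ l ≡ pt 2F
      cover {l} l∈B = split (S.to (atom l , l∈B))
          (atom-injective (Eq.trans (Eq.sym (S.strictlyInverseʳ (atom l , l∈B))) (Eq.sym (proj₂ (index _)))))
        where
        split : ∀ s → l ≡ pt s → l ≡ pt 0F ⊎ l ≡ pt 1F ⊎ l ≡ pt 2F
        split 0F e = inj₁ e
        split 1F e = inj₂ (inj₁ e)
        split 2F e = inj₂ (inj₂ e)

    abstract
      block-from : ∀ {B} → IsBlock L B → ∀ {i} → atom i ∈ B → ∃[ j ] ∃[ k ]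
       (Triple i j k × (atom j ∈ B × atom k ∈ B) × (∀ {l} → atom l ∈ B → l ≡ i ⊎ l ≡ j ⊎ l ≡ k))
      block-from {B} B-block i∈B
        with p , q , r , (p~q , p~r , q~r) , (p∈ , q∈ , r∈) , cover ← block-triple {B} B-block
        with cover i∈B
      ... | inj₁ refl        = q , r , (p~q , p~r , q~r) , (q∈ , r∈) , cover
      ... | inj₂ (inj₁ refl) = p , r , (⊥-sym p~q , q~r , p~r) , (p∈ , r∈) ,
        λ l∈ → [ inj₂ ∘ inj₁ , [ inj₁ , inj₂ ∘ inj₂ ]′ ]′ (cover l∈)
      ... | inj₂ (inj₂ refl) = p , q , (⊥-sym p~r , ⊥-sym q~r , p~q) , (p∈ , q∈) ,
        λ l∈ → [ inj₂ ∘ inj₁ , [ inj₂ ∘ inj₂ , inj₁ ]′ ]′ (cover l∈)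

    module _ {i j} (i~j : i ~ j) where
      private
        pair : Idx
        pair = insert i (insert j (λ _ → false))

        pair-clique : Clique pair
        pair-clique {k} = insert-clique i (insert j (λ _ → false))
          (λ {m} → insert-clique j (λ _ → false) (λ ()) (λ _ ()) {m}) i-near {k}
          where
          i-near : i near insert j (λ _ → false)
          i-near k k∈ with insert⁻ j (λ _ → false) {k} k∈
          ... | inj₁ refl = inj₂ (⊥-sym i~j)

        Completion : Set _
        Completion = ∃[ k ] (i ~ k × j ~ k × (∀ l → l ~ i → l ~ j → l ~ k → l ≡ i ⊎ l ≡ j ⊎ l ≡ k))

        completion : Completion
        completion with extend-to-block pair (λ {k} → pair-clique {k})
        ... | B , B-block , ⊇ , sat = split (block-from {B} B-block i∈B)
          where
          i∈B = ⊇ i (insert-here i (insert j (λ _ → false)))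
          j∈B = ⊇ j (insert-there i (insert j (λ _ → false)) {j} (insert-here j (λ _ → false)))
          closed : ∀ {k} → (∀ {l} → atom l ∈ B → l ≡ i ⊎ l ≡ j ⊎ l ≡ k) →
                   ∀ l → l ~ i → l ~ j → l ~ k → l ≡ i ⊎ l ≡ j ⊎ l ≡ k
          closed cover l l~i l~j l~k = cover (sat l near)
            where
            near : ∀ m → atom m ∈ B → m ≡ l ⊎ m ~ l
            near m m∈B with cover m∈B
            ... | inj₁ refl        = inj₂ (⊥-sym l~i)
            ... | inj₂ (inj₁ refl) = inj₂ (⊥-sym l~j)
            ... | inj₂ (inj₂ refl) = inj₂ (⊥-sym l~k)
          split : ∃[ p ] ∃[ q ] (Triple i p q × (atom p ∈ B × atom q ∈ B) ×
                  (∀ {l} → atom l ∈ B → l ≡ i ⊎ l ≡ p ⊎ l ≡ q)) → Completion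
          split (p , q , (i~p , i~q , p~q) , _ , cover) with cover j∈B
          ... | inj₁ refl        = contradiction i~j ~-irrefl
          ... | inj₂ (inj₁ refl) = q , i~q , p~q , closed cover
          ... | inj₂ (inj₂ refl) = p , i~p , ⊥-sym p~q ,
            closed λ l∈ → [ inj₁ , [ inj₂ ∘ inj₂ , inj₂ ∘ inj₁ ]′ ]′ (cover l∈)

        -- If `atom k` were strictly below `cojoin i~j`, an atom orthogonal to it would fit between.
        -- That atom would be orthogonal to all of `i`, `j`, `k`, against the maximality of the
        -- block.
        finish : Completion → ∃[ k ] (i ~ k × j ~ k × atom k ≈ cojoin i~j)
        finish (k , i~k , j~k , complete) with atom k ≈? cojoin i~j
        ... | yes k≈ = k , i~k , j~k , k≈
        ... | no k≉ with l , l≤ , l~k ← atom-between (≤-cojoin i~j (⊥-sym i~k) (⊥-sym j~k)) k≉ =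
          contradiction (complete l l~i l~j l~k) λ where
            (inj₁ refl)        → ~-irrefl l~i
            (inj₂ (inj₁ refl)) → ~-irrefl l~j
            (inj₂ (inj₂ refl)) → ~-irrefl l~k
          where
          l~i : l ~ i
          l~i = ≤-trans l≤ (cojoin-⊥ˡ i~j)
          l~j : l ~ j
          l~j = ≤-trans l≤ (cojoin-⊥ʳ i~j)

      abstract
        third : ∃[ k ] (i ~ k × j ~ k × atom k ≈ cojoin i~j)
        third = finish completion

      -- Whatever is orthogonal to `i` and `j` lies below `cojoin i~j`, which is itself an atom.
      -- This is why triangles outside blocks do not occur.
      third-unique : ∀ {r} → i ~ r → j ~ r → r ≡ proj₁ third
      third-unique i~r j~r =
        atom-≤ (≤-trans (≤-cojoin i~j (⊥-sym i~r) (⊥-sym j~r)) (≈⇒≥ (proj₂ (proj₂ (proj₂ third)))))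

    common : ∀ {p q r s} → p ~ q → p ~ r → q ~ r → p ~ s → q ~ s → r ≡ s
    common p~q p~r q~r p~s q~s = trans (third-unique p~q p~r q~r) (sym (third-unique p~q p~s q~s))

    module Pencil (a : Fin N) where
      private
        module Bl = Inverse (blocks (atom-isAtom a))

        block : Fin 3 → Func setoid (≡.setoid Bool)
        block k = proj₁ (Bl.from k)

        rest : ∀ k → _
        rest k = block-from {block k} (proj₁ (proj₂ (Bl.from k))) {a} (proj₂ (proj₂ (Bl.from k)))

      pt : Fin 3 → Bool → Fin N
      pt k false = proj₁ (rest k)
      pt k true  = proj₁ (proj₂ (rest k))

      spoke : ∀ k s → a ~ pt k s
      spoke k false = proj₁ (proj₁ (proj₂ (proj₂ (rest k))))
      spoke k true  = proj₁ (proj₂ (proj₁ (proj₂ (proj₂ (rest k)))))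

      rim : ∀ k s → pt k s ~ pt k (not s)
      rim k false = proj₂ (proj₂ (proj₁ (proj₂ (proj₂ (rest k)))))
      rim k true  = ⊥-sym (rim k false)

      private
        pt∈ : ∀ k s → atom (pt k s) ∈ block k
        pt∈ k false = proj₁ (proj₁ (proj₂ (proj₂ (proj₂ (rest k)))))
        pt∈ k true  = proj₂ (proj₁ (proj₂ (proj₂ (proj₂ (rest k)))))

        cover : ∀ k {l} → atom l ∈ block k → l ≡ a ⊎ ∃[ s ] l ≡ pt k s
        cover k l∈ with proj₂ (proj₂ (proj₂ (proj₂ (rest k)))) l∈
        ... | inj₁ e        = inj₁ e
        ... | inj₂ (inj₁ e) = inj₂ (false , e)
        ... | inj₂ (inj₂ e) = inj₂ (true , e)

      other : ∀ k l {s s'} → pt k s ≡ pt l s' → pt k (not s) ≡ pt l (not s')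
      other k l {s} {s'} e = common (spoke k s) (spoke k (not s)) (rim k s) (spoke l (not s'))
        (subst (_~ pt l (not s')) (sym e) (rim l s'))

      private
        not-cases : ∀ s t → t ≡ s ⊎ t ≡ not s
        not-cases false false = inj₁ refl
        not-cases false true  = inj₂ refl
        not-cases true  false = inj₂ refl
        not-cases true  true  = inj₁ refl

        module _ k l {s s'} (e : pt k s ≡ pt l s') where

          inside : ∀ {z} → z ≡ a ⊎ ∃[ t ] z ≡ pt k t → atom z ∈ block l
          inside (inj₁ refl) = proj₂ (proj₂ (Bl.from l))
          inside (inj₂ (t , refl)) with not-cases s t
          ... | inj₁ refl = subst (λ w → atom w ∈ block l) (sym e) (pt∈ l s')
          ... | inj₂ refl = subst (λ w → atom w ∈ block l) (sym (other k l {s} {s'} e)) (pt∈ l (not s'))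

          block-⊆ : block k ⊆ block l
          block-⊆ {x} x∈ =
            let z , z≈x = atom-surjective (proj₁ (proj₁ (proj₁ (proj₂ (Bl.from k)))) x∈)
            in ∈-resp (block l) z≈x (inside (cover k (∈-resp (block k) (Eq.sym z≈x) x∈)))

      -- Two blocks through `a` that share a further point share the remaining one as well, by
      -- `common`. Then they are equal as sets, and the enumeration of the blocks through `a` gives
      -- them the same index.
      apart : ∀ k l s s' → k ≢ l → pt k s ≢ pt l s'
      apart k l s s' k≢l e = k≢l (trans (sym (Bl.strictlyInverseˡ k)) (trans
        (Bl.to-cong {Bl.from k} {Bl.from l} (λ x → ≡true-ext (block-⊆ k l {s} {s'} e) (block-⊆ l k {s'} {s} (sym e))))
        (Bl.strictlyInverseˡ l)))

      private
        on : ∀ k b → Dec (∃[ s ] pt k s ≡ b)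
        on k b with pt k false Finₚ.≟ b | pt k true Finₚ.≟ b
        ... | yes e | _     = yes (false , e)
        ... | no _  | yes e = yes (true , e)
        ... | no h  | no h' = no λ { (false , e) → h e ; (true , e) → h' e }

      avoid : ∀ b → ∃[ k ] ∃[ l ] (k ≢ l × (∀ s → pt k s ≢ b) × (∀ s → pt l s ≢ b))
      avoid b with on 0F b | on 1F b
      ... | yes (s' , refl) | _               = 1F , 2F , (λ ()) , (λ s → apart 1F 0F s s' λ ()) , (λ s → apart 2F 0F s s' λ ())
      ... | no h            | yes (s' , refl) = 0F , 2F , (λ ()) , (λ s → apart 0F 1F s s' λ ()) , (λ s → apart 2F 1F s s' λ ())
      ... | no h            | no h'           = 0F , 1F , (λ ()) , (λ s e → h (s , e)) , (λ s e → h' (s , e))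

    ⟦_⟧ : El (Fin N) → Carrier
    ⟦ 𝟎 ⟧    = 0#
    ⟦ 𝟏 ⟧    = 1#
    ⟦ pos i ⟧ = atom i
    ⟦ neg i ⟧ = atom i ᗮ

    private
      Classified : Carrier → Set _
      Classified x = ∃[ e ] x ≈ ⟦ e ⟧

      module _ {i j x} (i~j : i ~ j) (i≤x : atom i ≤ x) (j≤x : atom j ≤ x) where
        w : Carrier
        w = proj₁ (⊥-join i~j)

        w≤x : w ≤ x
        w≤x = proj₂ (proj₂ (proj₂ (⊥-join i~j))) i≤x j≤x

        k : Fin N
        k = proj₁ (third i~j)

        k≈wᗮ : atom k ≈ w ᗮ
        k≈wᗮ = proj₂ (proj₂ (proj₂ (third i~j)))

        above-two : Dec (w ≈ x) → Classified x
        above-two (yes w≈x) = neg k , Eq.trans (Eq.sym w≈x) (Eq.trans (Eq.sym (ᗮ-involutive w))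
          (antisym (ᗮ-antitone (≤-reflexive k≈wᗮ)) (ᗮ-antitone (≈⇒≥ k≈wᗮ))))
        above-two (no w≉x) =
          let l , l≤x , l⊥w = atom-between w≤x w≉x
              k≤x = ≤-trans (≤-reflexive (Eq.reflexive (cong atom (sym (atom-≤ (≤-trans l⊥w (≈⇒≥ k≈wᗮ))))))) l≤x
          in 𝟏 , antisym (maximum x) (proj₂ (proj₂ (ᗮ-join w)) w≤x (≤-trans (≈⇒≥ k≈wᗮ) k≤x))

      above-one : ∀ {i x} → atom i ≤ x → Dec (atom i ≈ x) → Classified x
      above-one {i} i≤x (yes i≈x) = pos i , Eq.sym i≈x
      above-one i≤x (no i≉x) =
        let j , j≤x , j~i = atom-between i≤x i≉x
        in above-two (⊥-sym j~i) i≤x j≤x (_ ≈? _)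

      above-zero : ∀ {x} → Dec (x ≈ 0#) → Classified x
      above-zero (yes x≈0) = 𝟎 , x≈0
      above-zero (no x≉0)  = let i , i≤x = atom-below x≉0 in above-one i≤x (_ ≈? _)

    abstract
      -- Collect orthogonal atoms below `x`. None gives 0, and a single one equal to `x` gives an
      -- atom. Two have a join `w` that is the complement of an atom `k`. If `x` is strictly above
      -- `w`, the next atom is orthogonal to `w`, so it is `k`; thus `x` lies above both `w` and its
      -- complement and is 1.
      classify : ∀ x → ∃[ e ] x ≈ ⟦ e ⟧
      classify x = above-zero (x ≈? 0#)

-- The isomorphism for 15 atoms

module FifteenAtoms {c ℓ₁ ℓ₂} (L : OrthomodularPoset c ℓ₁ ℓ₂)
  (_≤?_ : Decidable (OrthomodularPoset._≤_ L))
  {n} (card : HasCard (OrthomodularPoset.setoid L) n)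
  (hom : IsHomogeneous L 3 3)
  (atoms : HasCard (Atoms L) 15)
  where

  open OrthomodularPoset L renaming (trans to ≤-trans; refl to ≤-refl; reflexive to ≤-reflexive)
  open FiniteOMP L _≤?_ card atoms
  open ThreeAtomBlocks (proj₁ hom) (λ {B} → proj₂ hom {B})
  open TriangleFree _~_ ⊥-sym ~-irrefl common

  fan : ∀ {a b c} → Line a b c → Fan a b c
  fan {a} {b} {c} (a~b , a~c , b~c) with k , l , k≢l , k≢b , l≢b ← Pencil.avoid a b = record
    { pt    = λ { false s → pt k s ; true s → pt l s }
    ; spoke = λ { false s → spoke k s ; true s → spoke l s }
    ; rim   = λ { false s → rim k s ; true s → rim l s }
    ; ≢b    = λ { false s → k≢b s ; true s → l≢b s }
    ; ≢c    = λ { false s → avoid-c k k≢b s ; true s → avoid-c l l≢b s }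
    ; apart = λ { false s s' → apart k l s s' k≢l ; true s s' → apart l k s s' (k≢l ∘ sym) }
    }
    where
    open Pencil a
    avoid-c : ∀ m → (∀ s → pt m s ≢ b) → ∀ s → pt m s ≢ c
    -- A block through `a` that contains `c` has `b` as its third point.
    avoid-c m ≢b s refl = ≢b (not s) (sym (common a~c a~b (⊥-sym b~c) (spoke m (not s)) (rim m s)))

  third′ : ∀ {p q} → p ~ q → ∃[ r ] (p ~ r × q ~ r)
  third′ p~q = let r , p~r , q~r , _ = third p~q in r , p~r , q~r

  open Uniqueness third′ fan using (coordinatised; Crossed)

  abstract
    coordinates : ∃ Crossed
    coordinates = coordinatised {0F} (spoke 0F false , spoke 0F true , rim 0F false)
      where open Pencil 0F

  open Frame (proj₁ coordinates)
  open LabelledFrame _~_ ⊥-sym ~-irrefl common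
  private
    ψ⁺ : ∀ {p q} → p # q → ψ p ~ ψ q
    ψ⁺ {p} {q} = ψ-# third′ fan (proj₁ coordinates) (proj₂ coordinates) {p} {q}

    ψ⁻ : ∀ {p q} → ψ p ~ ψ q → p # q
    ψ⁻ {p} {q} = ψ-#⁻ third′ fan (proj₁ coordinates) (proj₂ coordinates) {p} {q}

  h : El Pt → Carrier
  h 𝟎      = 0#
  h 𝟏      = 1#
  h (pos p) = atom (ψ p)
  h (neg p) = atom (ψ p) ᗮ

  h-surjective : ∀ x → ∃[ e ] x ≈ h e
  h-surjective x = lift (classify x)
    where
    lift : (∃[ e ] x ≈ ⟦ e ⟧) → ∃[ e ] x ≈ h e
    lift (𝟎 , e)    = 𝟎 , e
    lift (𝟏 , e)    = 𝟏 , e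
    lift (pos i , e) = let p , ψp≡i = ψ-surjective i in pos p , subst (λ i → x ≈ atom i) (sym ψp≡i) e
    lift (neg i , e) = let p , ψp≡i = ψ-surjective i in neg p , subst (λ i → x ≈ atom i ᗮ) (sym ψp≡i) e

  h-mono : ∀ {x y} → Order _#_ x y → h x ≤ h y
  h-mono 𝟎≤                = minimum _
  h-mono ≤𝟏                = maximum _
  h-mono pos≤pos             = ≤-refl
  h-mono neg≤neg             = ≤-refl
  h-mono (pos≤neg {p} {q} r) = ψ⁺ {p} {q} r

  private
    ᗮ-cancel : ∀ {x y} → x ᗮ ≤ y ᗮ → y ≤ x
    ᗮ-cancel h = ≤-trans (⊥-sym h) (≤-reflexive (ᗮ-involutive _))

    -- Two different atoms of a block through `i` lie below the complement of `atom i`; they cannot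
    -- both lie below one atom.
    atomᗮ≰atom : ∀ {i j} → ¬ atom i ᗮ ≤ atom j
    atomᗮ≰atom {i} {j} iᗮ≤j = ~-irrefl (subst (λ k → k ~ pt 0F true) (trans (below false) (sym (below true))) (rim 0F false))
      where
      open Pencil i
      below : ∀ s → pt 0F s ≡ j
      below s = atom-≤ (≤-trans (⊥-sym (spoke 0F s)) iᗮ≤j)

  h-cancel : ∀ {x y} → h x ≤ h y → Order _#_ x y
  h-cancel {𝟎}    {y}    r = 𝟎≤
  h-cancel {x}    {𝟏}    r = ≤𝟏
  h-cancel {pos p} {pos q} r with refl ← ψ-injective {p} {q} (atom-≤ r) = pos≤pos
  h-cancel {pos p} {neg q} r = pos≤neg (ψ⁻ {p} {q} r)
  h-cancel {neg p} {pos q} r = contradiction r atomᗮ≰atom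
  h-cancel {neg p} {neg q} r with refl ← ψ-injective {q} {p} (atom-≤ (ᗮ-cancel r)) = neg≤neg
  h-cancel {pos p} {𝟎}    r = contradiction (≤𝟎⇒≈ r) (proj₁ (atom-isAtom _))
  h-cancel {neg p} {𝟎}    r = contradiction (≤-trans r (minimum (atom 0F))) atomᗮ≰atom
  h-cancel {𝟏}    {𝟎}    r = contradiction (≤-trans (maximum (atom 0F ᗮ)) (≤-trans r (minimum (atom 0F)))) atomᗮ≰atom
  h-cancel {𝟏}    {pos q} r = contradiction (≤-trans (maximum (atom 0F ᗮ)) r) atomᗮ≰atom
  h-cancel {𝟏}    {neg q} r = contradiction (≤-trans (maximum _) r) ~-irrefl

  iso : L ≅ 𝓛³₂
  iso = record
    { to = λ x → ⟪ cl x ⟫ , ⟪⟫-even (cl x)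
    ; isOrderIsomorphism = record
      { isOrderMonomorphism = record
        { isOrderHomomorphism = record
          { cong = λ {x} {y} e → FSₚ.⊆-antisym (mono {x} {y} (≤-reflexive e)) (mono {y} {x} (≈⇒≥ e))
          ; mono = λ {x} {y} → mono {x} {y}
          }
        ; injective = λ {x} {y} e → antisym (cancel {x} {y} (FSₚ.⊆-reflexive e)) (cancel {y} {x} (FSₚ.⊆-reflexive (sym e)))
        ; cancel = λ {x} {y} → cancel {x} {y}
        }
      ; surjective = λ (X , X-even) → surjective X X-even
      }
    ; ᗮ-homo = ᗮ-homo′
    }
    where
    cl : Carrier → El Pt
    cl x = proj₁ (h-surjective x)
    cl-≈ : ∀ x → x ≈ h (cl x)
    cl-≈ x = proj₂ (h-surjective x)
    mono : ∀ {x y} → x ≤ y → ⟪ cl x ⟫ FS.⊆ ⟪ cl y ⟫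
    mono {x} {y} x≤y = ⟪⟫-mono (h-cancel {cl x} {cl y} (≤-trans (≈⇒≥ (cl-≈ x)) (≤-trans x≤y (≤-reflexive (cl-≈ y)))))
    cancel : ∀ {x y} → ⟪ cl x ⟫ FS.⊆ ⟪ cl y ⟫ → x ≤ y
    cancel {x} {y} r = ≤-trans (≤-reflexive (cl-≈ x)) (≤-trans (h-mono (⟪⟫-cancel {cl x} {cl y} r)) (≈⇒≥ (cl-≈ y)))
    -- `h` reflects the order, so the choice of a name made by `cl` does not affect the resulting
    -- subset.
    ⟪cl⟫ : ∀ {x} e → x ≈ h e → ⟪ cl x ⟫ ≡ ⟪ e ⟫
    ⟪cl⟫ {x} e x≈he = FSₚ.⊆-antisym
      (⟪⟫-mono (h-cancel {cl x} {e} (≤-trans (≈⇒≥ (cl-≈ x)) (≤-reflexive x≈he))))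
      (⟪⟫-mono (h-cancel {e} {cl x} (≤-trans (≈⇒≥ x≈he) (≤-reflexive (cl-≈ x)))))
    surjective : ∀ X → Even X → ∃[ x ] (∀ {z} → z ≈ x → ⟪ cl z ⟫ ≡ X)
    surjective X X-even = let e , ⟪e⟫≡X = ⟪⟫-surjective X X-even in h e , λ z≈x → trans (⟪cl⟫ e z≈x) ⟪e⟫≡X
    ᗮ-cong : ∀ {x y} → x ≈ y → x ᗮ ≈ y ᗮ
    ᗮ-cong e = antisym (ᗮ-antitone (≈⇒≥ e)) (ᗮ-antitone (≤-reflexive e))
    h-compl : ∀ e → h e ᗮ ≈ h (compl e)
    h-compl 𝟎      = antisym (maximum _) (⊥-sym (minimum _))
    h-compl 𝟏      = ≤𝟎⇒≈ (≤-trans (ᗮ-antitone (maximum _)) (≤-reflexive (ᗮ-involutive _)))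
    h-compl (pos p) = Eq.refl
    h-compl (neg p) = ᗮ-involutive _
    ᗮ-homo′ : ∀ x → ⟪ cl (x ᗮ) ⟫ ≡ FS.∁ ⟪ cl x ⟫
    ᗮ-homo′ x = trans (⟪cl⟫ (compl (cl x)) (Eq.trans (ᗮ-cong (cl-≈ x)) (h-compl (cl x)))) (⟪⟫-compl (cl x))

-- Real numbers

open ℚSolver.+-*-Solver using (solve; _:=_; _:+_; _:-_; _:*_; :-_; con)

-- _≈ℝ_ and _≤ℝ_ unfold, so that x and y cannot be inferred from a proof;
-- from the records below they can.
infix 4 _≃_ _≲_

record _≃_ (x y : ℝ) : Set where
  constructor ⟨_⟩
  field holds : x ≈ℝ y

record _≲_ (x y : ℝ) : Set where
  constructor ⟨_⟩
  field holds : x ≤ℝ y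

open _≃_ renaming (holds to un≃)
open _≲_ renaming (holds to un≲)

private
  module R = Setoid ℝ-setoid

≃-refl : ∀ {x} → x ≃ x
≃-refl {x} = ⟨ R.refl {x} ⟩

≡→≃ : ∀ {x y} → x ≡ y → x ≃ y
≡→≃ refl = ≃-refl

≃-sym : ∀ {x y} → x ≃ y → y ≃ x
≃-sym {x} {y} ⟨ h ⟩ = ⟨ R.sym {x} {y} h ⟩

≃-trans : ∀ {x y z} → x ≃ y → y ≃ z → x ≃ z
≃-trans {x} {y} {z} ⟨ h ⟩ ⟨ k ⟩ = ⟨ R.trans {x} {y} {z} h k ⟩

private
  ½-pos : ∀ {ε} → 0ℚ ℚ.< ε → 0ℚ ℚ.< ε ℚ.* ½
  ½-pos 0<ε = ℚₚ.*-monoˡ-<-pos ½ 0<ε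

  halves : ∀ ε → ε ℚ.* ½ ℚ.+ ε ℚ.* ½ ≡ ε
  halves ε = trans (sym (ℚₚ.*-distribˡ-+ ε ½ ½)) (ℚₚ.*-identityʳ ε)

  N₁≤ : ∀ {i j n} → i ℕ.⊔ j ℕ.≤ n → i ℕ.≤ n
  N₁≤ {i} {j} = ℕₚ.≤-trans (ℕₚ.m≤m⊔n i j)

  N₂≤ : ∀ {i j n} → i ℕ.⊔ j ℕ.≤ n → j ℕ.≤ n
  N₂≤ {i} {j} = ℕₚ.≤-trans (ℕₚ.m≤n⊔m i j)

≡⇒≃ : ∀ {x y} → (∀ n → seq x n ≡ seq y n) → x ≃ y
≡⇒≃ {x} {y} h = ⟨ (λ 0<ε → 0 , λ {n} _ → subst (λ d → ℚ.∣ d ∣ ℚ.≤ _)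
  (sym (trans (cong (ℚ._- seq y n) (h n)) (ℚₚ.+-inverseʳ (seq y n)))) (ℚₚ.<⇒≤ 0<ε)) ⟩

infixl 6 _⊕_ _⊝_
infix 8 ⊖_

-- Opaque copies of the operations: comparing sums for definitional equality must
-- not compare the Cauchy moduli.
abstract
  _⊕_ : ℝ → ℝ → ℝ
  _⊕_ = _+ℝ_

  ⊕≃+ℝ : ∀ x y → x ⊕ y ≃ x +ℝ y
  ⊕≃+ℝ x y = ≃-refl

  fromℚ-⊕ : ∀ p q → fromℚ p ⊕ fromℚ q ≃ fromℚ (p ℚ.+ q)
  fromℚ-⊕ p q = ≡⇒≃ λ _ → refl

  ⊖_ : ℝ → ℝ
  ⊖ x = mkℝ (λ n → ℚ.- seq x n) λ 0<ε → let N , h = cauchy x 0<ε in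
    N , λ {m} {n} N≤m N≤n → subst (ℚ._≤ _) (trans (sym (ℚₚ.∣-p∣≡∣p∣ (seq x m ℚ.- seq x n)))
      (cong ℚ.∣_∣ (solve 2 (λ a b → :- (a :- b) := :- a :- :- b) refl (seq x m) (seq x n)))) (h N≤m N≤n)

  ⊕-cong : ∀ {x x' y y'} → x ≃ x' → y ≃ y' → x ⊕ y ≃ x' ⊕ y'
  ⊕-cong {x} {x'} {y} {y'} ⟨ h ⟩ ⟨ k ⟩ = ⟨ (λ {ε} 0<ε →
    let N , h' = h (½-pos 0<ε)
        M , k' = k (½-pos 0<ε)
    in N ℕ.⊔ M , λ {n} le → subst₂ (λ d e → ℚ.∣ d ∣ ℚ.≤ e)
        (solve 4 (λ a b c d → (a :- b) :+ (c :- d) := (a :+ c) :- (b :+ d)) refl (seq x n) (seq x' n) (seq y n) (seq y' n))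
        (halves ε)
        (ℚₚ.≤-trans (ℚₚ.∣p+q∣≤∣p∣+∣q∣ (seq x n ℚ.- seq x' n) (seq y n ℚ.- seq y' n))
          (ℚₚ.+-mono-≤ (h' (N₁≤ {N} le)) (k' (N₂≤ {N} le))))) ⟩

  ⊖-cong : ∀ {x y} → x ≃ y → ⊖ x ≃ ⊖ y
  ⊖-cong {x} {y} ⟨ h ⟩ = ⟨ (λ 0<ε → let N , h' = h 0<ε in N , λ {n} le → subst (ℚ._≤ _)
    (trans (sym (ℚₚ.∣-p∣≡∣p∣ (seq x n ℚ.- seq y n)))
      (cong ℚ.∣_∣ (solve 2 (λ a b → :- (a :- b) := :- a :- :- b) refl (seq x n) (seq y n)))) (h' le)) ⟩

  ⊕-assoc : ∀ x y z → (x ⊕ y) ⊕ z ≃ x ⊕ (y ⊕ z)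
  ⊕-assoc x y z = ≡⇒≃ λ n → ℚₚ.+-assoc (seq x n) (seq y n) (seq z n)

  ⊕-comm : ∀ x y → x ⊕ y ≃ y ⊕ x
  ⊕-comm x y = ≡⇒≃ λ n → ℚₚ.+-comm (seq x n) (seq y n)

  ⊕-identityˡ : ∀ x → 0ℝ ⊕ x ≃ x
  ⊕-identityˡ x = ≡⇒≃ λ n → ℚₚ.+-identityˡ (seq x n)

  ⊕-identityʳ : ∀ x → x ⊕ 0ℝ ≃ x
  ⊕-identityʳ x = ≡⇒≃ λ n → ℚₚ.+-identityʳ (seq x n)

  ⊕-inverseˡ : ∀ x → (⊖ x) ⊕ x ≃ 0ℝ
  ⊕-inverseˡ x = ≡⇒≃ λ n → ℚₚ.+-inverseˡ (seq x n)

  ⊕-inverseʳ : ∀ x → x ⊕ (⊖ x) ≃ 0ℝ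
  ⊕-inverseʳ x = ≡⇒≃ λ n → ℚₚ.+-inverseʳ (seq x n)

+-abelianGroup : AbelianGroup 0ℓ 0ℓ
+-abelianGroup = record
  { Carrier = ℝ
  ; _≈_ = _≃_
  ; _∙_ = _⊕_
  ; ε = 0ℝ
  ; _⁻¹ = ⊖_
  ; isAbelianGroup = record
    { isGroup = record
      { isMonoid = record
        { isSemigroup = record
          { isMagma = record
            { isEquivalence = record { refl = ≃-refl ; sym = ≃-sym ; trans = ≃-trans }
            ; ∙-cong = ⊕-cong
            }
          ; assoc = ⊕-assoc
          }
        ; identity = ⊕-identityˡ , ⊕-identityʳ
        }
      ; inverse = ⊕-inverseˡ , ⊕-inverseʳ
      ; ⁻¹-cong = ⊖-cong
      }
    ; comm = ⊕-comm
    }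
  }

open AbelianGroup +-abelianGroup using (assoc; comm; identityˡ; identityʳ; ∙-cong; ∙-congˡ; ∙-congʳ)
  renaming (setoid to ≃-setoid)
open AbelianGroupₚ +-abelianGroup using () renaming (∙-cancelˡ to +-cancelˡ; ∙-cancelʳ to +-cancelʳ)
open import Algebra.Properties.CommutativeSemigroup (AbelianGroup.commutativeSemigroup +-abelianGroup)
  using (interchange; x∙yz≈y∙xz)
open import Algebra.Properties.CommutativeMonoid.Mult (AbelianGroup.commutativeMonoid +-abelianGroup)
  using (×-homo-+; ×-congʳ; ×-assocˡ; ×-distrib-+) renaming (_×_ to _·_)

_⊝_ : ℝ → ℝ → ℝ
x ⊝ y = x ⊕ ⊖ y

abstract
  +-[-] : ∀ x y → x ⊕ (y ⊝ x) ≃ y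
  +-[-] x y = ≡⇒≃ λ n → solve 2 (λ a b → a :+ (b :- a) := b) refl (seq x n) (seq y n)

≃-difference : ∀ {x y z} → x ⊕ y ≃ z → y ≃ z ⊝ x
≃-difference {x} {y} {z} h = +-cancelˡ x y (z ⊝ x) (≃-trans h (≃-sym (+-[-] x z)))

private
  -- The embedding of the natural numbers, by the same recursion as `_·_`, so that `seq-·` is a
  -- plain induction.
  ι : ℕ → ℚ
  ι zero    = 0ℚ
  ι (suc k) = 1ℚ ℚ.+ ι k

  ι-nonNeg : ∀ k → 0ℚ ℚ.≤ ι k
  ι-nonNeg zero    = ℚₚ.≤-refl
  ι-nonNeg (suc k) = ℚₚ.+-mono-≤ (ℚₚ.nonNegative⁻¹ 1ℚ) (ι-nonNeg k)

  1≤ι : ∀ k → 1ℚ ℚ.≤ ι (suc k)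
  1≤ι k = ℚₚ.+-monoʳ-≤ 1ℚ (ι-nonNeg k)

  ι-pos : ∀ k → ℚ.Positive (ι (suc k))
  ι-pos k = ℚ.positive (ℚₚ.<-≤-trans (ℚₚ.positive⁻¹ 1ℚ) (1≤ι k))

  ι-nonZero : ∀ k → ℚ.NonZero (ι (suc k))
  ι-nonZero k = ℚₚ.pos⇒nonZero (ι (suc k)) {{ι-pos k}}

  1/ι : ℕ → ℚ
  1/ι k = ℚ.1/_ (ι (suc k)) {{ι-nonZero k}}

  ι-inverse : ∀ k → ι (suc k) ℚ.* 1/ι k ≡ 1ℚ
  ι-inverse k = ℚₚ.*-inverseʳ (ι (suc k)) {{ι-nonZero k}}

  0≤1/ι : ∀ k → 0ℚ ℚ.≤ 1/ι k
  0≤1/ι k = ℚₚ.<⇒≤ (ℚₚ.positive⁻¹ (1/ι k) {{ℚₚ.1/pos⇒pos (ι (suc k)) {{ι-pos k}}}})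

  1/ι≤1 : ∀ k → 1/ι k ℚ.≤ 1ℚ
  1/ι≤1 k = subst₂ ℚ._≤_ (ℚₚ.*-identityˡ (1/ι k)) (ι-inverse k)
    (ℚₚ.*-monoʳ-≤-nonNeg (1/ι k) {{ℚ.nonNegative (0≤1/ι k)}} (1≤ι k))

  abstract
    seq-· : ∀ k x n → seq (k · x) n ≡ ι k ℚ.* seq x n
    seq-· zero    x n = sym (ℚₚ.*-zeroˡ (seq x n))
    seq-· (suc k) x n = trans (cong (seq x n ℚ.+_) (seq-· k x n))
      (solve 2 (λ a b → b :+ a :* b := (con 1ℚ :+ a) :* b) refl (ι k) (seq x n))

infixl 7 _/suc_

abstract
  _/suc_ : ℝ → ℕ → ℝ
  x /suc k = fromℚ (1/ι k) *ℝ x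

  -- Because `1/ι k` is at most 1, differences do not grow and the same index `N` serves for the
  -- quotients.
  /suc-cong : ∀ k {x y} → x ≃ y → x /suc k ≃ y /suc k
  /suc-cong k {x} {y} ⟨ h ⟩ = ⟨ (λ 0<ε → let N , h' = h 0<ε in N , λ {n} le →
    ℚₚ.≤-trans (bound n) (h' le)) ⟩
    where
    bound : ∀ n → ℚ.∣ 1/ι k ℚ.* seq x n ℚ.- 1/ι k ℚ.* seq y n ∣ ℚ.≤ ℚ.∣ seq x n ℚ.- seq y n ∣
    bound n = begin
      ℚ.∣ 1/ι k ℚ.* seq x n ℚ.- 1/ι k ℚ.* seq y n ∣
        ≡⟨ cong ℚ.∣_∣ (solve 3 (λ q a b → q :* a :- q :* b := q :* (a :- b)) refl (1/ι k) (seq x n) (seq y n)) ⟩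
      ℚ.∣ 1/ι k ℚ.* d ∣             ≡⟨ ℚₚ.∣p*q∣≡∣p∣*∣q∣ (1/ι k) d ⟩
      ℚ.∣ 1/ι k ∣ ℚ.* ℚ.∣ d ∣       ≡⟨ cong (ℚ._* ℚ.∣ d ∣) (ℚₚ.0≤p⇒∣p∣≡p (0≤1/ι k)) ⟩
      1/ι k ℚ.* ℚ.∣ d ∣             ≤⟨ ℚₚ.*-monoʳ-≤-nonNeg ℚ.∣ d ∣ {{ℚₚ.∣-∣-nonNeg d}} (1/ι≤1 k) ⟩
      1ℚ ℚ.* ℚ.∣ d ∣                ≡⟨ ℚₚ.*-identityˡ ℚ.∣ d ∣ ⟩
      ℚ.∣ d ∣                       ∎
      where
      open ℚₚ.≤-Reasoning
      d : ℚ
      d = seq x n ℚ.- seq y n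

  ·-/suc : ∀ k x → suc k · (x /suc k) ≃ x
  ·-/suc k x = ≡⇒≃ λ n → trans (seq-· (suc k) (x /suc k) n)
    (trans (sym (ℚₚ.*-assoc (ι (suc k)) (1/ι k) (seq x n)))
    (trans (cong (ℚ._* seq x n) (ι-inverse k)) (ℚₚ.*-identityˡ (seq x n))))

  /suc-· : ∀ k x → (suc k · x) /suc k ≃ x
  /suc-· k x = ≡⇒≃ λ n → trans (cong (1/ι k ℚ.*_) (seq-· (suc k) x n))
    (trans (sym (ℚₚ.*-assoc (1/ι k) (ι (suc k)) (seq x n)))
    (trans (cong (ℚ._* seq x n) (trans (ℚₚ.*-comm (1/ι k) (ι (suc k))) (ι-inverse k))) (ℚₚ.*-identityˡ (seq x n))))

·-cancelˡ : ∀ k {x y} → suc k · x ≃ suc k · y → x ≃ y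
·-cancelˡ k {x} {y} h = ≃-trans {x} {(suc k · x) /suc k} {y} (≃-sym (/suc-· k x))
  (≃-trans {(suc k · x) /suc k} {(suc k · y) /suc k} {y} (/suc-cong k {suc k · x} {suc k · y} h) (/suc-· k y))

≃⇒≲ : ∀ {x y} → x ≃ y → x ≲ y
≃⇒≲ {x} {y} ⟨ h ⟩ = ⟨ (λ {ε} 0<ε → let N , h' = h 0<ε in N , λ {n} le →
  subst (ℚ._≤ seq y n ℚ.+ ε) (solve 2 (λ a b → b :+ (a :- b) := a) refl (seq x n) (seq y n))
    (ℚₚ.+-monoʳ-≤ (seq y n) (ℚₚ.≤-trans (p≤∣p∣ (seq x n ℚ.- seq y n)) (h' le)))) ⟩
  where
  p≤∣p∣ : ∀ p → p ℚ.≤ ℚ.∣ p ∣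
  p≤∣p∣ p with ℚₚ.≤-total 0ℚ p
  ... | inj₁ 0≤p = ℚₚ.≤-reflexive (sym (ℚₚ.0≤p⇒∣p∣≡p 0≤p))
  ... | inj₂ p≤0 = ℚₚ.≤-trans p≤0 (ℚₚ.0≤∣p∣ p)

≲-trans : ∀ {x y z} → x ≲ y → y ≲ z → x ≲ z
≲-trans {x} {y} {z} ⟨ h ⟩ ⟨ k ⟩ = ⟨ (λ {ε} 0<ε →
  let N , h' = h (½-pos 0<ε)
      M , k' = k (½-pos 0<ε)
  in N ℕ.⊔ M , λ {n} le → ℚₚ.≤-trans (h' (N₁≤ {N} le)) (subst (seq y n ℚ.+ ε ℚ.* ½ ℚ.≤_)
      (trans (ℚₚ.+-assoc (seq z n) (ε ℚ.* ½) (ε ℚ.* ½)) (cong (seq z n ℚ.+_) (halves ε)))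
      (ℚₚ.+-monoˡ-≤ (ε ℚ.* ½) (k' (N₂≤ {N} le))))) ⟩

≲-resp : ∀ {x x' y y'} → x ≃ x' → y ≃ y' → x ≲ y → x' ≲ y'
≲-resp x≃x' y≃y' x≲y = ≲-trans (≃⇒≲ (≃-sym x≃x')) (≲-trans x≲y (≃⇒≲ y≃y'))

abstract
  +-monoʳ-≲ : ∀ x {y z} → y ≲ z → x ⊕ y ≲ x ⊕ z
  +-monoʳ-≲ x {y} {z} ⟨ h ⟩ = ⟨ (λ {ε} 0<ε → let N , h' = h 0<ε in N , λ {n} le →
    subst (seq x n ℚ.+ seq y n ℚ.≤_) (sym (ℚₚ.+-assoc (seq x n) (seq z n) ε)) (ℚₚ.+-monoʳ-≤ (seq x n) (h' le))) ⟩

  ≲-+ : ∀ {x y} → 0ℝ ≲ y → x ≲ x ⊕ y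
  ≲-+ {x} {y} 0≲y = ≲-resp (≡⇒≃ λ n → ℚₚ.+-identityʳ (seq x n)) ≃-refl (+-monoʳ-≲ x 0≲y)

  0≲-difference : ∀ {x y} → x ≲ y → 0ℝ ≲ y ⊝ x
  0≲-difference {x} {y} h = ≲-resp (≡⇒≃ λ n → ℚₚ.+-inverseˡ (seq x n))
    (≡⇒≃ λ n → ℚₚ.+-comm (ℚ.- seq x n) (seq y n)) (+-monoʳ-≲ (⊖ x) h)

  difference-≲ : ∀ {x y} → 0ℝ ≲ x → y ⊝ x ≲ y
  difference-≲ {x} {y} h = ≲-resp ≃-refl (≡⇒≃ λ n → solve 2 (λ a b → (b :- a) :+ a := b) refl (seq x n) (seq y n)) (≲-+ h)

fromℚ-mono : ∀ {p q} → p ℚ.≤ q → fromℚ p ≲ fromℚ q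
fromℚ-mono {p} {q} p≤q = ⟨ (λ 0<ε → 0 , λ _ →
  subst (ℚ._≤ _) (ℚₚ.+-identityʳ p) (ℚₚ.+-mono-≤ p≤q (ℚₚ.<⇒≤ 0<ε))) ⟩

-- The order of the reals bounds `p` only by `q + ε`. If `q < p`, a rational `r` strictly between
-- them and `ε = r − q` give the contradiction `p ≤ r < p`.
fromℚ-cancel : ∀ {p q} → fromℚ p ≲ fromℚ q → p ℚ.≤ q
fromℚ-cancel {p} {q} ⟨ h ⟩ with p ℚₚ.≤? q
... | yes p≤q = p≤q
... | no p≰q with r , q<r , r<p ← ℚₚ.<-dense (ℚₚ.≰⇒> p≰q) with h (0<r-q q<r)
  where
  0<r-q : q ℚ.< r → 0ℚ ℚ.< r ℚ.- q
  0<r-q q<r = subst (ℚ._< r ℚ.- q) (ℚₚ.+-inverseʳ q) (ℚₚ.+-monoˡ-< (ℚ.- q) q<r)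
... | N , p≤ = contradiction (ℚₚ.≤-<-trans
  (subst (p ℚ.≤_) (solve 2 (λ a b → a :+ (b :- a) := b) refl q r) (p≤ (ℕₚ.≤-refl {N}))) r<p) (ℚₚ.<-irrefl refl)

-- Linear relations between real numbers

Form : ℕ → Set
Form N = List (ℕ × Fin N)

infixr 7 _⊙_
_⊙_ : ∀ {N} → ℕ → Form N → Form N
k ⊙ []            = []
k ⊙ ((c , i) ∷ F) = (k * c , i) ∷ k ⊙ F

coefficients : ∀ {N} → Form N → Vec ℕ N
coefficients {N} []      = replicate N 0
coefficients ((c , i) ∷ F) = updateAt (coefficients F) i (c ℕ.+_)

combination : ∀ {N} {M : Set} → (M → Form N) → List (ℕ × M) → Form N
combination R []            = []
combination R ((c , l) ∷ P) = (c ⊙ R l) ++ combination R P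

·-distrib-⊕ : ∀ k x y → k · (x ⊕ y) ≃ k · x ⊕ k · y
·-distrib-⊕ k x y = ×-distrib-+ x y k

·-cong : ∀ k {x y} → x ≃ y → k · x ≃ k · y
·-cong k = ×-congʳ k

·-zero : ∀ k → k · 0ℝ ≃ 0ℝ
·-zero zero    = ≃-refl
·-zero (suc k) = ≃-trans (identityˡ _) (·-zero k)

module _ {N} (x : Fin N → ℝ) where

  value : Form N → ℝ
  value []            = 0ℝ
  value ((c , i) ∷ F) = c · x i ⊕ value F

  value-++ : ∀ F G → value (F ++ G) ≃ value F ⊕ value G
  value-++ []            G = ≃-sym (identityˡ _)
  value-++ ((c , i) ∷ F) G = ≃-trans (∙-congˡ (value-++ F G)) (≃-sym (assoc _ _ _))

  value-⊙ : ∀ k F → value (k ⊙ F) ≃ k · value F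
  value-⊙ k []            = ≃-sym (·-zero k)
  value-⊙ k ((c , i) ∷ F) = ≃-trans (∙-cong (≃-sym (×-assocˡ (x i) k c)) (value-⊙ k F)) (≃-sym (·-distrib-⊕ k _ _))

  value-line : ∀ i j k → value ((1 , i) ∷ (1 , j) ∷ (1 , k) ∷ []) ≃ x i ⊕ (x j ⊕ x k)
  value-line i j k = ∙-cong (identityʳ _) (∙-cong (identityʳ _) (≃-trans (identityʳ _) (identityʳ _)))

value-cong : ∀ {N} {x y : Fin N → ℝ} → (∀ i → x i ≃ y i) → ∀ F → value x F ≃ value y F
value-cong h []            = ≃-refl
value-cong h ((c , i) ∷ F) = ∙-cong (·-cong c (h i)) (value-cong h F)

value-reindex : ∀ {N N'} (x : Fin N' → ℝ) (ρ : Fin N → Fin N') {A : Set} (c : A → ℕ) (i : A → Fin N) as →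
                value x (map (λ a → c a , ρ (i a)) as) ≃ value (x ∘ ρ) (map (λ a → c a , i a) as)
value-reindex x ρ c i []       = ≃-refl
value-reindex x ρ c i (a ∷ as) = ∙-congˡ (value-reindex x ρ c i as)

private
  dot : ∀ {N} → Vec ℕ N → (Fin N → ℝ) → ℝ
  dot []       x = 0ℝ
  dot (c ∷ cs) x = c · x zero ⊕ dot cs (x ∘ suc)

  dot-zero : ∀ {N} (x : Fin N → ℝ) → dot (replicate N 0) x ≃ 0ℝ
  dot-zero {zero}  x = ≃-refl
  dot-zero {suc N} x = ≃-trans (identityˡ _) (dot-zero (x ∘ suc))

  dot-update : ∀ {N} (cs : Vec ℕ N) i c x → dot (updateAt cs i (c ℕ.+_)) x ≃ c · x i ⊕ dot cs x
  dot-update (d ∷ cs) zero    c x = ≃-trans (∙-congʳ (×-homo-+ (x zero) c d)) (assoc _ _ _)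
  dot-update (d ∷ cs) (suc i) c x = ≃-trans (∙-congˡ (dot-update cs i c (x ∘ suc))) (x∙yz≈y∙xz _ _ _)

  value≃dot : ∀ {N} (x : Fin N → ℝ) F → value x F ≃ dot (coefficients F) x
  value≃dot x []            = ≃-sym (dot-zero x)
  value≃dot x ((c , i) ∷ F) = ≃-trans (∙-congˡ (value≃dot x F)) (≃-sym (dot-update (coefficients F) i c x))

-- Proof by reflection: after like terms are collected, equality of two forms is a comparison of
-- vectors of natural numbers, which computation decides.
value-determined : ∀ {N} (x : Fin N → ℝ) F G → coefficients F ≡ coefficients G → value x F ≃ value x G
value-determined x F G e = ≃-trans (value≃dot x F) (≃-trans (≡→≃ (cong (λ cs → dot cs x) e)) (≃-sym (value≃dot x G)))

-- A linear consequence of the relations lhs l ≃ rhs l: suc k · (u − v) is the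
-- combination of the differences lhs l − rhs l with coefficients q − p, and both
-- sides are moved so that all coefficients are natural numbers.
module _ {N} {M : Set} (lhs rhs : M → Form N) where

  Certificate : ℕ → (u v : Form N) (p q : List (ℕ × M)) → Set
  Certificate k u v p q =
    coefficients (suc k ⊙ u ++ combination lhs p ++ combination rhs q) ≡
    coefficients (suc k ⊙ v ++ combination rhs p ++ combination lhs q)

  certificate? : ∀ k u v p q → Dec (Certificate k u v p q)
  certificate? k u v p q = Vecₚ.≡-dec ℕₚ._≟_
    (coefficients (suc k ⊙ u ++ combination lhs p ++ combination rhs q))
    (coefficients (suc k ⊙ v ++ combination rhs p ++ combination lhs q))

  module _ (x : Fin N → ℝ) (holds : ∀ l → value x (lhs l) ≃ value x (rhs l)) where
    private
      combination-holds : ∀ P → value x (combination lhs P) ≃ value x (combination rhs P)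
      combination-holds []            = ≃-refl
      combination-holds ((c , l) ∷ P) = begin
        value x (c ⊙ lhs l ++ combination lhs P)         ≈⟨ value-++ x (c ⊙ lhs l) _ ⟩
        value x (c ⊙ lhs l) ⊕ value x (combination lhs P) ≈⟨ ∙-cong (value-⊙ x c (lhs l)) (combination-holds P) ⟩
        c · value x (lhs l) ⊕ value x (combination rhs P) ≈⟨ ∙-congʳ (·-cong c (holds l)) ⟩
        c · value x (rhs l) ⊕ value x (combination rhs P) ≈⟨ ∙-congʳ (value-⊙ x c (rhs l)) ⟨
        value x (c ⊙ rhs l) ⊕ value x (combination rhs P) ≈⟨ value-++ x (c ⊙ rhs l) _ ⟨
        value x (c ⊙ rhs l ++ combination rhs P)         ∎
        where open SetoidReasoning ≃-setoid

    certify : ∀ k u v p q → Certificate k u v p q → value x u ≃ value x v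
    certify k u v p q balanced = ·-cancelˡ k (+-cancelʳ (value x P⁻) _ _ (begin
      suc k · value x u ⊕ value x P⁻      ≈⟨ ∙-cong (value-⊙ x (suc k) u) combination-eq ⟨
      value x (suc k ⊙ u) ⊕ value x P⁺    ≈⟨ value-++ x (suc k ⊙ u) P⁺ ⟨
      value x (suc k ⊙ u ++ P⁺)           ≈⟨ value-determined x (suc k ⊙ u ++ P⁺) (suc k ⊙ v ++ P⁻) balanced ⟩
      value x (suc k ⊙ v ++ P⁻)           ≈⟨ value-++ x (suc k ⊙ v) P⁻ ⟩
      value x (suc k ⊙ v) ⊕ value x P⁻    ≈⟨ ∙-congʳ (value-⊙ x (suc k) v) ⟩
      suc k · value x v ⊕ value x P⁻      ∎))
      where
      open SetoidReasoning ≃-setoid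
      P⁺ P⁻ : Form N
      P⁺ = combination lhs p ++ combination rhs q
      P⁻ = combination rhs p ++ combination lhs q
      combination-eq : value x P⁺ ≃ value x P⁻
      combination-eq = ≃-trans (value-++ x (combination lhs p) _) (≃-trans
        (∙-cong (combination-holds p) (≃-sym (combination-holds q))) (≃-sym (value-++ x (combination rhs p) _)))

-- The orthomodular poset of a configuration

∃Bool? : ∀ {p} {P : Bool → Set p} → (∀ b → Dec (P b)) → Dec (∃ P)
∃Bool? {P = P} P? = map′ [ (λ h → false , h) , (λ h → true , h) ]′ split (P? false ⊎-dec P? true)
  where
  split : ∃ P → P false ⊎ P true
  split (false , h) = inj₁ h
  split (true , h)  = inj₂ h

-- Three lines of three points through each of n points: the k-th line through i
-- consists of i and nb i k b for b : Bool.
Adjacent : ∀ {n} → (Fin n → Fin 3 → Bool → Fin n) → Rel (Fin n) 0ℓ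
Adjacent nb i j = ∃[ k ] ∃[ b ] nb i k b ≡ j

-- `nb-rim` makes the two neighbours on one line adjacent, and `nb-line` excludes triangles:
-- neighbours on different lines through a point are never adjacent. All laws are decidable, so
-- concrete tables are checked by evaluation.
record Configuration (n : ℕ) : Set where
  infix 4 _~_
  field
    nb     : Fin n → Fin 3 → Bool → Fin n
    origin : Fin n

  _~_ : Rel (Fin n) 0ℓ
  _~_ = Adjacent nb

  field
    ~-irrefl : ∀ {i} → ¬ i ~ i
    nb-sym   : ∀ i k b → nb i k b ~ i
    nb-rim   : ∀ i k b → nb i k b ~ nb i k (not b)
    nb-line  : ∀ i k b k' b' → nb i k b ~ nb i k' b' → k ≡ k'

∀Bool? : ∀ {p} {P : Bool → Set p} → (∀ b → Dec (P b)) → Dec (∀ b → P b)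
∀Bool? P? = map′ (λ (f , t) → λ { false → f ; true → t }) (λ h → h false , h true) (P? false ×-dec P? true)

module _ {n} (nb : Fin n → Fin 3 → Bool → Fin n) where

  adjacent? : Decidable (Adjacent nb)
  adjacent? i j = Finₚ.any? λ k → ∃Bool? λ b → nb i k b Finₚ.≟ j

  Laws : Set
  Laws = (∀ i → ¬ Adjacent nb i i) ×
         (∀ i k b → Adjacent nb (nb i k b) i) ×
         (∀ i k b → Adjacent nb (nb i k b) (nb i k (not b))) ×
         (∀ i k b k' b' → Adjacent nb (nb i k b) (nb i k' b') → k ≡ k')

  laws? : Dec Laws
  laws? =
    (Finₚ.all? λ i → ¬? (adjacent? i i)) ×-dec
    (Finₚ.all? λ i → Finₚ.all? λ k → ∀Bool? λ b → adjacent? (nb i k b) i) ×-dec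
    (Finₚ.all? λ i → Finₚ.all? λ k → ∀Bool? λ b → adjacent? (nb i k b) (nb i k (not b))) ×-dec
    (Finₚ.all? λ i → Finₚ.all? λ k → ∀Bool? λ b → Finₚ.all? λ k' → ∀Bool? λ b' →
      adjacent? (nb i k b) (nb i k' b') →-dec (k Finₚ.≟ k'))

  makeConfiguration : Fin n → True laws? → Configuration n
  makeConfiguration origin laws = record
    { nb       = nb
    ; origin   = origin
    ; ~-irrefl = λ {i} → proj₁ (toWitness laws) i
    ; nb-sym   = proj₁ (proj₂ (toWitness laws))
    ; nb-rim   = proj₁ (proj₂ (proj₂ (toWitness laws)))
    ; nb-line  = proj₂ (proj₂ (proj₂ (toWitness laws)))
    }

module Logic {n} (C : Configuration n) where
  open Configuration C

  spoke : ∀ i k b → i ~ nb i k b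
  spoke i k b = k , b , refl

  ~-sym : ∀ {i j} → i ~ j → j ~ i
  ~-sym (k , b , refl) = nb-sym _ k b

  infix 4 _~?_
  _~?_ : Decidable _~_
  i ~? j = Finₚ.any? λ k → ∃Bool? λ b → nb i k b Finₚ.≟ j

  third : ∀ {i j} → i ~ j → Fin n
  third {i} (k , b , _) = nb i k (not b)

  third-~ˡ : ∀ {i j} (h : i ~ j) → i ~ third h
  third-~ˡ (k , b , _) = k , not b , refl

  third-~ʳ : ∀ {i j} (h : i ~ j) → j ~ third h
  third-~ʳ (k , b , refl) = nb-rim _ k b

  third-unique : ∀ {i j l} (h : i ~ j) → i ~ l → j ~ l → l ≡ third h
  third-unique {i} (k , b , refl) (k' , b' , refl) j~l with nb-line i k b k' b' j~l
  ... | refl = cong (nb i k) (Boolₚ.¬-not λ { refl → ~-irrefl j~l })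

  unique : ∀ {i j l m} → i ~ j → i ~ l → j ~ l → i ~ m → j ~ m → l ≡ m
  unique h i~l j~l i~m j~m = trans (third-unique h i~l j~l) (sym (third-unique h i~m j~m))

  nb-injective : ∀ i {k b k' b'} → nb i k b ≡ nb i k' b' → k ≡ k' × b ≡ b'
  nb-injective i {k} {b} {k'} {b'} e with nb-line i k (not b) k' b' (subst (nb i k (not b) ~_) e (~-sym (nb-rim i k b)))
  ... | refl with b Boolₚ.≟ b'
  ...   | yes b≡b' = refl , b≡b'
  ...   | no b≢b'  = contradiction
            (subst (nb i k b ~_) (trans (cong (nb i k) (sym (Boolₚ.¬-not (b≢b' ∘ sym)))) (sym e)) (nb-rim i k b))
            ~-irrefl

  private
    Carrier = El (Fin n)

  infix 4 _≤_
  _≤_ : Rel Carrier 0ℓ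
  _≤_ = Order _~_

  ≤-refl : ∀ {x} → x ≤ x
  ≤-refl {𝟎}    = 𝟎≤
  ≤-refl {𝟏}    = ≤𝟏
  ≤-refl {pos _} = pos≤pos
  ≤-refl {neg _} = neg≤neg

  ≤-trans : ∀ {x y z} → x ≤ y → y ≤ z → x ≤ z
  ≤-trans 𝟎≤        _         = 𝟎≤
  ≤-trans ≤𝟏        ≤𝟏        = ≤𝟏
  ≤-trans pos≤pos     h         = h
  ≤-trans neg≤neg     h         = h
  ≤-trans (pos≤neg h) neg≤neg     = pos≤neg h
  ≤-trans (pos≤neg h) ≤𝟏        = ≤𝟏

  ≤-antisym : ∀ {x y} → x ≤ y → y ≤ x → x ≡ y
  ≤-antisym 𝟎≤    𝟎≤ = refl
  ≤-antisym ≤𝟏    ≤𝟏 = refl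
  ≤-antisym pos≤pos _  = refl
  ≤-antisym neg≤neg _  = refl

  poset : Poset 0ℓ 0ℓ 0ℓ
  poset = record
    { Carrier = Carrier
    ; _≈_ = _≡_
    ; _≤_ = _≤_
    ; isPartialOrder = record
      { isPreorder = record
        { isEquivalence = ≡.isEquivalence ; reflexive = λ { refl → ≤-refl } ; trans = ≤-trans }
      ; antisym = ≤-antisym
      }
    }

  compl-antitone : ∀ {x y} → x ≤ y → compl y ≤ compl x
  compl-antitone 𝟎≤        = ≤𝟏
  compl-antitone ≤𝟏        = 𝟎≤
  compl-antitone pos≤pos     = neg≤neg
  compl-antitone neg≤neg     = pos≤pos
  compl-antitone (pos≤neg h) = pos≤neg (~-sym h)

  compl-involutive : ∀ (x : Carrier) → compl (compl x) ≡ x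
  compl-involutive 𝟎      = refl
  compl-involutive 𝟏      = refl
  compl-involutive (pos _) = refl
  compl-involutive (neg _) = refl

  -- A case list of the orthogonal pairs with their joins. Additivity of states and charges is
  -- checked on these four cases.
  data Join : Carrier → Carrier → Carrier → Set where
    𝟎ˡ    : ∀ {y} → Join 𝟎 y y
    𝟎ʳ    : ∀ {x} → Join x 𝟎 x
    opp   : ∀ {x} → Join x (compl x) 𝟏
    line  : ∀ {i j} (h : i ~ j) → Join (pos i) (pos j) (neg (third h))

  join : ∀ {x y} → x ≤ compl y → ∃ (Join x y)
  join {𝟎}    {y}    _         = y , 𝟎ˡ
  join {x}    {𝟎}    _         = x , 𝟎ʳ
  join {pos i} {pos j} (pos≤neg h) = neg (third h) , line h
  join {pos i} {neg j} pos≤pos     = 𝟏 , opp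
  join {neg i} {pos j} neg≤neg     = 𝟏 , opp

  compl-lub : ∀ x {w} → x ≤ w → compl x ≤ w → 𝟏 ≤ w
  compl-lub 𝟎      _          h          = h
  compl-lub 𝟏      h          _          = h
  compl-lub (pos i) ≤𝟏         _          = ≤𝟏
  compl-lub (pos i) (pos≤neg h)  neg≤neg      = contradiction h ~-irrefl
  compl-lub (neg i) ≤𝟏         _          = ≤𝟏
  compl-lub (neg i) neg≤neg      (pos≤neg h)  = contradiction h ~-irrefl

  -- Besides `𝟏`, the common upper bounds are the elements `neg l` with `l` joined to both `i` and
  -- `j`; triangle-freeness leaves only `l = k`.
  line-lub : ∀ {i j k w} → i ~ j → i ~ k → j ~ k → pos i ≤ w → pos j ≤ w → neg k ≤ w
  line-lub i~j i~k j~k ≤𝟏          _           = ≤𝟏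
  line-lub i~j i~k j~k pos≤pos       pos≤pos       = contradiction i~j ~-irrefl
  line-lub i~j i~k j~k (pos≤neg i~l) (pos≤neg j~l) with refl ← unique i~j i~k j~k i~l j~l = neg≤neg

  isJoin : ∀ {x y z} → Join x y z → IsJoin poset x y z
  isJoin 𝟎ˡ          = 𝟎≤ , ≤-refl , λ _ h → h
  isJoin 𝟎ʳ          = ≤-refl , 𝟎≤ , λ h _ → h
  isJoin (opp {x})   = ≤𝟏 , ≤𝟏 , compl-lub x
  isJoin (line h)    = pos≤neg (third-~ˡ h) , pos≤neg (third-~ʳ h) , line-lub h (third-~ˡ h) (third-~ʳ h)

  isJoin-unique : ∀ {x y z z'} → IsJoin poset x y z → IsJoin poset x y z' → z ≡ z'
  isJoin-unique (x≤z , y≤z , z-lub) (x≤z' , y≤z' , z'-lub) = ≤-antisym (z-lub x≤z' y≤z') (z'-lub x≤z y≤z)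

  compl-glb : ∀ x {w} → w ≤ x → w ≤ compl x → w ≤ 𝟎
  compl-glb x {w} w≤x w≤x' = subst (_≤ 𝟎) (compl-involutive w) (compl-antitone (compl-lub (compl x)
    (compl-antitone w≤x) (compl-antitone w≤x')))

  orthomodular : ∀ {x y} → x ≤ y → ∃[ z ] (IsMeet poset y (compl x) z × IsJoin poset x z y)
  orthomodular {y = y} 𝟎≤ = y , (≤-refl , ≤𝟏 , λ h _ → h) , isJoin 𝟎ˡ
  orthomodular {x} ≤𝟏     = compl x , (≤𝟏 , ≤-refl , λ _ h → h) , isJoin opp
  orthomodular (pos≤pos {p}) = 𝟎 , (𝟎≤ , 𝟎≤ , compl-glb (pos p)) , isJoin 𝟎ʳ
  orthomodular (neg≤neg {p}) = 𝟎 , (𝟎≤ , 𝟎≤ , compl-glb (neg p)) , isJoin 𝟎ʳ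
  -- On the line of `p`, `q` and `k`, the complement of `q` is the join of `p` and `k`.
  orthomodular (pos≤neg {p} {q} h) = pos k , (pos≤neg (~-sym (third-~ʳ h)) , pos≤neg (~-sym (third-~ˡ h)) , glb) ,
    pos≤neg h , pos≤neg (~-sym (third-~ʳ h)) , line-lub (third-~ˡ h) h (~-sym (third-~ʳ h))
    where
    k = third h
    glb : ∀ {w} → w ≤ neg q → w ≤ neg p → w ≤ pos k
    glb 𝟎≤          _           = 𝟎≤
    glb neg≤neg       neg≤neg       = contradiction h ~-irrefl
    glb (pos≤neg l~q) (pos≤neg l~p) with refl ← third-unique h (~-sym l~p) (~-sym l~q) = pos≤pos

  logic : OrthomodularPoset 0ℓ 0ℓ 0ℓ
  logic = record
    { poset        = poset
    ; 0#           = 𝟎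
    ; 1#           = 𝟏
    ; _ᗮ           = compl
    ; minimum      = λ _ → 𝟎≤
    ; maximum      = λ _ → ≤𝟏
    ; ᗮ-antitone   = compl-antitone
    ; ᗮ-involutive = compl-involutive
    ; ᗮ-meet       = λ x → 𝟎≤ , 𝟎≤ , compl-glb x
    ; ᗮ-join       = λ x → isJoin opp
    ; ⊥-join       = λ h → let z , j = join h in z , isJoin j
    ; orthomodular = orthomodular
    }

  open OrthomodularPoset logic using (setoid)

  infix 4 _≟_ _≤?_
  _≟_ : DecidableEquality Carrier
  𝟎    ≟ 𝟎    = yes refl
  𝟎    ≟ 𝟏    = no λ ()
  𝟎    ≟ pos _ = no λ ()
  𝟎    ≟ neg _ = no λ ()
  𝟏    ≟ 𝟎    = no λ ()
  𝟏    ≟ 𝟏    = yes refl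
  𝟏    ≟ pos _ = no λ ()
  𝟏    ≟ neg _ = no λ ()
  pos _ ≟ 𝟎    = no λ ()
  pos _ ≟ 𝟏    = no λ ()
  pos i ≟ pos j = map′ (cong pos) (λ { refl → refl }) (i Finₚ.≟ j)
  pos _ ≟ neg _ = no λ ()
  neg _ ≟ 𝟎    = no λ ()
  neg _ ≟ 𝟏    = no λ ()
  neg _ ≟ pos _ = no λ ()
  neg i ≟ neg j = map′ (cong neg) (λ { refl → refl }) (i Finₚ.≟ j)

  _≤?_ : Decidable _≤_
  𝟎    ≤? y    = yes 𝟎≤
  𝟏    ≤? 𝟎    = no λ ()
  𝟏    ≤? 𝟏    = yes ≤𝟏
  𝟏    ≤? pos _ = no λ ()
  𝟏    ≤? neg _ = no λ ()
  pos _ ≤? 𝟎    = no λ ()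
  pos _ ≤? 𝟏    = yes ≤𝟏
  pos i ≤? pos j = map′ (λ { refl → pos≤pos }) (λ { pos≤pos → refl }) (i Finₚ.≟ j)
  pos i ≤? neg j = map′ pos≤neg (λ { (pos≤neg h) → h }) (i ~? j)
  neg _ ≤? 𝟎    = no λ ()
  neg _ ≤? 𝟏    = yes ≤𝟏
  neg _ ≤? pos _ = no λ ()
  neg i ≤? neg j = map′ (λ { refl → neg≤neg }) (λ { neg≤neg → refl }) (i Finₚ.≟ j)

  finite : IsFinite logic
  finite = _≤?_ , _ , card
    where
    sums : Carrier ↔ (Fin 2 ⊎ (Fin n ⊎ Fin n))
    sums = mk↔ₛ′
      (λ { 𝟎 → inj₁ 0F ; 𝟏 → inj₁ 1F ; (pos i) → inj₂ (inj₁ i) ; (neg i) → inj₂ (inj₂ i) })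
      (λ { (inj₁ 0F) → 𝟎 ; (inj₁ 1F) → 𝟏 ; (inj₂ (inj₁ i)) → pos i ; (inj₂ (inj₂ i)) → neg i })
      (λ { (inj₁ 0F) → refl ; (inj₁ 1F) → refl ; (inj₂ (inj₁ i)) → refl ; (inj₂ (inj₂ i)) → refl })
      (λ { 𝟎 → refl ; 𝟏 → refl ; (pos i) → refl ; (neg i) → refl })
    card : Carrier ↔ Fin (2 + (n + n))
    card = (↔-sym Finₚ.+↔⊎ ↔-∘ (↔-id (Fin 2) ⊎-↔ ↔-sym Finₚ.+↔⊎)) ↔-∘ sums

  pos-isAtom : ∀ i → IsAtom logic (pos i)
  pos-isAtom i = (λ ()) , λ { 𝟎≤ → inj₁ refl ; pos≤pos → inj₂ refl }

  isAtom⇒pos : ∀ {x} → IsAtom logic x → ∃[ i ] x ≡ pos i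
  isAtom⇒pos {𝟎}    (x≢𝟎 , _)   = contradiction refl x≢𝟎
  isAtom⇒pos {𝟏}    (_ , below) with below {pos origin} ≤𝟏
  ... | inj₁ ()
  ... | inj₂ ()
  isAtom⇒pos {pos i} _           = i , refl
  isAtom⇒pos {neg i} (_ , below) with below (pos≤neg (nb-sym i 0F false))
  ... | inj₁ ()
  ... | inj₂ ()

  atoms-card : HasCard (Atoms logic) n
  atoms-card = record
    { to        = λ (x , x-atom) → proj₁ (isAtom⇒pos x-atom)
    ; from      = λ i → pos i , pos-isAtom i
    ; to-cong   = λ { {_ , p} {_ , q} refl → pos-injective (trans (sym (proj₂ (isAtom⇒pos p))) (proj₂ (isAtom⇒pos q))) }
    ; from-cong = cong pos
    ; inverse   = (λ { refl → refl }) , λ { {_ , p} refl → sym (proj₂ (isAtom⇒pos p)) }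
    }
    where
    pos-injective : ∀ {i j : Fin n} → pos i ≡ pos j → i ≡ j
    pos-injective refl = refl

  private
    PL : Set
    PL = Func setoid (≡.setoid Bool)

  lineset : Fin n → Fin 3 → PL
  lineset i k = record
    { to   = λ x → does (x ≟ pos i) ∨ does (x ≟ pos (nb i k false)) ∨ does (x ≟ pos (nb i k true))
    ; cong = λ { refl → refl }
    }

  OnLine : Fin n → Fin 3 → Carrier → Set
  OnLine i k x = x ≡ pos i ⊎ ∃[ b ] x ≡ pos (nb i k b)

  lineset⁺ : ∀ {i k x} → OnLine i k x → x ∈ lineset i k
  lineset⁺ {i} {k} {x} h with x ≟ pos i | x ≟ pos (nb i k false) | x ≟ pos (nb i k true)
  ... | yes _ | _     | _     = refl
  ... | no _  | yes _ | _     = refl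
  ... | no _  | no _  | yes _ = refl
  lineset⁺ (inj₁ e)           | no ≢i | _     | _     = contradiction e ≢i
  lineset⁺ (inj₂ (false , e)) | _     | no ≢f | _     = contradiction e ≢f
  lineset⁺ (inj₂ (true , e))  | _     | _     | no ≢t = contradiction e ≢t

  lineset⁻ : ∀ {i k x} → x ∈ lineset i k → OnLine i k x
  lineset⁻ {i} {k} {x} h with x ≟ pos i | x ≟ pos (nb i k false) | x ≟ pos (nb i k true)
  ... | yes e | _     | _     = inj₁ e
  ... | no _  | yes e | _     = inj₂ (false , e)
  ... | no _  | no _  | yes e = inj₂ (true , e)
  lineset⁻ () | no _  | no _  | no _

  lineset-orthogonal : ∀ i k → IsOrthogonalAtomSet logic (lineset i k)
  lineset-orthogonal i k =
    (λ {x} x∈ → [ (λ { refl → pos-isAtom _ }) , (λ { (_ , refl) → pos-isAtom _ }) ]′ (lineset⁻ {i} {k} {x} x∈)) ,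
    λ {x} {y} x∈ y∈ → orth (lineset⁻ {i} {k} {x} x∈) (lineset⁻ {i} {k} {y} y∈)
    where
    orth : ∀ {x y} → OnLine i k x → OnLine i k y → x ≢ y → x ≤ compl y
    orth (inj₁ refl)       (inj₁ refl)        x≢y = contradiction refl x≢y
    orth (inj₁ refl)       (inj₂ (b , refl))  x≢y = pos≤neg (spoke i k b)
    orth (inj₂ (b , refl)) (inj₁ refl)        x≢y = pos≤neg (nb-sym i k b)
    orth (inj₂ (b , refl)) (inj₂ (b' , refl)) x≢y = pos≤neg
      (subst (λ c → nb i k b ~ nb i k c) (sym (Boolₚ.¬-not λ { refl → x≢y refl })) (nb-rim i k b))

  orthogonal-~ : ∀ {B} → IsOrthogonalAtomSet logic B → ∀ {i j} → pos i ∈ B → pos j ∈ B → i ≡ j ⊎ i ~ j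
  orthogonal-~ (_ , orth) {i} {j} i∈B j∈B with i Finₚ.≟ j
  ... | yes i≡j = inj₁ i≡j
  ... | no i≢j with pos≤neg h ← orth i∈B j∈B (λ { refl → i≢j refl }) = inj₂ h

  ⊆-lineset : ∀ {B} → IsOrthogonalAtomSet logic B → ∀ {i k b} → pos i ∈ B → pos (nb i k b) ∈ B → B ⊆ lineset i k
  ⊆-lineset {B} B-orth {i} {k} {b} i∈B j∈B {x} x∈B with isAtom⇒pos (proj₁ B-orth x∈B)
  ... | l , refl with orthogonal-~ {B} B-orth i∈B x∈B | orthogonal-~ {B} B-orth j∈B x∈B
  ... | inj₁ refl | _         = lineset⁺ {i} {k} (inj₁ refl)
  ... | inj₂ _    | inj₁ refl = lineset⁺ {i} {k} (inj₂ (b , refl))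
  ... | inj₂ i~l  | inj₂ j~l  = lineset⁺ {i} {k} (inj₂ (not b , cong pos (third-unique (spoke i k b) i~l j~l)))

  lineset-block : ∀ i k → IsBlock logic (lineset i k)
  lineset-block i k = lineset-orthogonal i k , λ {C} C-orth ⊆C →
    ⊆-lineset {C} C-orth {i} {k} {false} (⊆C (lineset⁺ {i} {k} (inj₁ refl))) (⊆C (lineset⁺ {i} {k} (inj₂ (false , refl))))

  infix 4 _≐_
  _≐_ : Rel PL 0ℓ
  B ≐ B' = ∀ x → B ⟨$⟩ x ≡ B' ⟨$⟩ x

  ⊆-antisym : ∀ {B B'} → B ⊆ B' → B' ⊆ B → B ≐ B'
  ⊆-antisym f g x = ≡true-ext f g

  -- If the block contains a neighbour of `i`, the two points fix a line that contains the block,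
  -- and maximality makes them equal. If it contains none, it is just the atom `i` and properly
  -- contained in a line, against maximality.
  block-line : ∀ {B} → IsBlock logic B → ∀ {i} → pos i ∈ B → ∃[ k ] B ≐ lineset i k
  block-line {B} (B-orth , B-max) {i} i∈B
    with Finₚ.any? (λ k → ∃Bool? λ b → (B ⟨$⟩ pos (nb i k b)) Boolₚ.≟ true)
  ... | yes (k , b , j∈B) = k , ⊆-antisym {B} {lineset i k} ⊆l (B-max {lineset i k} (lineset-orthogonal i k) ⊆l)
    where
    ⊆l : B ⊆ lineset i k
    ⊆l = ⊆-lineset {B} B-orth {i} {k} {b} i∈B j∈B
  ... | no none = contradiction
    (0F , false , B-max {lineset i 0F} (lineset-orthogonal i 0F) ⊆l (lineset⁺ {i} {0F} (inj₂ (false , refl)))) none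
    where
    ⊆l : B ⊆ lineset i 0F
    ⊆l {x} x∈B with isAtom⇒pos (proj₁ B-orth x∈B)
    ... | l , refl with orthogonal-~ {B} B-orth i∈B x∈B
    ... | inj₁ refl           = lineset⁺ {i} {0F} (inj₁ refl)
    ... | inj₂ (k , b , refl) = contradiction (k , b , x∈B) none

  lineset-injective : ∀ {i k k'} → lineset i k ≐ lineset i k' → k ≡ k'
  lineset-injective {i} {k} {k'} e
    with lineset⁻ {i} {k'} (trans (sym (e (pos (nb i k false)))) (lineset⁺ {i} {k} (inj₂ (false , refl))))
  ... | inj₁ j≡i     = contradiction (subst (_~ i) (pos-injective j≡i) (nb-sym i k false)) ~-irrefl
    where
    pos-injective : ∀ {i j : Fin n} → pos i ≡ pos j → i ≡ j
    pos-injective refl = refl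
  ... | inj₂ (b , e') = proj₁ (nb-injective i (pos-injective e'))
    where
    pos-injective : ∀ {i j : Fin n} → pos i ≡ pos j → i ≡ j
    pos-injective refl = refl

  blocks-card : ∀ {a} → IsAtom logic a → HasCard (𝒫 setoid ∣ₛ λ B → IsBlock logic B × a ∈ B) 3
  blocks-card {a} a-atom with isAtom⇒pos a-atom
  ... | i , refl = record
    { to        = index
    ; from      = λ k → lineset i k , lineset-block i k , lineset⁺ {i} {k} (inj₁ refl)
    ; to-cong   = λ {B} {B'} e → lineset-injective λ x → trans (sym (index-≐ B x)) (trans (e x) (index-≐ B' x))
    ; from-cong = λ { refl x → refl }
    ; inverse   = (λ {k} {B} e → lineset-injective λ x → trans (sym (index-≐ B x)) (e x)) ,
                  λ { {B} refl x → sym (index-≐ B x) }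
    }
    where
    Blk : Set
    Blk = Σ[ B ∈ PL ] (IsBlock logic B × pos i ∈ B)
    index : Blk → Fin 3
    index (B , B-block , i∈B) = proj₁ (block-line {B} B-block i∈B)
    index-≐ : ∀ (B : Blk) → proj₁ B ≐ lineset i (index B)
    index-≐ (B , B-block , i∈B) = proj₂ (block-line {B} B-block i∈B)

  block-inhabited : ∀ {B} → IsBlock logic B → ∃[ i ] pos i ∈ B
  block-inhabited {B} ((B-atoms , _) , B-max) with Finₚ.any? (λ i → (B ⟨$⟩ pos i) Boolₚ.≟ true)
  ... | yes h   = h
  ... | no none = contradiction
    (origin , B-max {lineset origin 0F} (lineset-orthogonal origin 0F) empty (lineset⁺ {origin} {0F} (inj₁ refl))) none
    where
    empty : B ⊆ lineset origin 0F
    empty x∈B with i , refl ← isAtom⇒pos (B-atoms x∈B) = contradiction (i , x∈B) none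

  block-size : ∀ {B} → IsBlock logic B → HasCard (setoid ∣ₛ λ x → x ∈ B) 3
  block-size {B} B-block with i , i∈B ← block-inhabited {B} B-block with k , B≐ ← block-line {B} B-block i∈B = record
    { to        = λ (x , _) → index x
    ; from      = λ s → pt s , trans (B≐ (pt s)) (lineset⁺ {i} {k} (pt∈ s))
    ; to-cong   = cong index
    ; from-cong = cong pt
    ; inverse   = (λ { {s} refl → index-pt s }) ,
                  λ { {x , x∈B} refl → pt-index (lineset⁻ {i} {k} (trans (sym (B≐ x)) x∈B)) }
    }
    where
    pt : Fin 3 → Carrier
    pt 0F = pos i
    pt 1F = pos (nb i k false)
    pt 2F = pos (nb i k true)
    pt∈ : ∀ s → OnLine i k (pt s)
    pt∈ 0F = inj₁ refl
    pt∈ 1F = inj₂ (false , refl)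
    pt∈ 2F = inj₂ (true , refl)
    index : Carrier → Fin 3
    index x = if does (x ≟ pos i) then 0F else if does (x ≟ pos (nb i k false)) then 1F else 2F
    nb≢i : ∀ b → nb i k b ≢ i
    nb≢i b e = ~-irrefl (subst (_~ i) e (nb-sym i k b))
    nb≢nb : nb i k true ≢ nb i k false
    nb≢nb e = ~-irrefl (subst (_~ nb i k false) e (nb-rim i k true))
    index-pt : ∀ s → index (pt s) ≡ s
    index-pt 0F with i Finₚ.≟ i
    ... | yes _ = refl
    ... | no h  = contradiction refl h
    index-pt 1F with nb i k false Finₚ.≟ i | nb i k false Finₚ.≟ nb i k false
    ... | yes e | _     = contradiction e (nb≢i false)
    ... | no _  | yes _ = refl
    ... | no _  | no h  = contradiction refl h
    index-pt 2F with nb i k true Finₚ.≟ i | nb i k true Finₚ.≟ nb i k false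
    ... | yes e | _     = contradiction e (nb≢i true)
    ... | no _  | yes e = contradiction e nb≢nb
    ... | no _  | no _  = refl
    pt-index : ∀ {x} → OnLine i k x → pt (index x) ≡ x
    pt-index {x} h with x ≟ pos i | x ≟ pos (nb i k false)
    ... | yes e | _     = sym e
    ... | no _  | yes e = sym e
    pt-index (inj₁ e)           | no ≢i | no _  = contradiction e ≢i
    pt-index (inj₂ (false , e)) | no _  | no ≢f = contradiction e ≢f
    pt-index (inj₂ (true , e))  | no _  | no _  = sym e

  homogeneous : IsHomogeneous logic 3 3
  homogeneous = blocks-card , λ {B} → block-size {B}

-- States

0≲1 : 0ℝ ≲ 1ℝ
0≲1 = fromℚ-mono (from-yes (ℚ.0ℚ ℚₚ.≤? ℚ.1ℚ))

≲-refl : ∀ {x} → x ≲ x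
≲-refl = ≃⇒≲ ≃-refl

0≲⊕ : ∀ {x y} → 0ℝ ≲ x → 0ℝ ≲ y → 0ℝ ≲ x ⊕ y
0≲⊕ 0≲x 0≲y = ≲-trans 0≲x (≲-+ 0≲y)

bit : Bool → ℕ
bit false = 0
bit true  = 1

module States {n} (C : Configuration n) where
  open Configuration C
  open Logic C

  IsWeight : (Fin n → ℝ) → Set
  IsWeight f = (∀ i → 0ℝ ≲ f i) × (∀ i k → f i ⊕ (f (nb i k false) ⊕ f (nb i k true)) ≃ 1ℝ)

  extend : (Fin n → ℝ) → El (Fin n) → ℝ
  extend f 𝟎       = 0ℝ
  extend f 𝟏       = 1ℝ
  extend f (pos i) = f i
  extend f (neg i) = 1ℝ ⊝ f i

  extend-cong : ∀ {f g} → (∀ i → f i ≃ g i) → ∀ x → extend f x ≃ extend g x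
  extend-cong f≃g 𝟎       = ≃-refl
  extend-cong f≃g 𝟏       = ≃-refl
  extend-cong f≃g (pos i) = f≃g i
  extend-cong f≃g (neg i) = ∙-congˡ (⊖-cong (f≃g i))

  module _ {f : Fin n → ℝ} (weight : IsWeight f) where
    private
      f≥0    = proj₁ weight
      f-line = proj₂ weight

    weight-≤1 : ∀ i → f i ≲ 1ℝ
    weight-≤1 i = ≲-resp ≃-refl (f-line i 0F) (≲-+ (0≲⊕ (f≥0 _) (f≥0 _)))

    extend-≥0 : ∀ x → 0ℝ ≲ extend f x
    extend-≥0 𝟎       = ≲-refl
    extend-≥0 𝟏       = 0≲1
    extend-≥0 (pos i) = f≥0 i
    extend-≥0 (neg i) = 0≲-difference (weight-≤1 i)

    extend-≤1 : ∀ x → extend f x ≲ 1ℝ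
    extend-≤1 𝟎       = 0≲1
    extend-≤1 𝟏       = ≲-refl
    extend-≤1 (pos i) = weight-≤1 i
    extend-≤1 (neg i) = difference-≲ (f≥0 i)

    extend-join : ∀ {x y z} → Join x y z → extend f z ≃ extend f x ⊕ extend f y
    extend-join 𝟎ˡ                         = ≃-sym (identityˡ _)
    extend-join 𝟎ʳ                         = ≃-sym (identityʳ _)
    extend-join (opp {𝟎})                  = ≃-sym (identityˡ _)
    extend-join (opp {𝟏})                  = ≃-sym (identityʳ _)
    extend-join (opp {pos i})              = ≃-sym (+-[-] (f i) 1ℝ)
    extend-join (opp {neg i})              = ≃-trans (≃-sym (+-[-] (f i) 1ℝ)) (comm _ _)
    extend-join (line {i} (k , false , refl)) = ≃-sym (≃-difference
      (≃-trans (comm _ _) (≃-trans (assoc _ _ _) (f-line i k))))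
    extend-join (line {i} (k , true , refl)) = ≃-sym (≃-difference
      (≃-trans (comm _ _) (≃-trans (assoc _ _ _) (≃-trans (∙-congˡ (comm _ _)) (f-line i k)))))

    state : Setoid.Carrier (𝐒 logic)
    state = record { to = extend f ; cong = λ { {x} refl → un≃ (≃-refl {extend f x}) } } ,
      (λ x → un≲ (extend-≥0 x) , un≲ (extend-≤1 x)) ,
      un≃ (≃-refl {1ℝ}) ,
      λ {x} {y} {z} → additive {x} {y} {z}
      where
      additive : ∀ {x y z} → x ≤ compl y → IsJoin poset x y z → extend f z ≈ℝ extend f x +ℝ extend f y
      additive {x} {y} {z} h z-join with join h
      ... | w , j with refl ← isJoin-unique z-join (isJoin j) = un≃ (≃-trans (extend-join j) (⊕≃+ℝ _ _))

  Join⇒⊥ : ∀ {x y z} → Join x y z → x ≤ compl y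
  Join⇒⊥ 𝟎ˡ            = 𝟎≤
  Join⇒⊥ 𝟎ʳ            = ≤𝟏
  Join⇒⊥ (opp {𝟎})     = 𝟎≤
  Join⇒⊥ (opp {𝟏})     = ≤𝟏
  Join⇒⊥ (opp {pos i}) = pos≤pos
  Join⇒⊥ (opp {neg i}) = neg≤neg
  Join⇒⊥ (line h)      = pos≤neg h

  -- Additivity without bounds and with an arbitrary value at `𝟏`, so that it covers states and
  -- signed measures alike.
  IsCharge : (El (Fin n) → ℝ) → Set
  IsCharge s = ∀ {x y z} → Join x y z → s z ≃ s x ⊕ s y

  module _ {s : El (Fin n) → ℝ} (s-join : IsCharge s) where

    charge-zero : s 𝟎 ≃ 0ℝ
    charge-zero = ≃-sym (+-cancelˡ (s 𝟎) _ _ (≃-trans (identityʳ _) (s-join 𝟎ˡ)))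

    charge-opposite : ∀ x → s (compl x) ≃ s 𝟏 ⊝ s x
    charge-opposite x = ≃-difference (≃-sym (s-join opp))

    charge-line : ∀ i k → s (pos i) ⊕ (s (pos (nb i k false)) ⊕ s (pos (nb i k true))) ≃ s 𝟏
    charge-line i k = ≃-trans (≃-sym (assoc _ _ _)) (≃-trans
      (∙-congʳ (≃-sym (s-join (line (spoke i k false))))) (≃-trans (comm _ _) (≃-sym (s-join opp))))

  -- The value at `𝟏` is recovered as the sum over any line, and the values at complements follow
  -- from it.
  charge-determined : ∀ {s s'} → IsCharge s → IsCharge s' → (∀ i → s (pos i) ≃ s' (pos i)) → ∀ x → s x ≃ s' x
  charge-determined {s} {s'} s-join s'-join agree = go
    where
    one : s 𝟏 ≃ s' 𝟏
    one = ≃-trans (≃-sym (charge-line s-join origin 0F))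
      (≃-trans (∙-cong (agree _) (∙-cong (agree _) (agree _))) (charge-line s'-join origin 0F))
    go : ∀ x → s x ≃ s' x
    go 𝟎       = ≃-trans (charge-zero s-join) (≃-sym (charge-zero s'-join))
    go 𝟏       = one
    go (pos i) = agree i
    go (neg i) = ≃-trans (charge-opposite s-join (pos i))
      (≃-trans (∙-cong one (⊖-cong (agree i))) (≃-sym (charge-opposite s'-join (pos i))))

  module _ (state : Setoid.Carrier (𝐒 logic)) where
    private
      s          = proj₁ state
      s-bounds   = proj₁ (proj₂ state)
      s-one      = proj₁ (proj₂ (proj₂ state))
      s-additive : ∀ {x y z} → x ≤ compl y → IsJoin poset x y z → Func.to s z ≈ℝ Func.to s x +ℝ Func.to s y
      s-additive = proj₂ (proj₂ (proj₂ state))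

    restrict : Fin n → ℝ
    restrict i = Func.to s (pos i)

    state-charge : IsCharge (Func.to s)
    state-charge j = ≃-trans ⟨ s-additive (Join⇒⊥ j) (isJoin j) ⟩ (≃-sym (⊕≃+ℝ _ _))

    state-≥0 : ∀ x → 0ℝ ≲ Func.to s x
    state-≥0 x = ⟨ proj₁ (s-bounds x) ⟩

    state-line : ∀ i k → restrict i ⊕ (restrict (nb i k false) ⊕ restrict (nb i k true)) ≃ 1ℝ
    state-line i k = ≃-trans (charge-line state-charge i k) ⟨ s-one ⟩

    state-extend : ∀ x → Func.to s x ≃ extend restrict x
    state-extend 𝟎       = charge-zero state-charge
    state-extend 𝟏       = ⟨ s-one ⟩
    state-extend (pos i) = ≃-refl
    state-extend (neg i) = ≃-trans (charge-opposite state-charge (pos i)) (∙-congʳ ⟨ s-one ⟩)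

    state-mono : ∀ {x y} → x ≤ y → Func.to s x ≲ Func.to s y
    state-mono {x} {y} x≤y =
      let z , (_ , z≤x' , _) , j = orthomodular x≤y
          x⊥z = subst (_≤ compl z) (compl-involutive x) (compl-antitone z≤x')
      in ≲-resp ≃-refl (≃-trans (⊕≃+ℝ _ _) (≃-sym ⟨ s-additive x⊥z j ⟩)) (≲-+ (state-≥0 z))

  -- The sums of bits say that the set `g` meets every line in exactly one point; as equations
  -- between natural numbers they can be checked by evaluation.
  module Transversal (g : Fin n → Bool)
    (transversal : ∀ i k → bit (g i) + (bit (g (nb i k false)) + bit (g (nb i k true))) ≡ 1) where

    private
      indicator : Bool → ℝ
      indicator false = 0ℝ
      indicator true  = 1ℝ

      sum : ∀ a b c → bit a + (bit b + bit c) ≡ 1 → indicator a ⊕ (indicator b ⊕ indicator c) ≃ 1ℝ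
      sum true  false false _ = ≃-trans (∙-congˡ (identityˡ _)) (identityʳ _)
      sum false true  false _ = ≃-trans (identityˡ _) (identityʳ _)
      sum false false true  _ = ≃-trans (identityˡ _) (identityˡ _)

      nonneg : ∀ a → 0ℝ ≲ indicator a
      nonneg false = ≲-refl
      nonneg true  = 0≲1

    holds : El (Fin n) → Bool
    holds 𝟎       = false
    holds 𝟏       = true
    holds (pos i) = g i
    holds (neg i) = not (g i)

    private
      extend-holds : ∀ x → extend (indicator ∘ g) x ≃ indicator (holds x)
      extend-holds 𝟎       = ≃-refl
      extend-holds 𝟏       = ≃-refl
      extend-holds (pos i) = ≃-refl
      extend-holds (neg i) with g i
      ... | false = ≃-sym (≃-difference (identityˡ _))
      ... | true  = ≃-sym (≃-difference (identityʳ _))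

    two-valued-state : Setoid.Carrier (𝐒₂ logic)
    two-valued-state =
      state {indicator ∘ g} ((λ i → nonneg (g i)) , λ i k → sum _ _ _ (transversal i k)) ,
      λ x → cases x (holds x) (extend-holds x)
      where
      cases : ∀ x b → extend (indicator ∘ g) x ≃ indicator b → extend (indicator ∘ g) x ≈ℝ 0ℝ ⊎ extend (indicator ∘ g) x ≈ℝ 1ℝ
      cases x false ⟨ h ⟩ = inj₁ h
      cases x true  ⟨ h ⟩ = inj₂ h

    two-valued-state-one : ∀ {x} → holds x ≡ true → _at_ logic two-valued-state x ≃ 1ℝ
    two-valued-state-one {x} e = ≃-trans (extend-holds x) (≡→≃ (cong indicator e))

    two-valued-state-zero : ∀ {x} → holds x ≡ false → _at_ logic two-valued-state x ≃ 0ℝ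
    two-valued-state-zero {x} e = ≃-trans (extend-holds x) (≡→≃ (cong indicator e))

1≴0 : ¬ 1ℝ ≲ 0ℝ
1≴0 h = from-yes (¬? (ℚ.1ℚ ℚₚ.≤? ℚ.0ℚ)) (fromℚ-cancel h)

1≄0 : ¬ 1ℝ ≃ 0ℝ
1≄0 h = 1≴0 (≃⇒≲ h)

∨-true : ∀ a b → a ∨ b ≡ true → a ≡ true ⊎ b ≡ true
∨-true true  b e = inj₁ refl
∨-true false b e = inj₂ e

-- Total representations

module TotalRep {c ℓ₁ ℓ₂} (L : OrthomodularPoset c ℓ₁ ℓ₂) where
  open OrthomodularPoset L renaming (refl to ≤-refl; trans to ≤-trans; reflexive to ≤-reflexive)

  Ω : Setoid _ _
  Ω = 𝐒₂ L

  infix 10 _$_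
  _$_ : Setoid.Carrier Ω → Carrier → ℝ
  μ $ x = _at_ L μ x

  module _ (μ : Setoid.Carrier Ω) where

    two-valued : ∀ x → μ $ x ≃ 0ℝ ⊎ μ $ x ≃ 1ℝ
    two-valued x = [ inj₁ ∘ ⟨_⟩ , inj₂ ∘ ⟨_⟩ ]′ (proj₂ μ x)

    not-one : ∀ x → ¬ μ $ x ≃ 1ℝ → μ $ x ≃ 0ℝ
    not-one x ≄1 = [ (λ h → h) , (λ h → contradiction h ≄1) ]′ (two-valued x)

    additive : ∀ {x y z} → x ⊥ y → IsJoin poset x y z → μ $ z ≃ μ $ x ⊕ μ $ y
    additive x⊥y j = ≃-trans ⟨ proj₂ (proj₂ (proj₂ (proj₁ μ))) x⊥y j ⟩ (≃-sym (⊕≃+ℝ _ _))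

    opposite : ∀ x → μ $ x ⊕ μ $ (x ᗮ) ≃ 1ℝ
    opposite x = ≃-trans (≃-sym (additive (≤-reflexive (Eq.sym (ᗮ-involutive x))) (ᗮ-join x)))
      ⟨ proj₁ (proj₂ (proj₂ (proj₁ μ))) ⟩

    opposite-0 : ∀ x → μ $ x ≃ 0ℝ → μ $ (x ᗮ) ≃ 1ℝ
    opposite-0 x h = ≃-trans (≃-sym (identityˡ _)) (≃-trans (∙-congʳ (≃-sym h)) (opposite x))

    opposite-1 : ∀ x → μ $ x ≃ 1ℝ → ¬ μ $ (x ᗮ) ≃ 1ℝ
    opposite-1 x h k = 1≄0 (+-cancelˡ 1ℝ _ _
      (≃-trans (∙-cong (≃-sym h) (≃-sym k)) (≃-trans (opposite x) (≃-sym (identityʳ _)))))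

    -- By additivity, values 1 at both x and y would give the value 2 at z.
    exclusive : ∀ {x y z} → x ⊥ y → IsJoin poset x y z → μ $ x ≃ 1ℝ → ¬ μ $ y ≃ 1ℝ
    exclusive {z = z} x⊥y j h k with two-valued z
    ... | inj₁ z≃0 = 1≴0 (≲-resp ≃-refl (≃-trans (∙-cong (≃-sym h) (≃-sym k)) (≃-trans (≃-sym (additive x⊥y j)) z≃0)) (≲-+ 0≲1))
    ... | inj₂ z≃1 = 1≄0 (+-cancelˡ 1ℝ _ _ (≃-trans (∙-cong (≃-sym h) (≃-sym k))
      (≃-trans (≃-sym (additive x⊥y j)) (≃-trans z≃1 (≃-sym (identityʳ _))))))

    join-one⁻ : ∀ {x y z} → x ⊥ y → IsJoin poset x y z → μ $ z ≃ 1ℝ → μ $ x ≃ 1ℝ ⊎ μ $ y ≃ 1ℝ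
    join-one⁻ {x} x⊥y j h with two-valued x
    ... | inj₁ x≃0 = inj₂ (≃-trans (≃-sym (identityˡ _)) (≃-trans (∙-congʳ (≃-sym x≃0)) (≃-trans (≃-sym (additive x⊥y j)) h)))
    ... | inj₂ x≃1 = inj₁ x≃1

    join-oneˡ : ∀ {x y z} → x ⊥ y → IsJoin poset x y z → μ $ x ≃ 1ℝ → μ $ z ≃ 1ℝ
    join-oneˡ {y = y} x⊥y j h = ≃-trans (additive x⊥y j)
      (≃-trans (∙-cong h (not-one y (exclusive x⊥y j h))) (identityʳ _))

    join-oneʳ : ∀ {x y z} → x ⊥ y → IsJoin poset x y z → μ $ y ≃ 1ℝ → μ $ z ≃ 1ℝ
    join-oneʳ {x} x⊥y j h = ≃-trans (additive x⊥y j)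
      (≃-trans (∙-cong (not-one x (λ k → exclusive x⊥y j k h)) h) (identityˡ _))

  private
    Ev : Set _
    Ev = Setoid.Carrier (𝒫 Ω)

  is-one : ∀ {x} → x ≃ 0ℝ ⊎ x ≃ 1ℝ → Bool
  is-one (inj₁ _) = false
  is-one (inj₂ _) = true

  is-one⁺ : ∀ {x} (h : x ≃ 0ℝ ⊎ x ≃ 1ℝ) → x ≃ 1ℝ → is-one h ≡ true
  is-one⁺ (inj₁ x≃0) x≃1 = contradiction (≃-trans (≃-sym x≃1) x≃0) 1≄0
  is-one⁺ (inj₂ _)   _   = refl

  is-one⁻ : ∀ {x} (h : x ≃ 0ℝ ⊎ x ≃ 1ℝ) → is-one h ≡ true → x ≃ 1ℝ
  is-one⁻ (inj₂ x≃1) _ = x≃1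

  Represents : Carrier → Ev → Set _
  Represents x X = ∀ μ → _∈_ {S = Ω} μ X ⇔ _at_ L μ x ≈ℝ 1ℝ

  module _ {x X} (r : Represents x X) where
    represents⁺ : ∀ μ → μ $ x ≃ 1ℝ → X ⟨$⟩ μ ≡ true
    represents⁺ μ h = Equivalence.from (r μ) (un≃ h)

    represents⁻ : ∀ μ → X ⟨$⟩ μ ≡ true → μ $ x ≃ 1ℝ
    represents⁻ μ h = ⟨ Equivalence.to (r μ) h ⟩

  represents : ∀ {x X} → (∀ μ → X ⟨$⟩ μ ≡ true → μ $ x ≃ 1ℝ) → (∀ μ → μ $ x ≃ 1ℝ → X ⟨$⟩ μ ≡ true) → Represents x X
  represents {x} {X} to from μ = mk⇔ to′ from′
    where
    to′ : X ⟨$⟩ μ ≡ true → _at_ L μ x ≈ℝ 1ℝ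
    to′ h = un≃ (to μ h)
    from′ : _at_ L μ x ≈ℝ 1ℝ → X ⟨$⟩ μ ≡ true
    from′ h = from μ ⟨ h ⟩

  abstract
    -- Equality of reals cannot be decided, so the Boolean is read off the alternative that a
    -- two-valued state carries with it. It respects equality of states because 0 and 1 are
    -- different.
    event : Carrier → Ev
    event x = record
      { to   = λ μ → is-one (two-valued μ x)
      ; cong = λ {μ} {ν} μ≈ν → ≡true-ext
          (λ h → is-one⁺ (two-valued ν x) (≃-trans (≃-sym ⟨ μ≈ν x ⟩) (is-one⁻ (two-valued μ x) h)))
          (λ h → is-one⁺ (two-valued μ x) (≃-trans ⟨ μ≈ν x ⟩ (is-one⁻ (two-valued ν x) h)))
      }

    event-represents : ∀ x → Represents x (event x)
    event-represents x = represents {x} {event x} (λ μ → is-one⁻ (two-valued μ x)) (λ μ → is-one⁺ (two-valued μ x))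

  represents-unique : ∀ {x X Y} → Represents x X → Represents x Y → ∀ μ → X ⟨$⟩ μ ≡ Y ⟨$⟩ μ
  represents-unique {x} {X} {Y} r r' μ = ≡true-ext
    (λ h → represents⁺ {x} {Y} r' μ (represents⁻ {x} {X} r μ h))
    (λ h → represents⁺ {x} {X} r μ (represents⁻ {x} {Y} r' μ h))

  ∪-represents : ∀ {x y z X Y} → x ⊥ y → IsJoin poset x y z → Represents x X → Represents y Y → Represents z (_∪_ {S = Ω} X Y)
  ∪-represents {x} {y} {z} {X} {Y} x⊥y j r r' = represents {z} {_∪_ {S = Ω} X Y}
    (λ μ h → [ (λ k → join-oneˡ μ x⊥y j (represents⁻ {x} {X} r μ k)) , (λ k → join-oneʳ μ x⊥y j (represents⁻ {y} {Y} r' μ k)) ]′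
      (∨-true (X ⟨$⟩ μ) (Y ⟨$⟩ μ) h))
    (λ μ h → [ (λ k → cong (_∨ (Y ⟨$⟩ μ)) (represents⁺ {x} {X} r μ k)) ,
               (λ k → trans (cong ((X ⟨$⟩ μ) ∨_) (represents⁺ {y} {Y} r' μ k)) (Boolₚ.∨-zeroʳ (X ⟨$⟩ μ))) ]′
      (join-one⁻ μ x⊥y j h))

  event∈ : ∀ x → TotalRepresentation L (event x)
  event∈ x = x , event-represents x

  module Charge (m : SignedMeasure Ω (TotalRepresentation L)) where

    charge : Carrier → ℝ
    charge x = SignedMeasure.measure m (event x) (event∈ x)

    -- A member of the total representation carries a representing element, but equality there
    -- compares only the sets; hence the measure can be computed on `event x` instead.
    measure-charge : ∀ {x X} (r : Represents x X) → SignedMeasure.measure m X (x , r) ≃ charge x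
    measure-charge {x} {X} r = ⟨ Func.cong (SignedMeasure.fun m) {X , x , r} {event x , event∈ x}
      (represents-unique {x} {X} {event x} r (event-represents x)) ⟩

    module _ {x y z} (x⊥y : x ⊥ y) (j : IsJoin poset x y z) where
      private
        X∪Y : Ev
        X∪Y = _∪_ {S = Ω} (event x) (event y)

        r : Represents z X∪Y
        r = ∪-represents {x} {y} {z} {event x} {event y} x⊥y j (event-represents x) (event-represents y)

        disjoint : Disjoint {S = Ω} (event x) (event y)
        disjoint {μ} h k = exclusive μ x⊥y j
          (represents⁻ {x} {event x} (event-represents x) μ h) (represents⁻ {y} {event y} (event-represents y) μ k)

        measure-∪ : SignedMeasure.measure m X∪Y (z , r) ≃ charge x +ℝ charge y
        measure-∪ = ⟨ SignedMeasure.additive m {event x} {event y} (event∈ x) (event∈ y) (z , r) (λ {μ} → disjoint {μ}) ⟩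

      charge-additive : charge z ≃ charge x ⊕ charge y
      charge-additive = ≃-trans (≃-sym (measure-charge {z} {X∪Y} r))
        (≃-trans measure-∪ (≃-sym (⊕≃+ℝ (charge x) (charge y))))

  module _ (isFull : IsFull L U) where

    -- Fullness lets the two-valued states test the inequality of `x` and the complement of `y`: a
    -- state that is 1 at `x` is 0 at `y` by disjointness, hence 1 at the complement.
    disjoint⇒⊥ : ∀ {x y X Y} → Represents x X → Represents y Y → Disjoint {S = Ω} X Y → x ⊥ y
    disjoint⇒⊥ {x} {y} {X} {Y} r r' disj = Equivalence.from isFull λ μ _ → un≲ (below μ)
      where
      y-zero : ∀ μ → μ $ x ≃ 1ℝ → μ $ y ≃ 0ℝ
      y-zero μ x≃1 = not-one μ y λ y≃1 →
        disj {μ} (represents⁺ {x} {X} r μ x≃1) (represents⁺ {y} {Y} r' μ y≃1)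
      cases : ∀ μ → μ $ x ≃ 0ℝ ⊎ μ $ x ≃ 1ℝ → μ $ (y ᗮ) ≃ 0ℝ ⊎ μ $ (y ᗮ) ≃ 1ℝ → μ $ x ≲ μ $ (y ᗮ)
      cases μ (inj₁ x≃0) (inj₁ y'≃0) = ≃⇒≲ (≃-trans x≃0 (≃-sym y'≃0))
      cases μ (inj₁ x≃0) (inj₂ y'≃1) = ≲-resp (≃-sym x≃0) (≃-sym y'≃1) 0≲1
      cases μ (inj₂ x≃1) _           = ≃⇒≲ (≃-trans x≃1 (≃-sym (opposite-0 μ y (y-zero μ x≃1))))
      below : ∀ μ → μ $ x ≲ μ $ (y ᗮ)
      below μ = cases μ (two-valued μ x) (two-valued μ (y ᗮ))

    concrete : IsConcreteLogic Ω (TotalRepresentation L)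
    concrete = record
      { resp     = λ {X} {Y} X≈Y (x , r) → x , represents {x} {Y}
          (λ μ h → represents⁻ {x} {X} r μ (trans (X≈Y μ) h))
          (λ μ h → trans (sym (X≈Y μ)) (represents⁺ {x} {X} r μ h))
      ; full∈    = 1# , represents {1#} {full {S = Ω}}
          (λ μ _ → ⟨ proj₁ (proj₂ (proj₂ (proj₁ μ))) ⟩) (λ _ _ → refl)
      ; ∁-closed = λ {X} (x , r) → x ᗮ , represents {x ᗮ} {∁ {S = Ω} X}
          (λ μ h → opposite-0 μ x (not-one μ x λ k → contradiction (trans (sym h) (cong not (represents⁺ {x} {X} r μ k))) λ ()))
          (λ μ h → ∁-true (X ⟨$⟩ μ) (λ k → opposite-1 μ x (represents⁻ {x} {X} r μ k) h))
      ; ∪-closed = λ {X} {Y} (x , r) (y , r') disj →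
          let x⊥y   = disjoint⇒⊥ {x} {y} {X} {Y} r r' (λ {μ} → disj {μ})
              z , j = ⊥-join x⊥y
          in z , ∪-represents {x} {y} {z} {X} {Y} x⊥y j r r'
      }
      where
      ∁-true : ∀ b → ¬ b ≡ true → not b ≡ true
      ∁-true true  h = contradiction refl h
      ∁-true false h = refl

-- Seventeen atoms

module Seventeen where

  -- The triangle-free configuration of 17 points and 17 lines.
  neighbours₁₇ : Vec (Vec (Fin 17 × Fin 17) 3) 17
  neighbours₁₇ =
      ((# 1 , # 2) ∷ (# 3 , # 4) ∷ (# 5 , # 6) ∷ [])
    ∷ ((# 0 , # 2) ∷ (# 7 , # 8) ∷ (# 9 , # 10) ∷ [])
    ∷ ((# 0 , # 1) ∷ (# 11 , # 12) ∷ (# 13 , # 14) ∷ [])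
    ∷ ((# 0 , # 4) ∷ (# 7 , # 11) ∷ (# 9 , # 13) ∷ [])
    ∷ ((# 0 , # 3) ∷ (# 8 , # 14) ∷ (# 10 , # 15) ∷ [])
    ∷ ((# 0 , # 6) ∷ (# 8 , # 12) ∷ (# 13 , # 15) ∷ [])
    ∷ ((# 0 , # 5) ∷ (# 10 , # 11) ∷ (# 14 , # 16) ∷ [])
    ∷ ((# 1 , # 8) ∷ (# 3 , # 11) ∷ (# 15 , # 16) ∷ [])
    ∷ ((# 1 , # 7) ∷ (# 4 , # 14) ∷ (# 5 , # 12) ∷ [])
    ∷ ((# 1 , # 10) ∷ (# 3 , # 13) ∷ (# 12 , # 16) ∷ [])
    ∷ ((# 1 , # 9) ∷ (# 4 , # 15) ∷ (# 6 , # 11) ∷ [])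
    ∷ ((# 2 , # 12) ∷ (# 3 , # 7) ∷ (# 6 , # 10) ∷ [])
    ∷ ((# 2 , # 11) ∷ (# 5 , # 8) ∷ (# 9 , # 16) ∷ [])
    ∷ ((# 2 , # 14) ∷ (# 3 , # 9) ∷ (# 5 , # 15) ∷ [])
    ∷ ((# 2 , # 13) ∷ (# 4 , # 8) ∷ (# 6 , # 16) ∷ [])
    ∷ ((# 4 , # 10) ∷ (# 5 , # 13) ∷ (# 7 , # 16) ∷ [])
    ∷ ((# 6 , # 14) ∷ (# 7 , # 15) ∷ (# 9 , # 12) ∷ [])
    ∷ []

  nb₁₇ : Fin 17 → Fin 3 → Bool → Fin 17
  nb₁₇ i k b = let j , l = lookup (lookup neighbours₁₇ i) k in if b then l else j

  configuration₁₇ : Configuration 17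
  configuration₁₇ = makeConfiguration nb₁₇ 0F _

  open Configuration configuration₁₇
  open Logic configuration₁₇
  open States configuration₁₇

  L₁₇ : OrthomodularPoset _ _ _
  L₁₇ = logic

  ⅓ ⅔ : ℝ
  ⅓ = fromℚ (+ 1 / 3)
  ⅔ = fromℚ (+ 2 / 3)

  -- In every state the atoms of type 0F, 1F and 2F take the values 1/3, t and 2/3 − t.
  type : Fin 17 → Fin 3
  type = lookup (2F ∷ 0F ∷ 1F ∷ 0F ∷ 1F ∷ 1F ∷ 0F ∷ 0F ∷ 0F ∷ 0F ∷ 0F ∷ 0F ∷ 2F ∷ 0F ∷ 2F ∷ 2F ∷ 1F ∷ [])

  Line : Set
  Line = Fin 17 × Fin 3

  -- Variable 0F is the constant 1, variable suc i the value at the atom i.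
  lineSum one : Line → Form 18
  lineSum (i , k) = (1 , suc i) ∷ (1 , suc (nb₁₇ i k false)) ∷ (1 , suc (nb₁₇ i k true)) ∷ []
  one _           = (1 , 0F) ∷ []

  -- The values 1/3, t and 2/3 - t with denominators cleared. The parameter t is the value at the
  -- atom 16.
  claimˡ claimʳ : Fin 17 → Fin 3 → Form 18
  claimˡ i 0F = (3 , suc i) ∷ []
  claimˡ i 1F = (1 , suc i) ∷ []
  claimˡ i 2F = (3 , suc i) ∷ (3 , suc (# 16)) ∷ []
  claimʳ i 0F = (1 , 0F) ∷ []
  claimʳ i 1F = (1 , suc (# 16)) ∷ []
  claimʳ i 2F = (2 , 0F) ∷ []

  -- Coefficients of the line relations, found by Gaussian elimination.
  multipliers : Vec (List (ℕ × Line) × List (ℕ × Line)) 17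
  multipliers =
      ((2 , # 0 , 0F) ∷ (3 , # 0 , 1F) ∷ (1 , # 2 , 2F) ∷ (1 , # 4 , 1F) ∷ (1 , # 5 , 1F)
            ∷ (1 , # 5 , 2F) ∷ (4 , # 6 , 1F) ∷ (3 , # 7 , 2F) ∷ (2 , # 9 , 2F) ∷ []
      , (2 , # 0 , 2F) ∷ (2 , # 1 , 1F) ∷ (3 , # 2 , 1F) ∷ (1 , # 3 , 1F) ∷ (2 , # 3 , 2F)
            ∷ (4 , # 4 , 2F) ∷ (2 , # 6 , 2F) ∷ [])
    ∷ ((1 , # 0 , 1F) ∷ (2 , # 1 , 1F) ∷ (1 , # 1 , 2F) ∷ (1 , # 2 , 1F) ∷ (2 , # 5 , 2F)
          ∷ (2 , # 6 , 2F) ∷ []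
      , (1 , # 0 , 2F) ∷ (1 , # 2 , 2F) ∷ (1 , # 3 , 2F) ∷ (1 , # 4 , 1F) ∷ (1 , # 5 , 1F)
            ∷ (1 , # 6 , 1F) ∷ (2 , # 7 , 2F) ∷ [])
    ∷ ((1 , # 0 , 2F) ∷ (1 , # 2 , 1F) ∷ (1 , # 3 , 2F) ∷ (1 , # 4 , 2F) ∷ []
      , (1 , # 0 , 1F) ∷ (1 , # 5 , 2F) ∷ (1 , # 6 , 1F) ∷ (1 , # 9 , 2F) ∷ [])
    ∷ ((1 , # 0 , 0F) ∷ (1 , # 3 , 1F) ∷ (2 , # 3 , 2F) ∷ (1 , # 4 , 2F) ∷ (2 , # 5 , 1F)
          ∷ (2 , # 6 , 2F) ∷ []
      , (1 , # 0 , 2F) ∷ (1 , # 1 , 1F) ∷ (1 , # 2 , 2F) ∷ (1 , # 4 , 1F) ∷ (1 , # 5 , 2F)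
            ∷ (1 , # 6 , 1F) ∷ (2 , # 9 , 2F) ∷ [])
    ∷ ((1 , # 0 , 2F) ∷ (1 , # 1 , 1F) ∷ (1 , # 2 , 1F) ∷ (1 , # 4 , 2F) ∷ []
      , (1 , # 0 , 0F) ∷ (1 , # 5 , 1F) ∷ (1 , # 6 , 1F) ∷ (1 , # 7 , 2F) ∷ [])
    ∷ ((1 , # 0 , 2F) ∷ (1 , # 1 , 2F) ∷ (1 , # 2 , 1F) ∷ []
      , (1 , # 0 , 0F) ∷ (1 , # 6 , 1F) ∷ (1 , # 9 , 2F) ∷ [])
    ∷ ((2 , # 0 , 2F) ∷ (2 , # 1 , 1F) ∷ (3 , # 2 , 1F) ∷ (2 , # 3 , 2F) ∷ (1 , # 4 , 2F)
          ∷ (2 , # 6 , 2F) ∷ []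
      , (2 , # 0 , 0F) ∷ (1 , # 2 , 2F) ∷ (2 , # 3 , 1F) ∷ (1 , # 4 , 1F) ∷ (1 , # 5 , 1F)
            ∷ (1 , # 5 , 2F) ∷ (1 , # 6 , 1F) ∷ (2 , # 9 , 2F) ∷ [])
    ∷ ((2 , # 0 , 2F) ∷ (2 , # 1 , 1F) ∷ (2 , # 2 , 2F) ∷ (1 , # 3 , 1F) ∷ (1 , # 4 , 2F)
          ∷ (1 , # 9 , 2F) ∷ []
      , (2 , # 0 , 0F) ∷ (1 , # 3 , 2F) ∷ (1 , # 4 , 1F) ∷ (1 , # 5 , 1F) ∷ (1 , # 5 , 2F)
            ∷ (1 , # 6 , 1F) ∷ (1 , # 6 , 2F) ∷ [])
    ∷ ((1 , # 0 , 0F) ∷ (2 , # 3 , 2F) ∷ (2 , # 4 , 1F) ∷ (2 , # 5 , 1F) ∷ (2 , # 6 , 1F)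
          ∷ (3 , # 7 , 2F) ∷ []
      , (1 , # 0 , 2F) ∷ (1 , # 1 , 1F) ∷ (1 , # 2 , 2F) ∷ (2 , # 3 , 1F) ∷ (2 , # 4 , 2F)
            ∷ (1 , # 5 , 2F) ∷ (1 , # 6 , 2F) ∷ (2 , # 9 , 2F) ∷ [])
    ∷ ((2 , # 0 , 2F) ∷ (1 , # 1 , 2F) ∷ (1 , # 2 , 1F) ∷ (2 , # 3 , 2F) ∷ (2 , # 4 , 1F)
          ∷ (1 , # 7 , 2F) ∷ []
      , (2 , # 0 , 1F) ∷ (1 , # 1 , 1F) ∷ (1 , # 2 , 2F) ∷ (1 , # 5 , 1F) ∷ (1 , # 5 , 2F)
            ∷ (1 , # 6 , 1F) ∷ (1 , # 6 , 2F) ∷ [])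
    ∷ ((1 , # 0 , 1F) ∷ (1 , # 1 , 2F) ∷ (2 , # 2 , 2F) ∷ (2 , # 5 , 1F) ∷ (2 , # 6 , 1F)
          ∷ (1 , # 7 , 2F) ∷ []
      , (1 , # 0 , 2F) ∷ (1 , # 1 , 1F) ∷ (2 , # 2 , 1F) ∷ (1 , # 3 , 2F) ∷ (1 , # 4 , 1F)
            ∷ (1 , # 5 , 2F) ∷ (1 , # 6 , 2F) ∷ [])
    ∷ ((1 , # 0 , 0F) ∷ (1 , # 3 , 1F) ∷ (2 , # 4 , 1F) ∷ (2 , # 5 , 2F) ∷ (2 , # 6 , 1F)
          ∷ (1 , # 9 , 2F) ∷ []
      , (1 , # 0 , 2F) ∷ (1 , # 1 , 1F) ∷ (1 , # 2 , 2F) ∷ (1 , # 3 , 2F) ∷ (2 , # 4 , 2F)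
            ∷ (1 , # 5 , 1F) ∷ (1 , # 6 , 2F) ∷ [])
    ∷ ((3 , # 0 , 1F) ∷ (1 , # 1 , 1F) ∷ (1 , # 2 , 2F) ∷ (1 , # 5 , 1F) ∷ (1 , # 5 , 2F)
          ∷ (1 , # 6 , 1F) ∷ (1 , # 6 , 2F) ∷ (2 , # 9 , 2F) ∷ []
      , (1 , # 0 , 0F) ∷ (2 , # 0 , 2F) ∷ (1 , # 3 , 1F) ∷ (2 , # 3 , 2F) ∷ (2 , # 4 , 1F)
            ∷ (1 , # 4 , 2F) ∷ [])
    ∷ ((3 , # 0 , 1F) ∷ (2 , # 1 , 1F) ∷ (2 , # 2 , 2F) ∷ (2 , # 5 , 2F) ∷ (2 , # 6 , 1F)
          ∷ (1 , # 9 , 2F) ∷ []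
      , (2 , # 0 , 0F) ∷ (1 , # 0 , 2F) ∷ (2 , # 3 , 1F) ∷ (1 , # 3 , 2F) ∷ (1 , # 4 , 1F)
            ∷ (2 , # 4 , 2F) ∷ (1 , # 5 , 1F) ∷ (1 , # 6 , 2F) ∷ [])
    ∷ ((2 , # 0 , 1F) ∷ (2 , # 1 , 2F) ∷ (1 , # 2 , 2F) ∷ (1 , # 4 , 1F) ∷ (1 , # 5 , 1F)
          ∷ (1 , # 5 , 2F) ∷ (1 , # 6 , 1F) ∷ (1 , # 6 , 2F) ∷ (2 , # 7 , 2F) ∷ []
      , (2 , # 0 , 2F) ∷ (2 , # 1 , 1F) ∷ (1 , # 2 , 1F) ∷ (2 , # 3 , 2F) ∷ (3 , # 4 , 2F) ∷ [])
    ∷ ((2 , # 0 , 0F) ∷ (1 , # 3 , 2F) ∷ (1 , # 4 , 1F) ∷ (1 , # 5 , 1F) ∷ (1 , # 5 , 2F)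
          ∷ (1 , # 6 , 1F) ∷ (1 , # 6 , 2F) ∷ (3 , # 7 , 2F) ∷ []
      , (2 , # 0 , 2F) ∷ (2 , # 1 , 1F) ∷ (2 , # 2 , 2F) ∷ (1 , # 3 , 1F) ∷ (1 , # 4 , 2F)
            ∷ (1 , # 9 , 2F) ∷ [])
    ∷ ([]
      , [])
    ∷ []

  abstract
    -- A certificate weighs its relations by the second list minus the first, while `multipliers`
    -- stores the positive part first; hence the exchanged projections.
    claims : ∀ i → Certificate lineSum one 0 (claimˡ i (type i)) (claimʳ i (type i))
                     (proj₂ (lookup multipliers i)) (proj₁ (lookup multipliers i))
    claims = from-yes (Finₚ.all? λ i → certificate? lineSum one 0 (claimˡ i (type i)) (claimʳ i (type i))
                     (proj₂ (lookup multipliers i)) (proj₁ (lookup multipliers i)))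

  3·⅓ : 3 · ⅓ ≃ 1ℝ
  3·⅓ = ≃-trans (∙-congˡ (≃-trans (∙-congˡ (identityʳ _)) (fromℚ-⊕ _ _))) (fromℚ-⊕ _ _)

  3·⅔ : 3 · ⅔ ≃ 2 · 1ℝ
  3·⅔ = ≃-trans (≃-trans (∙-congˡ (≃-trans (∙-congˡ (identityʳ _)) (fromℚ-⊕ _ _))) (fromℚ-⊕ _ _))
    (≃-sym (≃-trans (∙-congˡ (identityʳ _)) (fromℚ-⊕ _ _)))

  typical : ℝ → Fin 3 → ℝ
  typical t 0F = ⅓
  typical t 1F = t
  typical t 2F = ⅔ ⊝ t

  module _ (s : Setoid.Carrier (𝐒 L₁₇)) where
    private
      f : Fin 17 → ℝ
      f = restrict s

      x : Fin 18 → ℝ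
      x zero    = 1ℝ
      x (suc i) = f i

      holds : ∀ l → value x (lineSum l) ≃ value x (one l)
      holds (i , k) = ≃-trans (value-line x (suc i) (suc (nb₁₇ i k false)) (suc (nb₁₇ i k true)))
        (≃-trans (state-line s i k) (≃-sym (≃-trans (identityʳ _) (identityʳ _))))

      claim : ∀ i → value x (claimˡ i (type i)) ≃ value x (claimʳ i (type i))
      claim i = certify lineSum one x holds 0 (claimˡ i (type i)) (claimʳ i (type i))
        (proj₂ (lookup multipliers i)) (proj₁ (lookup multipliers i)) (claims i)

      typically : ∀ i k → value x (claimˡ i k) ≃ value x (claimʳ i k) → f i ≃ typical (f (# 16)) k
      typically i 0F h = ·-cancelˡ 2 (≃-trans (≃-sym (identityʳ _)) (≃-trans h
        (≃-trans (identityʳ _) (≃-trans (identityʳ _) (≃-sym 3·⅓)))))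
      typically i 1F h = ≃-trans (≃-sym (≃-trans (identityʳ _) (identityʳ _))) (≃-trans h (≃-trans (identityʳ _) (identityʳ _)))
      typically i 2F h = ≃-difference (·-cancelˡ 2 (≃-trans (·-distrib-⊕ 3 _ _) (≃-trans (comm _ _)
        (≃-trans (∙-congˡ (≃-sym (identityʳ _))) (≃-trans h (≃-trans (identityʳ _) (≃-sym 3·⅔)))))))

    restrict-typical : ∀ i → restrict s i ≃ typical (restrict s (# 16)) (type i)
    restrict-typical i = typically i (type i) (claim i)

  no-two-valued : ¬ Setoid.Carrier (𝐒₂ L₁₇)
  no-two-valued (s , two-valued) with two-valued (pos 1F)
  ... | inj₁ h = from-yes (¬? ((+ 1 / 3) ℚₚ.≤? ℚ.0ℚ)) (fromℚ-cancel (≃⇒≲ (≃-trans (≃-sym (restrict-typical s 1F)) ⟨ h ⟩)))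
  ... | inj₂ h = from-yes (¬? (ℚ.1ℚ ℚₚ.≤? (+ 1 / 3))) (fromℚ-cancel (≃⇒≲ (≃-trans (≃-sym ⟨ h ⟩) (restrict-typical s 1F))))

  typical-cong : ∀ {t u} → t ≃ u → ∀ k → typical t k ≃ typical u k
  typical-cong h 0F = ≃-refl
  typical-cong h 1F = h
  typical-cong h 2F = ∙-congˡ (⊖-cong h)

  -- Forms serve here as multisets: the coefficients count how often each type occurs on the line,
  -- and `value (typical t)` sums the corresponding values.
  types : Fin 17 → Fin 3 → Form 3
  types i k = (1 , type i) ∷ (1 , type (nb₁₇ i k false)) ∷ (1 , type (nb₁₇ i k true)) ∷ []

  abstract
    line-types : ∀ i k → coefficients (types i k) ≡ 3 ∷ 0 ∷ 0 ∷ [] ⊎ coefficients (types i k) ≡ 1 ∷ 1 ∷ 1 ∷ []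
    line-types = from-yes (Finₚ.all? λ i → Finₚ.all? λ k →
      Vecₚ.≡-dec ℕₚ._≟_ (coefficients (types i k)) (3 ∷ 0 ∷ 0 ∷ []) ⊎-dec
      Vecₚ.≡-dec ℕₚ._≟_ (coefficients (types i k)) (1 ∷ 1 ∷ 1 ∷ []))

  typical-weight : ∀ {t} → 0ℝ ≲ t → t ≲ ⅔ → IsWeight (typical t ∘ type)
  typical-weight {t} 0≲t t≲⅔ = (λ i → nonneg (type i)) , λ i k →
    ≃-trans (≃-sym (value-line (typical t) (type i) (type (nb₁₇ i k false)) (type (nb₁₇ i k true)))) (sum i k)
    where
    nonneg : ∀ k → 0ℝ ≲ typical t k
    nonneg 0F = fromℚ-mono (from-yes (ℚ.0ℚ ℚₚ.≤? (+ 1 / 3)))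
    nonneg 1F = 0≲t
    nonneg 2F = 0≲-difference t≲⅔
    ⅓+⅔ : ⅓ ⊕ (t ⊕ (⅔ ⊝ t)) ≃ 1ℝ
    ⅓+⅔ = ≃-trans (∙-congˡ (+-[-] t ⅔)) (fromℚ-⊕ _ _)
    sum : ∀ i k → value (typical t) (types i k) ≃ 1ℝ
    sum i k with line-types i k
    ... | inj₁ e = ≃-trans (value-determined (typical t) (types i k) ((3 , 0F) ∷ []) e) (≃-trans (identityʳ _) 3·⅓)
    ... | inj₂ e = ≃-trans (value-determined (typical t) (types i k) ((1 , 0F) ∷ (1 , 1F) ∷ (1 , 2F) ∷ []) e)
      (≃-trans (value-line (typical t) 0F 1F 2F) ⅓+⅔)

  state-space : StateSpace≅Segment L₁₇ 0ℝ ⅔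
  state-space = record
    { bijection = record
      { to        = λ s → restrict s (# 16) , un≲ (state-≥0 s (pos (# 16))) , un≲ (upper s)
      ; from      = λ (t , 0≤t , t≤⅔) → state (typical-weight {t} ⟨ 0≤t ⟩ ⟨ t≤⅔ ⟩)
      ; to-cong   = λ e → e (pos (# 16))
      ; from-cong = λ {t} {u} e x → un≃ (extend-cong (λ i → typical-cong ⟨ e ⟩ (type i)) x)
      ; inverse   = (λ e → e (pos (# 16))) ,
                    λ {s} {t} e x → un≃ (≃-trans (extend-cong (λ i → ≃-trans (typical-cong ⟨ e ⟩ (type i)) (≃-sym (restrict-typical s i))) x)
                                                (≃-sym (state-extend s x)))
      }
    ; affine = λ _ _ _ h → h (pos (# 16))
    }
    where
    upper : ∀ s → restrict s (# 16) ≲ ⅔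
    -- The atom 0 has type `2F`, so t is 2/3 minus a nonnegative value.
    upper s = ≲-resp
      (≃-sym (≃-difference (≃-trans (∙-congʳ (restrict-typical s 0F)) (≃-trans (comm _ _) (+-[-] _ _)))))
      ≃-refl (difference-≲ (state-≥0 s (pos 0F)))

-- Twenty-seven atoms

module TwentySeven where

  shift : Fin 3 → Bool → Fin 3
  shift 0F false = 1F
  shift 1F false = 2F
  shift 2F false = 0F
  shift 0F true  = 2F
  shift 1F true  = 0F
  shift 2F true  = 1F

  point : Fin 3 → Fin 3 → Fin 3 → Fin 27
  point i j k = combine {3} {9} i (combine {3} {3} j k)

  coordinates : Fin 27 → Fin 3 × Fin 3 × Fin 3
  coordinates p = map₂ (remQuot {3} 3) (remQuot {3} 9 p)

  -- The points and lines of the 3 × 3 × 3 grid.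
  nb₂₇ : Fin 27 → Fin 3 → Bool → Fin 27
  nb₂₇ p a b with coordinates p
  nb₂₇ p 0F b | i , j , k = point (shift i b) j k
  nb₂₇ p 1F b | i , j , k = point i (shift j b) k
  nb₂₇ p 2F b | i , j , k = point i j (shift k b)

  configuration₂₇ : Configuration 27
  configuration₂₇ = makeConfiguration nb₂₇ 0F _

  open Configuration configuration₂₇
  open Logic configuration₂₇
  open States configuration₂₇

  L₂₇ : OrthomodularPoset _ _ _
  L₂₇ = logic

  infixl 6 _+₃_
  _+₃_ : Fin 3 → Fin 3 → Fin 3
  0F +₃ j = j
  1F +₃ j = shift j false
  2F +₃ j = shift j true

  negate : Fin 3 → Fin 3
  negate 0F = 0F
  negate 1F = 2F
  negate 2F = 1F

  -- The twelve planes i ± j ± k = d over the field of three elements, that is,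
  -- the twelve Latin squares of order three.
  on-plane : Fin 12 → Fin 27 → Bool
  on-plane P p with remQuot {4} 3 P | coordinates p
  ... | 0F , d | i , j , k = does (i +₃ j +₃ k Finₚ.≟ d)
  ... | 1F , d | i , j , k = does (i +₃ j +₃ negate k Finₚ.≟ d)
  ... | 2F , d | i , j , k = does (i +₃ negate j +₃ k Finₚ.≟ d)
  ... | 3F , d | i , j , k = does (i +₃ negate j +₃ negate k Finₚ.≟ d)

  abstract
    plane-transversal : ∀ P i k →
      bit (on-plane P i) + (bit (on-plane P (nb₂₇ i k false)) + bit (on-plane P (nb₂₇ i k true))) ≡ 1
    plane-transversal = from-yes (Finₚ.all? λ P → Finₚ.all? λ i → Finₚ.all? λ k →
      bit (on-plane P i) + (bit (on-plane P (nb₂₇ i k false)) + bit (on-plane P (nb₂₇ i k true))) ℕₚ.≟ 1)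

  module Plane (P : Fin 12) = Transversal (on-plane P) (plane-transversal P)

  literal : Bool → Fin 27 → El (Fin 27)
  literal true  = pos
  literal false = neg

  abstract
    -- `literal b i` has value 1 at the plane `P` exactly when `on-plane P i` is `b`, so this is
    -- what separation of two literals means; all cases are searched.
    separate : ∀ i j b c → ¬ literal b i ≤ literal c j → ∃[ P ] (on-plane P i ≡ b × on-plane P j ≡ not c)
    separate = from-yes (Finₚ.all? λ i → Finₚ.all? λ j → ∀Bool? λ b → ∀Bool? λ c →
      ¬? (literal b i ≤? literal c j) →-dec Finₚ.any? λ P → (on-plane P i Boolₚ.≟ b) ×-dec (on-plane P j Boolₚ.≟ not c))

    some-plane : ∀ i b → ∃[ P ] on-plane P i ≡ b
    some-plane = from-yes (Finₚ.all? λ i → ∀Bool? λ b → Finₚ.any? λ P → on-plane P i Boolₚ.≟ b)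

  separating-plane : ∀ x y → ¬ x ≤ y → ∃[ P ] (Plane.holds P x ≡ true × Plane.holds P y ≡ false)
  separating-plane 𝟎       y       h = contradiction 𝟎≤ h
  separating-plane x       𝟏       h = contradiction ≤𝟏 h
  separating-plane 𝟏       𝟎       h = 0F , refl , refl
  separating-plane 𝟏       (pos j) h = let P , e = some-plane j false in P , refl , e
  separating-plane 𝟏       (neg j) h = let P , e = some-plane j true in P , refl , cong not e
  separating-plane (pos i) 𝟎       h = let P , e = some-plane i true in P , e , refl
  separating-plane (neg i) 𝟎       h = let P , e = some-plane i false in P , cong not e , refl
  separating-plane (pos i) (pos j) h = let P , e , e' = separate i j true true h in P , e , e'
  separating-plane (pos i) (neg j) h = let P , e , e' = separate i j true false h in P , e , cong not e'
  separating-plane (neg i) (pos j) h = let P , e , e' = separate i j false true h in P , cong not e , e'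
  separating-plane (neg i) (neg j) h = let P , e , e' = separate i j false false h in P , cong not e , cong not e'

  full₂₇ : IsFull L₂₇ U
  full₂₇ {x} {y} = mk⇔ to from
    where
    Below : Set
    Below = ∀ μ → U μ → _at_ L₂₇ μ x ≤ℝ _at_ L₂₇ μ y
    to : x ≤ y → Below
    to x≤y μ _ = un≲ (state-mono (proj₁ μ) x≤y)
    decide : Below → Dec (x ≤ y) → x ≤ y
    decide h (yes x≤y) = x≤y
    decide h (no x≰y)  =
      let P , x-true , y-false = separating-plane x y x≰y
      in contradiction (≲-resp (Plane.two-valued-state-one P {x} x-true) (Plane.two-valued-state-zero P {y} y-false)
           ⟨ h (Plane.two-valued-state P) _ ⟩) 1≴0
    from : Below → x ≤ y
    from h = decide h (x ≤? y)

  open TotalRep L₂₇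

  private
    Event : Set _
    Event = Setoid.Carrier (𝒫 Ω)

    E : Event → Set _
    E = TotalRepresentation L₂₇

  τ : Fin 12 → Setoid.Carrier Ω
  τ P = Plane.two-valued-state P

  event-τ : ∀ P i → event (pos i) ⟨$⟩ τ P ≡ on-plane P i
  event-τ P i = ≡true-ext
    (λ h → not-false (on-plane P i) λ e → 1≄0 (≃-trans
      (≃-sym (represents⁻ {pos i} {event (pos i)} (event-represents (pos i)) (τ P) h))
      (Plane.two-valued-state-zero P {pos i} e)))
    (λ e → represents⁺ {pos i} {event (pos i)} (event-represents (pos i)) (τ P) (Plane.two-valued-state-one P {pos i} e))
    where
    not-false : ∀ b → ¬ b ≡ false → b ≡ true
    not-false true  _ = refl
    not-false false h = contradiction refl h


  -- Signed measures on the grid as combinations of point masses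

  module PointMasses {N} (w : Fin N → ℝ) (at-plane : Fin 12 → Fin N) where

    charged : (Fin 12 → Bool) → List (Fin 12) → Form N
    charged g = map λ P → bit (g P) , at-plane P

    -- A point mass needs only the Boolean value of the set at one state, so the sum is defined for
    -- every set and not just for those that represent an element.
    mass : Event → ℝ
    mass X = value w (charged (λ P → X ⟨$⟩ τ P) (allFin 12))

    charged-cong : ∀ {g h : Fin 12 → Bool} → (∀ P → g P ≡ h P) → ∀ Ps → charged g Ps ≡ charged h Ps
    charged-cong e []       = refl
    charged-cong e (P ∷ Ps) rewrite e P | charged-cong e Ps = refl

    charged-∨ : ∀ {g h : Fin 12 → Bool} → (∀ P → g P ≡ true → ¬ h P ≡ true) → ∀ Ps →
                value w (charged (λ P → g P ∨ h P) Ps) ≃ value w (charged g Ps) ⊕ value w (charged h Ps)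
    charged-∨ disj []       = ≃-sym (identityˡ _)
    charged-∨ {g} {h} disj (P ∷ Ps) = ≃-trans
      (∙-cong (≃-trans (≡→≃ (cong (_· w (at-plane P)) (bit-∨ (g P) (h P) (disj P)))) (×-homo-+ (w (at-plane P)) (bit (g P)) (bit (h P))))
              (charged-∨ {g} {h} disj Ps))
      (interchange _ _ _ _)
      where
      bit-∨ : ∀ a b → (a ≡ true → ¬ b ≡ true) → bit (a ∨ b) ≡ bit a + bit b
      bit-∨ false b     h = refl
      bit-∨ true  false h = refl
      bit-∨ true  true  h = contradiction refl (h refl)

    measure-U : SignedMeasure Ω U
    measure-U = record
      { fun = record
        { to = λ (X , _) → mass X
        ; cong = λ {(X , _)} {(Y , _)} X≈Y → un≃ (≡→≃ (cong (value w) (charged-cong (λ P → X≈Y (τ P)) (allFin 12))))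
        }
      ; additive = λ {X} {Y} _ _ _ disj → un≃ (≃-trans
          (charged-∨ {λ P → X ⟨$⟩ τ P} {λ P → Y ⟨$⟩ τ P} (λ P → disj {τ P}) (allFin 12)) (⊕≃+ℝ _ _))
      }

  charge-isCharge : ∀ m → IsCharge (Charge.charge m)
  charge-isCharge m {x} {y} {z} j = Charge.charge-additive m {x} {y} {z} (Join⇒⊥ j) (isJoin j)

  digit : Fin 27 → Fin 3 → Fin 3
  digit p 0F = proj₁ (coordinates p)
  digit p 1F = proj₁ (proj₂ (coordinates p))
  digit p 2F = proj₂ (proj₂ (coordinates p))

  private
    differ : Fin 27 → Fin 27 → Fin 3 → ℕ
    differ p q a = if does (digit p a Finₚ.≟ digit q a) then 0 else 1

  -- Number of coordinates in which a point differs from the line through p with direction a.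
  distance : Fin 27 → Fin 27 → Fin 3 → ℕ
  distance i p 0F = differ i p 1F + differ i p 2F
  distance i p 1F = differ i p 0F + differ i p 2F
  distance i p 2F = differ i p 0F + differ i p 1F

  -- Variables: the value of a charge at 𝟏, its values at the atoms, and the masses of the planes.
  top : Fin 40
  top = zero

  atomVar : Fin 27 → Fin 40
  atomVar i = suc (i ↑ˡ 12)

  planeVar : Fin 12 → Fin 40
  planeVar P = suc (27 ↑ʳ P)

  Relation : Set
  Relation = (Fin 27 × Fin 3) ⊎ Fin 12

  -- The mass w(P) = f(P)/9 − c/4 of a plane P, where f(P) sums the charge over P, is
  -- determined by 36 w(P) + 9 c = 4 f(P).
  lhs rhs : Relation → Form 40
  lhs (inj₁ (i , k)) = (1 , atomVar i) ∷ (1 , atomVar (nb₂₇ i k false)) ∷ (1 , atomVar (nb₂₇ i k true)) ∷ []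
  lhs (inj₂ P)       = (36 , planeVar P) ∷ (9 , top) ∷ []
  rhs (inj₁ _)       = (1 , top) ∷ []
  rhs (inj₂ P)       = map (λ i → 4 * bit (on-plane P i) , atomVar i) (allFin 27)

  planesThrough : Fin 27 → Form 40
  planesThrough i = map (λ P → bit (on-plane P i) , planeVar P) (allFin 12)

  -- Every line once: it is listed at its point with vanishing coordinate in its direction.
  lines : (Fin 27 → Fin 3 → ℕ) → List (ℕ × Relation)
  lines c = concatMap (λ p → concatMap (λ a →
    if does (digit p a Finₚ.≟ 0F) then (c p a , inj₁ (p , a)) ∷ [] else []) (allFin 3)) (allFin 27)

  weight : ℕ → ℕ → ℕ → ℕ → ℕ
  weight a b c 0 = a
  weight a b c 1 = b
  weight a b c _ = c

  -- The planes through a point i contain a point at distance 0, 1, 2, 3 from i with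
  -- multiplicity 4, 0, 2, 1, whence f(P) summed over these planes is 9 f(i) + 9 c.  The
  -- line relations enter with coefficients −5/3, 5/6, 1/3 according to the distance of
  -- the line from i, here scaled by 12.
  negative positive : Fin 27 → List (ℕ × Relation)
  negative i = lines λ p a → weight 20 0 0 (distance i p a)
  positive i = map (λ P → 3 * bit (on-plane P i) , inj₂ P) (allFin 12) ++ lines λ p a → weight 0 10 4 (distance i p a)

  abstract
    -- The factor 108 is 3 · 36: three times the relations of the four planes through `i` give 108
    -- times their masses plus 108 c minus 12 times the sums f(P). The line coefficients -20, 10, 4
    -- turn the latter into 108 f(i) + 108 c: a point at distance 0, 1, 2, 3 from `i` collects -60,
    -- 0, 24, 12 from its three lines, and all lines together collect 3 · (-20) + 12 · 10 + 12 · 4 =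
    -- 108.
    reconstruction : ∀ i → Certificate lhs rhs 107 (planesThrough i) ((1 , atomVar i) ∷ []) (negative i) (positive i)
    reconstruction = from-yes (Finₚ.all? λ i →
      certificate? lhs rhs 107 (planesThrough i) ((1 , atomVar i) ∷ []) (negative i) (positive i))

  module Reconstruction (f : Fin 27 → ℝ) (c : ℝ)
    (f-line : ∀ i k → f i ⊕ (f (nb₂₇ i k false) ⊕ f (nb₂₇ i k true)) ≃ c) where

    private
      planeForm : Fin 12 → Form 27
      planeForm P = map (λ i → 4 * bit (on-plane P i) , i) (allFin 27)

    planeMass : Fin 12 → ℝ
    planeMass P = (value f (planeForm P) ⊝ 9 · c) /suc 35

    private
      x : Fin 40 → ℝ
      x zero    = c
      x (suc q) = [ f , planeMass ]′ (splitAt 27 q)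

      x-atom : ∀ i → x (atomVar i) ≃ f i
      x-atom i = ≡→≃ (cong [ f , planeMass ]′ (Finₚ.splitAt-↑ˡ 27 i 12))

      x-plane : ∀ P → x (planeVar P) ≃ planeMass P
      x-plane P = ≡→≃ (cong [ f , planeMass ]′ (Finₚ.splitAt-↑ʳ 27 12 P))

      line-holds : ∀ i k → value x (lhs (inj₁ (i , k))) ≃ value x (rhs (inj₁ (i , k)))
      line-holds i k = ≃-trans (value-line x (atomVar i) (atomVar (nb₂₇ i k false)) (atomVar (nb₂₇ i k true)))
        (≃-trans (∙-cong (x-atom i) (∙-cong (x-atom (nb₂₇ i k false)) (x-atom (nb₂₇ i k true))))
        (≃-trans (f-line i k) (≃-sym (≃-trans (identityʳ _) (identityʳ _)))))

      planeForm-value : ∀ P → value x (rhs (inj₂ P)) ≃ value f (planeForm P)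
      planeForm-value P = ≃-trans (value-reindex x atomVar (λ i → 4 * bit (on-plane P i)) (λ i → i) (allFin 27))
        (value-cong x-atom (planeForm P))

      plane-holds : ∀ P → 36 · planeMass P ⊕ 9 · c ≃ value f (planeForm P)
      plane-holds P = ≃-trans (∙-congʳ (·-/suc 35 (value f (planeForm P) ⊝ 9 · c)))
        (≃-trans (comm _ _) (+-[-] (9 · c) (value f (planeForm P))))

      holds : ∀ r → value x (lhs r) ≃ value x (rhs r)
      holds (inj₁ (i , k)) = line-holds i k
      holds (inj₂ P)       = ≃-trans (∙-cong (·-cong 36 (x-plane P)) (identityʳ _))
        (≃-trans (plane-holds P) (≃-sym (planeForm-value P)))

      planesThrough-value : ∀ i → value x (planesThrough i) ≃ value planeMass (map (λ P → bit (on-plane P i) , P) (allFin 12))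
      planesThrough-value i = ≃-trans (value-reindex x planeVar (λ P → bit (on-plane P i)) (λ P → P) (allFin 12))
        (value-cong x-plane (map (λ P → bit (on-plane P i) , P) (allFin 12)))

      certified : ∀ i → value x (planesThrough i) ≃ value x ((1 , atomVar i) ∷ [])
      certified i = certify lhs rhs x holds 107 (planesThrough i) ((1 , atomVar i) ∷ []) (negative i) (positive i) (reconstruction i)

      atom-value : ∀ i → value x ((1 , atomVar i) ∷ []) ≃ f i
      atom-value i = ≃-trans (identityʳ _) (≃-trans (identityʳ _) (x-atom i))

    reconstruct : ∀ i → value planeMass (map (λ P → bit (on-plane P i) , P) (allFin 12)) ≃ f i
    reconstruct i = ≃-trans (≃-sym (planesThrough-value i)) (≃-trans (certified i) (atom-value i))

  module Extension (m : SignedMeasure Ω E) where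
    open Charge m
    open Reconstruction (λ i → charge (pos i)) (charge 𝟏) (charge-line (charge-isCharge m))
    open PointMasses planeMass (λ P → P)

    private
      -- Restricted to the logic, the sum of point masses is again a signed measure and has a
      -- charge. By `charge-determined`, comparing it with `m` at the atoms suffices, and there
      -- `reconstruct` applies.
      ν : SignedMeasure Ω E
      ν = record
        { fun = record
          { to   = λ (X , _) → mass X
          ; cong = λ {(X , _)} {(Y , _)} → Func.cong (SignedMeasure.fun measure-U) {X , _} {Y , _}
          }
        ; additive = λ {X} {Y} _ _ _ → SignedMeasure.additive measure-U {X} {Y} _ _ _
        }

      module ν = Charge ν

      mass-atom : ∀ i → ν.charge (pos i) ≃ charge (pos i)
      mass-atom i = ≃-trans (≡→≃ (cong (value planeMass) (charged-cong (λ P → event-τ P i) (allFin 12)))) (reconstruct i)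

      agree : ∀ x → ν.charge x ≃ charge x
      agree = charge-determined {ν.charge} {charge} (charge-isCharge ν) (charge-isCharge m) mass-atom

    extension : Σ[ ν ∈ SignedMeasure Ω U ]
                (∀ {X} (X∈E : E X) → SignedMeasure.measure ν X _ ≈ℝ SignedMeasure.measure m X X∈E)
    extension = measure-U , λ {X} (x , r) →
      un≃ (≃-trans (ν.measure-charge {x} {X} r) (≃-trans (agree x) (≃-sym (measure-charge {x} {X} r))))

  regular : IsRegular Ω E
  regular = Extension.extension

theorem2p1 : ∀ c ℓ₁ ℓ₂ →
    ((L : OrthomodularPoset c ℓ₁ ℓ₂) → IsFinite L → IsHomogeneous L 3 3 → HasCard (Atoms L) 15 → L ≅ 𝓛³₂)
    × (Σ[ L₁₇ ∈ OrthomodularPoset 0ℓ 0ℓ 0ℓ ] Σ[ L₂₇ ∈ OrthomodularPoset 0ℓ 0ℓ 0ℓ ]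
    (IsFinite L₁₇ × IsHomogeneous L₁₇ 3 3 × HasCard (Atoms L₁₇) 17)
    × (IsFinite L₂₇ × IsHomogeneous L₂₇ 3 3 × HasCard (Atoms L₂₇) 27)
    × (¬ Setoid.Carrier (𝐒₂ L₁₇) × StateSpace≅Segment L₁₇ 0ℝ (fromℚ (+ 2 / 3)))
    × (IsFull L₂₇ U × IsConcreteLogic (𝐒₂ L₂₇) (TotalRepresentation L₂₇) × IsRegular (𝐒₂ L₂₇) (TotalRepresentation L₂₇)))
theorem2p1 c ℓ₁ ℓ₂ =
  (λ L (≤? , _ , card) homogeneous atoms → FifteenAtoms.iso L ≤? card homogeneous atoms) ,
  L₁₇ , L₂₇ ,
  (Logic.finite configuration₁₇ , Logic.homogeneous configuration₁₇ , Logic.atoms-card configuration₁₇) ,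
  (Logic.finite configuration₂₇ , Logic.homogeneous configuration₂₇ , Logic.atoms-card configuration₂₇) ,
  (no-two-valued , state-space) ,
  (full₂₇ , TotalRep.concrete L₂₇ full₂₇ , regular)
  where
  open Seventeen using (configuration₁₇; L₁₇; no-two-valued; state-space)
  open TwentySeven using (configuration₂₇; L₂₇; full₂₇; regular)
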